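{- There is an $\mathsf{MSO}$-transduction $\tau$ such that for every weakly-partitive set system $(U,\mathcal S)$, modelled by the $\{\mathsf{SET}\}$-structure $\mathbb S$, $\tau$ on input $\mathbb S$ outputs the weakly-partitive tree $(T,\lambda,<)$ of $(U,\mathcal S)$; that is, $\tau(\mathbb S)$ is non-empty and every structure in $\tau(\mathbb S)$ models (up to isomorphism) a weakly-partitive tree of $(U,\mathcal S)$.
   Context: All structures are finite. Vocabularies contain relation names (interpreted by relations on elements) and set predicate names (interpreted by relations on subsets of the universe). $\mathsf{MSO}$ is monadic second-order logic without counting predicates. Set systems. A set system $(U,\mathcal S)$ here consists of a finite non-empty set $U$ and a family $\mathcal S$ of non-empty subsets of $U$ with $U\in\mathcal S$ and $\{u\}\in\mathcal S$ for all $u\in U$. It is modelled by the structure with universe $U$ over $\{\mathsf{SET}\}$, where $\mathsf{SET}(X)$ holds iff $X\in\mathcal S$. Two sets cross if they intersect and neither contains the other. $(U,\mathcal S)$ is weakly-partitive if for all crossing $F_1,F_2\in\mathcal S$ the sets $F_1\cap F_2$, $F_1\setminus F_2$, $F_2\setminus F_1$, $F_1\cup F_2$ belong to $\mathcal S$. Weakly-partitive tree. Let $\mathcal S^!\subseteq\mathcal S$ be the family of sets in $\mathcal S$ crossing no other set of $\mathcal S$; let $T$ be its laminar tree, i.e. the rooted tree with one node per set in $\mathcal S^!$, descendant relation given by inclusion, and leaves identified with the elements of $U$. A weakly-partitive tree of $(U,\mathcal S)$ is a triple $(T,\lambda,<)$ where $\lambda$ maps inner nodes of $T$ to $\{\mathsf{prime},\mathsf{degenerate},\mathsf{linear}\}$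 and $<$ is a partial order which linearly orders the children of each $\mathsf{linear}$ node (and relates no other pairs), such that for each inner node $t$ with children $s_0,\dots,s_\ell$, writing $L_I$ for the set of leaves below some $s_i$, $i\in I$: (prime) if $\lambda(t)=\mathsf{prime}$, then the set of leaves below $t$ is in $\mathcal S$ and $L_I\notin\mathcal S$ for every $I\subseteq\{0,\dots,\ell\}$ with $2\le|I|\le\ell$; (degenerate) if $\lambda(t)=\mathsf{degenerate}$, then $L_I\in\mathcal S$ for every non-empty $I\subseteq\{0,\dots,\ell\}$; (linear) if $\lambda(t)=\mathsf{linear}$, with children numbered so that $s_0<\dots<s_\ell$, then for non-empty $I\subseteq\{0,\dots,\ell\}$, $L_I\in\mathcal S$ iff $I$ is an interval; and moreover every set in $\mathcal S$ is of one of these forms (a set $L_I$ for some inner node $t$, or a singleton leaf set). Such a triple exists and is unique up to reversing the orders at linear nodes and up to the label of nodes with only two children. It is modelled as a structure with universe $V(T)$ with the binary relation $\mathsf{desc}$ ($\mathsf{desc}(x,y)$ iff $x$ is a descendant of $y$, including $x=y$), unary relations for the three labels, and the binary relation $<$. Transductions. A transduction from vocabulary $\Sigma$ to $\Gamma$ is a set $\tau$ of pairs ($\Sigma$-structure, $\Gamma$-structure); $\tau(\mathbb A)=\{\mathbb B:(\mathbb A,\mathbb B)\in\tau\}$. An $\mathsf{MSO}$-transduction is a composition of finitely many atomic transductions of the kinds: (Colouring) for some $k$, add $k$ new unary relations, every possible interpretation giving an output; (Copying) for some $k$, add $k$ disjoint copies of the universe, keep the old relations and predicates on the original elements, and add binary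 relations $\mathsf{copy}_i(x,y)$, $0\le i\le k$, saying that $x$ is the $i$-th copy of the original element $y$ (with $\mathsf{copy}_0(x,y)$ meaning $x=y$ is original); (Filtering) for an $\mathsf{MSO}$-sentence $\chi$, output the input unchanged if it satisfies $\chi$ and output nothing otherwise; (Interpretation) given $\mathsf{MSO}$-formulas $\phi(x)$ and $\psi_Q$ for $Q\in\Gamma$ (with as many free variables as the arity of $Q$, set variables if $Q$ is a set predicate), output the $\Gamma$-structure whose universe is the set of elements satisfying $\phi$ and in which each $Q\in\Gamma$ is interpreted as the set of tuples (over the new universe) satisfying $\psi_Q$. -}

module Defs where

open import Data.Bool using (Bool; true; false; T)
open import Data.Empty using (⊥)
open import Data.Fin as Fin using (Fin; zero; suc)
open import Data.Fin.Properties using (any?)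
open import Data.Fin.Subset as Subset
  using (Subset; ⁅_⁆; ⋃; _∩_; _∪_; _─_; ∣_∣; Nonempty)
open import Data.Fin.Subset.Properties using (_∈?_; _⊆?_; _⊂?_)
open import Data.List as List using (List; []; _∷_; _++_; allFin; filter)
open import Data.List.Membership.Propositional as List using ()
open import Data.List.Membership.Propositional.Properties
  using (∈-map⁺; ∈-++⁺ˡ; ∈-++⁺ʳ; ∈-allFin)
open import Data.List.Relation.Unary.Any using (here; there)
open import Data.Nat using (ℕ; suc; NonZero; _≤_)
open import Data.Product using (∃; _×_; _,_; map₂)
open import Data.Sum using (_⊎_)
open import Data.Vec as Vec using (Vec; []; _∷_; lookup)
open import Function using (_∘_; _↔_; _⇔_; Inverse; Injective)
open import Level using (0ℓ)
open import Relation.Binary using (Rel; Decidable; DecidableEquality; IsStrictPartialOrder)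
open import Relation.Binary.Construct.Closure.ReflexiveTransitive using (Star; ε; _◅_)
open import Relation.Binary.PropositionalEquality using (_≡_; _≢_; refl)
open import Relation.Nullary using (¬_; Dec; does; yes; no)

------------------------------------------------------------------------
-- Unions and images of subsets

⋃[_] : ∀ {k n} → Subset k → (Fin k → Subset n) → Subset n
⋃[ I ] F = ⋃ (List.map F (filter (_∈? I) (allFin _)))

image : ∀ {m n} → (Fin m → Fin n) → Subset m → Subset n
image f X = ⋃[ X ] (⁅_⁆ ∘ f)

------------------------------------------------------------------------
-- Vocabularies and structures

-- A finite collection of names, indexed by their arities.

Finite : (ℕ → Set) → Set
Finite N = ∃ λ (names : List (∃ N)) → ∀ {r} (Q : N r) → (r , Q) List.∈ names

record Vocabulary : Set₁ where
  field
    RelName    : ℕ → Set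
    SetName    : ℕ → Set
    relFinite  : Finite RelName
    setFinite  : Finite SetName

open Vocabulary public

-- Every finite structure is isomorphic to one whose universe is some Fin n.

record Structure (Γ : Vocabulary) : Set where
  field
    size : ℕ
    rel  : ∀ {r} → RelName Γ r → Vec (Fin size) r → Bool
    pred : ∀ {r} → SetName Γ r → Vec (Subset size) r → Bool

open Structure public

record _≅_ {Γ : Vocabulary} (𝔸 𝔹 : Structure Γ) : Set where
  field
    bijection : Fin (size 𝔸) ↔ Fin (size 𝔹)

  open Inverse bijection public using (to)

  field
    rel-≅  : ∀ {r} (Q : RelName Γ r) xs → rel 𝔸 Q xs ≡ rel 𝔹 Q (Vec.map to xs)
    pred-≅ : ∀ {r} (Q : SetName Γ r) Xs → pred 𝔸 Q Xs ≡ pred 𝔹 Q (Vec.map (image to) Xs)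

------------------------------------------------------------------------
-- Monadic second-order logic

-- Formula Γ e s: formulas with e element variables and s set variables, both as
-- de Bruijn indices.

infix  7 _≈̇_ _∈̇_
infix  6 ¬̇_
infixr 5 _∧̇_
infixr 4 _∨̇_

data Formula (Γ : Vocabulary) (e s : ℕ) : Set where
  _≈̇_       : Fin e → Fin e → Formula Γ e s
  _∈̇_       : Fin e → Fin s → Formula Γ e s
  relation   : ∀ {r} → RelName Γ r → Vec (Fin e) r → Formula Γ e s
  predicate  : ∀ {r} → SetName Γ r → Vec (Fin s) r → Formula Γ e s
  ¬̇_        : Formula Γ e s → Formula Γ e s
  _∧̇_ _∨̇_  : Formula Γ e s → Formula Γ e s → Formula Γ e s
  ∃ᵉ ∀ᵉ      : Formula Γ (suc e) s → Formula Γ e s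
  ∃ˢ ∀ˢ      : Formula Γ e (suc s) → Formula Γ e s

infix 3 _⊨_[_,_]

-- Satisfaction is decidable as structures are finite, so the intuitionistic
-- reading of the connectives agrees with the classical one.

_⊨_[_,_] : ∀ {Γ e s} (𝔸 : Structure Γ) → Formula Γ e s →
           Vec (Fin (size 𝔸)) e → Vec (Subset (size 𝔸)) s → Set
𝔸 ⊨ x ≈̇ y          [ ρ , σ ] = lookup ρ x ≡ lookup ρ y
𝔸 ⊨ x ∈̇ X          [ ρ , σ ] = lookup ρ x Subset.∈ lookup σ X
𝔸 ⊨ relation Q xs  [ ρ , σ ] = T (rel 𝔸 Q (Vec.map (lookup ρ) xs))
𝔸 ⊨ predicate Q Xs [ ρ , σ ] = T (pred 𝔸 Q (Vec.map (lookup σ) Xs))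
𝔸 ⊨ ¬̇ φ           [ ρ , σ ] = ¬ (𝔸 ⊨ φ [ ρ , σ ])
𝔸 ⊨ φ ∧̇ ψ          [ ρ , σ ] = (𝔸 ⊨ φ [ ρ , σ ]) × (𝔸 ⊨ ψ [ ρ , σ ])
𝔸 ⊨ φ ∨̇ ψ          [ ρ , σ ] = (𝔸 ⊨ φ [ ρ , σ ]) ⊎ (𝔸 ⊨ ψ [ ρ , σ ])
𝔸 ⊨ ∃ᵉ φ           [ ρ , σ ] = ∃ λ x → 𝔸 ⊨ φ [ x ∷ ρ , σ ]
𝔸 ⊨ ∀ᵉ φ           [ ρ , σ ] = ∀ x → 𝔸 ⊨ φ [ x ∷ ρ , σ ]
𝔸 ⊨ ∃ˢ φ           [ ρ , σ ] = ∃ λ X → 𝔸 ⊨ φ [ ρ , X ∷ σ ]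
𝔸 ⊨ ∀ˢ φ           [ ρ , σ ] = ∀ X → 𝔸 ⊨ φ [ ρ , X ∷ σ ]

------------------------------------------------------------------------
-- Atomic transductions

data ColouredName (N : ℕ → Set) (k : ℕ) : ℕ → Set where
  old    : ∀ {r} → N r → ColouredName N k r
  colour : Fin k → ColouredName N k 1

data CopiedName (N : ℕ → Set) (k : ℕ) : ℕ → Set where
  old  : ∀ {r} → N r → CopiedName N k r
  copy : Fin (suc k) → CopiedName N k 2

colouredFinite : ∀ {N} k → Finite N → Finite (ColouredName N k)
colouredFinite {N} k (names , complete) = List.map (map₂ old) names ++ colours , λ where
    (old Q)    → ∈-++⁺ˡ (∈-map⁺ (map₂ old) (complete Q))
    (colour i) → ∈-++⁺ʳ (List.map (map₂ old) names) (∈-map⁺ _ (∈-allFin i))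
  where
  colours : List (∃ (ColouredName N k))
  colours = List.map (λ i → 1 , colour i) (allFin k)

copiedFinite : ∀ {N} k → Finite N → Finite (CopiedName N k)
copiedFinite {N} k (names , complete) = List.map (map₂ old) names ++ copies , λ where
    (old Q)  → ∈-++⁺ˡ (∈-map⁺ (map₂ old) (complete Q))
    (copy i) → ∈-++⁺ʳ (List.map (map₂ old) names) (∈-map⁺ _ (∈-allFin i))
  where
  copies : List (∃ (CopiedName N k))
  copies = List.map (λ i → 2 , copy i) (allFin (suc k))

withColours : ℕ → Vocabulary → Vocabulary
withColours k Γ = record Γ
  { RelName   = ColouredName (RelName Γ) k
  ; relFinite = colouredFinite k (relFinite Γ)
  }

withCopies : ℕ → Vocabulary → Vocabulary
withCopies k Γ = record Γ
  { RelName   = CopiedName (RelName Γ) k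
  ; relFinite = copiedFinite k (relFinite Γ)
  }

data Atomic : Vocabulary → Vocabulary → Set₁ where
  colouring      : ∀ {Γ} k → Atomic Γ (withColours k Γ)
  copying        : ∀ {Γ} k → Atomic Γ (withCopies k Γ)
  filtering      : ∀ {Γ} → Formula Γ 0 0 → Atomic Γ Γ
  interpretation : ∀ {Γ Δ} →
                   (φ  : Formula Γ 1 0)
                   (ψʳ : ∀ {r} → RelName Δ r → Formula Γ r 0)
                   (ψˢ : ∀ {r} → SetName Δ r → Formula Γ 0 r) →
                   Atomic Γ Δ

forgetColours : ∀ {k Γ} → Structure (withColours k Γ) → Structure Γ
forgetColours 𝔹 = record { size = size 𝔹 ; rel = rel 𝔹 ∘ old ; pred = pred 𝔹 }

record IsCopying (k : ℕ) {Γ} (𝔸 : Structure Γ) (𝔹 : Structure (withCopies k Γ)) : Set where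
  field
    elements : (Fin (suc k) × Fin (size 𝔸)) ↔ Fin (size 𝔹)

  copyOf : Fin (suc k) → Fin (size 𝔸) → Fin (size 𝔹)
  copyOf i x = Inverse.to elements (i , x)

  original : Fin (size 𝔸) → Fin (size 𝔹)
  original = copyOf zero

  field
    old-rel  : ∀ {r} (Q : RelName Γ r) ys →
               T (rel 𝔹 (old Q) ys) ⇔
               (∃ λ xs → ys ≡ Vec.map original xs × T (rel 𝔸 Q xs))
    old-pred : ∀ {r} (Q : SetName Γ r) Ys →
               T (pred 𝔹 Q Ys) ⇔
               (∃ λ Xs → Ys ≡ Vec.map (image original) Xs × T (pred 𝔸 Q Xs))
    copy-rel : ∀ i x y →
               T (rel 𝔹 (copy i) (x ∷ y ∷ [])) ⇔
               (∃ λ z → x ≡ copyOf i z × y ≡ original z)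

record IsInterpretation {Γ Δ}
  (φ  : Formula Γ 1 0)
  (ψʳ : ∀ {r} → RelName Δ r → Formula Γ r 0)
  (ψˢ : ∀ {r} → SetName Δ r → Formula Γ 0 r)
  (𝔸 : Structure Γ) (𝔹 : Structure Δ) : Set where
  field
    embed     : Fin (size 𝔹) → Fin (size 𝔸)
    injective : Injective _≡_ _≡_ embed
    universe  : ∀ x → (∃ λ y → embed y ≡ x) ⇔ (𝔸 ⊨ φ [ x ∷ [] , [] ])
    rel-⇔     : ∀ {r} (Q : RelName Δ r) ys →
                T (rel 𝔹 Q ys) ⇔ (𝔸 ⊨ ψʳ Q [ Vec.map embed ys , [] ])
    pred-⇔    : ∀ {r} (Q : SetName Δ r) Ys →
                T (pred 𝔹 Q Ys) ⇔ (𝔸 ⊨ ψˢ Q [ [] , Vec.map (image embed) Ys ])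

⟦_⟧ᵃ : ∀ {Γ Δ} → Atomic Γ Δ → Structure Γ → Structure Δ → Set
⟦ colouring k            ⟧ᵃ 𝔸 𝔹 = forgetColours 𝔹 ≡ 𝔸
⟦ copying k              ⟧ᵃ 𝔸 𝔹 = IsCopying k 𝔸 𝔹
⟦ filtering χ            ⟧ᵃ 𝔸 𝔹 = (𝔸 ⊨ χ [ [] , [] ]) × 𝔹 ≡ 𝔸
⟦ interpretation φ ψʳ ψˢ ⟧ᵃ 𝔸 𝔹 = IsInterpretation φ ψʳ ψˢ 𝔸 𝔹

------------------------------------------------------------------------
-- MSO-transductions

MSOTransduction : Vocabulary → Vocabulary → Set₁
MSOTransduction = Star Atomic

⟦_⟧ : ∀ {Γ Δ} → MSOTransduction Γ Δ → Structure Γ → Structure Δ → Set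
⟦ ε     ⟧ 𝔸 𝔹 = 𝔹 ≡ 𝔸
⟦ α ◅ τ ⟧ 𝔸 ℂ = ∃ λ 𝔹 → ⟦ α ⟧ᵃ 𝔸 𝔹 × ⟦ τ ⟧ 𝔹 ℂ

------------------------------------------------------------------------
-- Set systems

record SetSystem : Set where
  field
    card       : ℕ
    ⦃ card≢0 ⦄ : NonZero card
    member     : Subset card → Bool

  infix 4 _∈𝒮
  _∈𝒮 : Subset card → Set
  X ∈𝒮 = T (member X)

  field
    members-nonempty : ∀ X → X ∈𝒮 → Nonempty X
    whole∈𝒮          : Subset.⊤ ∈𝒮
    singleton∈𝒮      : ∀ u → ⁅ u ⁆ ∈𝒮

Cross : ∀ {n} → Subset n → Subset n → Set
Cross F G = Nonempty (F ∩ G) × F Subset.⊈ G × G Subset.⊈ F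

WeaklyPartitive : SetSystem → Set
WeaklyPartitive 𝒮 = ∀ F G → F ∈𝒮 → G ∈𝒮 → Cross F G →
    (F ∩ G) ∈𝒮 × (F ─ G) ∈𝒮 × (G ─ F) ∈𝒮 × (F ∪ G) ∈𝒮
  where open SetSystem 𝒮

Strong : (𝒮 : SetSystem) → Subset (SetSystem.card 𝒮) → Set
Strong 𝒮 X = X ∈𝒮 × (∀ Y → Y ∈𝒮 → ¬ Cross X Y)
  where open SetSystem 𝒮

data SETName : ℕ → Set where
  SET : SETName 1

setVocabulary : Vocabulary
setVocabulary = record
  { RelName   = λ _ → ⊥
  ; SetName   = SETName
  ; relFinite = [] , λ ()
  ; setFinite = (1 , SET) ∷ [] , λ where SET → here refl
  }

setStructure : SetSystem → Structure setVocabulary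
setStructure 𝒮 = record
  { size = card
  ; rel  = λ ()
  ; pred = λ where SET (X ∷ []) → member X
  }
  where open SetSystem 𝒮

------------------------------------------------------------------------
-- Laminar trees

-- A node is given with the strong set it stands for.  The leaf identified with
-- u is the node of ⁅ u ⁆, which lies below t iff u ∈ leaves t.

record LaminarTree (𝒮 : SetSystem) : Set where
  open SetSystem 𝒮
  field
    nodes     : ℕ
    leaves    : Fin nodes → Subset card
    strong    : ∀ t → Strong 𝒮 (leaves t)
    injective : Injective _≡_ _≡_ leaves
    complete  : ∀ X → Strong 𝒮 X → ∃ λ t → leaves t ≡ X

  Node : Set
  Node = Fin nodes

  infix 4 _≼_ _≺_
  _≼_ _≺_ : Node → Node → Set
  s ≼ t = leaves s Subset.⊆ leaves t
  s ≺ t = leaves s Subset.⊂ leaves t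

  _≼?_ : Decidable _≼_
  s ≼? t = leaves s ⊆? leaves t

  Inner : Node → Set
  Inner t = ∃ λ s → s ≺ t

  inner? : ∀ t → Dec (Inner t)
  inner? t = any? λ s → leaves s ⊂? leaves t

  Child : Node → Node → Set
  Child s t = s ≺ t × ¬ (∃ λ r → s ≺ r × r ≺ t)

  -- A numbering child 0, …, child ℓ of the children of t.

  record Children (t : Node) : Set where
    field
      ℓ               : ℕ
      child           : Fin (suc ℓ) → Node
      child-injective : Injective _≡_ _≡_ child
      is-child        : ∀ i → Child (child i) t
      child-complete  : ∀ s → Child s t → ∃ λ i → child i ≡ s

    L : Subset (suc ℓ) → Subset card
    L I = ⋃[ I ] (leaves ∘ child)

------------------------------------------------------------------------
-- Weakly-partitive trees

data Label : Set where
  prime degenerate linear : Label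

infix 4 _≟ˡ_
_≟ˡ_ : DecidableEquality Label
prime      ≟ˡ prime      = yes refl
prime      ≟ˡ degenerate = no λ ()
prime      ≟ˡ linear     = no λ ()
degenerate ≟ˡ prime      = no λ ()
degenerate ≟ˡ degenerate = yes refl
degenerate ≟ˡ linear     = no λ ()
linear     ≟ˡ prime      = no λ ()
linear     ≟ˡ degenerate = no λ ()
linear     ≟ˡ linear     = yes refl

Interval : ∀ {n} → Subset n → Set
Interval I = ∀ i j k → i Fin.≤ j → j Fin.≤ k → i Subset.∈ I → k Subset.∈ I → j Subset.∈ I

record WeaklyPartitiveTree (𝒮 : SetSystem) : Set₁ where
  open SetSystem 𝒮
  field
    tree : LaminarTree 𝒮

  open LaminarTree tree public
  open Children

  field
    label : ∀ t → .(Inner t) → Label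

  Linear : Node → Set
  Linear t = ∃ λ (i : Inner t) → label t i ≡ linear

  infix 4 _<_
  field
    _<_      : Rel Node 0ℓ
    _<?_     : Decidable _<_
    <-strict : IsStrictPartialOrder _≡_ _<_
    <-total  : ∀ t → Linear t → ∀ s s′ → Child s t → Child s′ t → s ≢ s′ → s < s′ ⊎ s′ < s
    <-only   : ∀ s s′ → s < s′ → ∃ λ t → Linear t × Child s t × Child s′ t

    prime-node : ∀ t (i : Inner t) → label t i ≡ prime →
      leaves t ∈𝒮 ×
      (∀ (c : Children t) I → 2 ≤ ∣ I ∣ → ∣ I ∣ ≤ ℓ c → ¬ (L c I ∈𝒮))

    degenerate-node : ∀ t (i : Inner t) → label t i ≡ degenerate →
      ∀ (c : Children t) I → Nonempty I → L c I ∈𝒮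

    linear-node : ∀ t (i : Inner t) → label t i ≡ linear →
      ∀ (c : Children t) → (∀ i j → i Fin.< j → child c i < child c j) →
      ∀ I → Nonempty I → L c I ∈𝒮 ⇔ Interval I

    exhaustive : ∀ X → X ∈𝒮 →
      (∃ λ u → X ≡ ⁅ u ⁆) ⊎
      (∃ λ t → Inner t × ∃ λ (c : Children t) → ∃ λ I → X ≡ L c I)

data TreeName : ℕ → Set where
  desc   : TreeName 2
  marked : Label → TreeName 1
  less   : TreeName 2

treeVocabulary : Vocabulary
treeVocabulary = record
  { RelName   = TreeName
  ; SetName   = λ _ → ⊥
  ; relFinite = (2 , desc) ∷ (1 , marked prime) ∷ (1 , marked degenerate) ∷
                (1 , marked linear) ∷ (2 , less) ∷ [] , λ where
      desc                → here refl
      (marked prime)      → there (here refl)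
      (marked degenerate) → there (there (here refl))
      (marked linear)     → there (there (there (here refl)))
      less                → there (there (there (there (here refl))))
  ; setFinite = [] , λ ()
  }

treeStructure : ∀ {𝒮} → WeaklyPartitiveTree 𝒮 → Structure treeVocabulary
treeStructure W = record { size = nodes ; rel = interpret ; pred = λ () }
  where
  open WeaklyPartitiveTree W

  hasLabel : Label → Node → Bool
  hasLabel l t with inner? t
  ... | yes i = does (label t i ≟ˡ l)
  ... | no _  = false

  interpret : ∀ {r} → TreeName r → Vec Node r → Bool
  interpret desc       (x ∷ y ∷ []) = does (x ≼? y)
  interpret (marked l) (x ∷ [])     = hasLabel l x
  interpret less       (x ∷ y ∷ []) = does (x <? y)

{-# OPTIONS --safe #-}

-- The strong sets carry a three-colouring in which the children of a node use
-- exactly the two colours other than its own.  Membership of a strong set in a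
-- colour class i is the outcome of a game, decided by the colours of the leaves:
-- a node has colour i iff none of its children has, so a set of leaves spanning a
-- strategy (all children below a node of colour i, one child of colour i below
-- any other) certifies it, and no counting is needed to verify a strategy.  Every
-- node of colour i represents itself by a leaf which it reaches by avoiding
-- colour i, and is recovered from that leaf as the least strong superset of
-- colour i; distinct nodes of one colour thus get distinct leaves, and three
-- copies of the leaves suffice for the inner nodes.  As the first step of the
-- descent is free, it can go to an end of the order of a linear node, which makes
-- that order definable.
--
-- That every node is prime, degenerate or linear is a statement about families
-- all of whose non-trivial members are crossed.  If such a family has a
-- non-trivial member then any such member can be left along a two-element member.
-- Hence if some complement of a point e is a member, either the members containing
-- e form a chain, whose order makes the members the intervals, or three disjoint
-- members with all unions shrink to a triangle of two-element members, which grows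
-- to show that all non-empty sets are members.

module Submission where

open import Defs
open import Data.Bool using (Bool; true; false; T)
open import Data.Bool.Properties as Bool using (T?)
open import Data.Empty using (⊥; ⊥-elim)
open import Data.Fin as Fin using (Fin; zero; suc; toℕ)
open import Data.Fin.Properties
  using (any?; all?; toℕ-injective; toℕ<n; toℕ-fromℕ<; *↔×; splitAt-↑ˡ; splitAt-↑ʳ)
open import Data.Fin.Subset
  using (Subset; ⁅_⁆; _∈_; _∉_; _⊆_; _⊈_; _⊂_; _∩_; _∪_; _─_; ∣_∣; Nonempty)
  renaming (⊤ to full)
open import Data.Fin.Subset.Properties
open import Data.List as List using (List; []; _∷_)
open import Data.List.Membership.Propositional as List using ()
open import Data.List.Membership.Propositional.Properties
  using (∈-map⁺; ∈-map⁻; ∈-++⁺ˡ; ∈-++⁺ʳ; ∈-allFin; ∈-filter⁺; ∈-filter⁻; ∈-lookup; ∈-cartesianProductWith⁺)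
open import Data.List.Relation.Unary.Any using (here; there; index)
open import Data.List.Relation.Unary.Any.Properties using (lookup-index)
open import Data.List.Relation.Unary.AllPairs using ([]; _∷_)
open import Data.List.Relation.Unary.All as All using ([]; _∷_)
open import Data.List.Relation.Unary.Unique.Propositional using (Unique)
import Data.List.Relation.Unary.Unique.Propositional.Properties as Unique
open import Data.Nat as ℕ using (ℕ; zero; suc; _+_; _∸_; z≤n; s≤s)
import Data.Nat.Properties as ℕ
open import Data.Nat.Induction using (<-wellFounded)
open import Data.Product using (Σ; ∃; _×_; _,_; proj₁; proj₂; uncurry)
open import Data.Sum using (_⊎_; inj₁; inj₂; [_,_]′)
open import Data.Vec as Vec using (Vec; []; _∷_; lookup)
open import Data.Vec.Properties using (lookup∘tabulate; lookup⇒[]=; []=⇒lookup; ≡-dec)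
open import Function using (_∘_; id; _⇔_; mk⇔; Equivalence; _↔_; Inverse; mk↔ₛ′)
open import Function.Properties.Inverse using (↔-sym)
open import Induction.WellFounded using (Acc; acc)
open import Relation.Binary.Construct.Closure.ReflexiveTransitive using (ε; _◅_)
open import Relation.Binary.PropositionalEquality
  using (_≡_; _≢_; refl; sym; trans; cong; cong₂; subst; subst₂; isEquivalence)
open import Relation.Nullary using (¬_; Dec; yes; no; does; contradiction)
open import Relation.Nullary.Decidable
  using (decidable-stable; dec-true; dec-false; ¬?; _×-dec_; _⊎-dec_; _→-dec_; map′)
open import Relation.Unary using (Decidable)

-- Finite subsets

-- Only elements can be marked, and each can code only boundedly many inner nodes, so colours of
-- inner nodes have to be recovered from marks on the leaves below. Two alternating colours would
-- not do: below a node of colour `i` every grandchild would have colour `i` again, and no leaf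
-- deeper than a child could be reached while avoiding it. With three colours, the two or more
-- children of an inner node suffice to show both other colours. Hence a descent avoiding `i` always
-- finds a child to continue in, and an inner node lacks colour `i` exactly when some child has it,
-- which is the rule of the game.
--
-- The filter does not try to recognise the intended colouring. It demands only the properties that
-- the decoding consumes, so a different guess may pass and still yields a correct tree; the
-- intended colouring serves to show that some guess passes.

module _ {n : ℕ} where

  ∈∩⁺ : ∀ {F G : Subset n} {x} → x ∈ F → x ∈ G → x ∈ F ∩ G
  ∈∩⁺ x∈F x∈G = x∈p∩q⁺ (x∈F , x∈G)

  ∈∩ˡ : ∀ {F G : Subset n} {x} → x ∈ F ∩ G → x ∈ F
  ∈∩ˡ {F} {G} = p∩q⊆p F G

  ∈∩ʳ : ∀ {F G : Subset n} {x} → x ∈ F ∩ G → x ∈ G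
  ∈∩ʳ {F} {G} = p∩q⊆q F G

  ∈∪ˡ : ∀ {F G : Subset n} {x} → x ∈ F → x ∈ F ∪ G
  ∈∪ˡ {F} {G} = p⊆p∪q G

  ∈∪ʳ : ∀ {F G : Subset n} {x} → x ∈ G → x ∈ F ∪ G
  ∈∪ʳ {F} {G} = q⊆p∪q F G

  ∈∪⁻ : ∀ {F G : Subset n} {x} → x ∈ F ∪ G → x ∈ F ⊎ x ∈ G
  ∈∪⁻ {F} {G} = x∈p∪q⁻ F G

  ∈─⁺ : ∀ {F G : Subset n} {x} → x ∈ F → x ∉ G → x ∈ F ─ G
  ∈─⁺ = x∈p∧x∉q⇒x∈p─q

  ∈─ˡ : ∀ {F G : Subset n} {x} → x ∈ F ─ G → x ∈ F
  ∈─ˡ {F} {G} = p─q⊆p F G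

∈─ʳ : ∀ {n} {F G : Subset n} {x} → x ∈ F ─ G → x ∉ G
∈─ʳ {F = _ ∷ F} {_ ∷ G} {suc x} (Vec.there x∈) (Vec.there x∈G) = ∈─ʳ {F = F} {G} x∈ x∈G
∈─ʳ {F = true  ∷ F} {true ∷ G} {zero} () Vec.here
∈─ʳ {F = false ∷ F} {true ∷ G} {zero} () Vec.here

module _ {n : ℕ} where

  ∈-stable : ∀ {F : Subset n} {x} → ¬ (x ∉ F) → x ∈ F
  ∈-stable {F} {x} = decidable-stable (x ∈? F)

  ⊈⇒∃ : ∀ {F G : Subset n} → F ⊈ G → ∃ λ x → x ∈ F × x ∉ G
  ⊈⇒∃ {F} {G} F⊈G with any? (λ x → (x ∈? F) ×-dec ¬? (x ∈? G))
  ... | yes found = found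
  ... | no ¬found = ⊥-elim (F⊈G λ x∈F → ∈-stable λ x∉G → ¬found (_ , x∈F , x∉G))

  ∃⇒⊈ : ∀ {F G : Subset n} {x} → x ∈ F → x ∉ G → F ⊈ G
  ∃⇒⊈ x∈F x∉G F⊆G = x∉G (F⊆G x∈F)

  ⊆∧≢⇒⊂ : ∀ {F G : Subset n} → F ⊆ G → F ≢ G → F ⊂ G
  ⊆∧≢⇒⊂ F⊆G F≢G = F⊆G , ⊈⇒∃ (F≢G ∘ ⊆-antisym F⊆G)

  singleton-⊆ : ∀ {F : Subset n} {x} → x ∈ F → ⁅ x ⁆ ⊆ F
  singleton-⊆ {F} {x} x∈F y∈ = subst (_∈ F) (sym (x∈⁅y⁆⇒x≡y x y∈)) x∈F

  pair : Fin n → Fin n → Subset n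
  pair x y = ⁅ x ⁆ ∪ ⁅ y ⁆

  ∈pairˡ : ∀ {x y} → x ∈ pair x y
  ∈pairˡ {x} {y} = ∈∪ˡ (x∈⁅x⁆ x)

  ∈pairʳ : ∀ {x y} → y ∈ pair x y
  ∈pairʳ {x} {y} = ∈∪ʳ (x∈⁅x⁆ y)

  ∈pair⁻ : ∀ {x y z} → z ∈ pair x y → z ≡ x ⊎ z ≡ y
  ∈pair⁻ {x} {y} z∈ with ∈∪⁻ z∈
  ... | inj₁ z∈x = inj₁ (x∈⁅y⁆⇒x≡y x z∈x)
  ... | inj₂ z∈y = inj₂ (x∈⁅y⁆⇒x≡y y z∈y)

  ∉pair : ∀ {x y z : Fin n} → z ≢ x → z ≢ y → z ∉ pair x y
  ∉pair z≢x z≢y z∈ = [ z≢x , z≢y ]′ (∈pair⁻ z∈)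

  abstract
    comprehension : {P : Fin n → Set} → Decidable P → Subset n
    comprehension P? = Vec.tabulate (does ∘ P?)

    ∈comprehension⁺ : {P : Fin n → Set} (P? : Decidable P) → ∀ {x} → P x → x ∈ comprehension P?
    ∈comprehension⁺ P? {x} px = lookup⇒[]= x _ (trans (lookup∘tabulate (does ∘ P?) x) (dec-true (P? x) px))

    ∈comprehension⁻ : {P : Fin n → Set} (P? : Decidable P) → ∀ {x} → x ∈ comprehension P? → P x
    ∈comprehension⁻ P? {x} x∈ with P? x | trans (sym (lookup∘tabulate (does ∘ P?) x)) ([]=⇒lookup x∈)
    ... | yes px | _ = px

  abstract

    someSubset? : {P : Subset n → Set} → Decidable P → Dec (∃ P)
    someSubset? = anySubset?

    allSubset? : {P : Subset n → Set} → Decidable P → Dec (∀ X → P X)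
    allSubset? P? = map′ (λ none X → decidable-stable (P? X) (λ ¬px → none (X , ¬px)))
                         (λ all (X , ¬px) → ¬px (all X))
                         (¬? (anySubset? (¬? ∘ P?)))

    minimal : (f : Subset n → ℕ) {P : Subset n → Set} → Decidable P → ∃ P →
              ∃ λ X → P X × (∀ Y → P Y → f X ℕ.≤ f Y)
    minimal f {P} P? (X , px) = go X px (<-wellFounded (f X))
      where
      go : ∀ X → P X → Acc ℕ._<_ (f X) → ∃ λ X → P X × (∀ Y → P Y → f X ℕ.≤ f Y)
      go X px (acc rec) with anySubset? (λ Y → P? Y ×-dec (f Y ℕ.<? f X))
      ... | yes (Y , py , Y<X) = go Y py (rec Y<X)
      ... | no none = X , px , λ Y py → ℕ.≮⇒≥ λ Y<X → none (Y , py , Y<X)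

    smallest : {P : Subset n → Set} → Decidable P → ∃ P → ∃ λ X → P X × (∀ Y → P Y → ¬ (Y ⊂ X))
    smallest P? ∃P with minimal ∣_∣ P? ∃P
    ... | X , px , least = X , px , λ Y py Y⊂X → ℕ.<⇒≱ (p⊂q⇒∣p∣<∣q∣ Y⊂X) (least Y py)

    largest : {P : Subset n → Set} → Decidable P → ∃ P → ∃ λ X → P X × (∀ Y → P Y → ¬ (X ⊂ Y))
    largest P? ∃P with minimal (λ X → n ∸ ∣ X ∣) P? ∃P
    ... | X , px , least = X , px , λ Y py X⊂Y →
      ℕ.<⇒≱ (ℕ.∸-monoʳ-< (p⊂q⇒∣p∣<∣q∣ X⊂Y) (∣p∣≤n Y)) (least Y py)

-- Families without non-trivial uncrossed members

Nontrivial : ∀ {n} → Subset n → Set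
Nontrivial C = (∃ λ x → ∃ λ y → x ∈ C × y ∈ C × x ≢ y) × (∃ λ z → z ∉ C)

nontrivial? : ∀ {n} → Decidable (Nontrivial {n})
nontrivial? C = any? (λ x → any? (λ y → (x ∈? C) ×-dec (y ∈? C) ×-dec ¬? (x Fin.≟ y)))
                ×-dec any? (λ z → ¬? (z ∈? C))

-- The situation at one node: points are its children, and `Q` holds of an index set whose union is
-- a member. The field `crossed` reflects that a non-trivial uncrossed union would be a strong set
-- strictly between a child and the node.
record CrossedFamily {n} (Q : Subset n → Set) : Set where
  field
    member?   : Decidable Q
    nonempty  : ∀ F → Q F → Nonempty F
    whole     : Q full
    singleton : ∀ x → Q ⁅ x ⁆
    closed    : ∀ F G → Q F → Q G → Cross F G → Q (F ∩ G) × Q (F ─ G) × Q (G ─ F) × Q (F ∪ G)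
    crossed   : ∀ C → Q C → Nontrivial C → ∃ λ H → Q H × Cross C H

module CrossedFamilyProperties {n} {Q : Subset n → Set} (family : CrossedFamily Q) where

  open CrossedFamily family

  respects : ∀ {F G} → Q F → (∀ {x} → x ∈ F → x ∈ G) → (∀ {x} → x ∈ G → x ∈ F) → Q G
  respects {F} {G} QF F⊆G G⊆F = subst Q (⊆-antisym F⊆G G⊆F) QF

  ∪-closed : ∀ {F G x} → Q F → Q G → x ∈ F → x ∈ G → Q (F ∪ G)
  ∪-closed {F} {G} QF QG x∈F x∈G with F ⊆? G | G ⊆? F
  ... | yes F⊆G | _ = respects QG ∈∪ʳ ([ F⊆G , id ]′ ∘ ∈∪⁻)
  ... | no _ | yes G⊆F = respects QF ∈∪ˡ ([ id , G⊆F ]′ ∘ ∈∪⁻)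
  ... | no F⊈G | no G⊈F = proj₂ (proj₂ (proj₂ (closed F G QF QG ((_ , ∈∩⁺ x∈F x∈G) , F⊈G , G⊈F))))

  ∩-closed : ∀ {F G x} → Q F → Q G → x ∈ F → x ∈ G → Q (F ∩ G)
  ∩-closed {F} {G} QF QG x∈F x∈G with F ⊆? G | G ⊆? F
  ... | yes F⊆G | _ = respects QF (λ y∈ → ∈∩⁺ y∈ (F⊆G y∈)) ∈∩ˡ
  ... | no _ | yes G⊆F = respects QG (λ y∈ → ∈∩⁺ (G⊆F y∈) y∈) ∈∩ʳ
  ... | no F⊈G | no G⊈F = proj₁ (closed F G QF QG ((_ , ∈∩⁺ x∈F x∈G) , F⊈G , G⊈F))

  -- The difference of nested members need not be a member, in contrast to union and intersection,
  -- so witnesses on both sides make `F` and `G` cross.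
  ─-closed : ∀ {F G x y z} → Q F → Q G → x ∈ F → x ∈ G → y ∈ F → y ∉ G → z ∈ G → z ∉ F → Q (F ─ G)
  ─-closed QF QG x∈F x∈G y∈F y∉G z∈G z∉F =
    proj₁ (proj₂ (closed _ _ QF QG ((_ , ∈∩⁺ x∈F x∈G) , ∃⇒⊈ y∈F y∉G , ∃⇒⊈ z∈G z∉F)))

  -- The graph of two-element members

  Edge : Fin n → Fin n → Set
  Edge p q = Q (pair p q)

  Edge-sym : ∀ {p q} → Edge p q → Edge q p
  Edge-sym e = respects e (λ z∈ → [ (λ { refl → ∈pairʳ }) , (λ { refl → ∈pairˡ }) ]′ (∈pair⁻ z∈))
                          (λ z∈ → [ (λ { refl → ∈pairʳ }) , (λ { refl → ∈pairˡ }) ]′ (∈pair⁻ z∈))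

  -- A member crossing a part of H yields a smaller member meeting both that
  -- part and its complement in H.
  crossing-part : ∀ {H R r} → Q H → Q R → R ⊆ H → Nontrivial R → r ∈ H → r ∉ R →
    ∃ λ G → Q G × G ⊂ H × (∃ λ a → a ∈ G × a ∈ R) × (∃ λ b → b ∈ G × b ∉ R)
  crossing-part {H} {R} {r} QH QR R⊆H nt r∈H r∉R with crossed R QR nt
  ... | G , QG , (g , g∈) , R⊈G , G⊈R with ⊈⇒∃ R⊈G | ⊈⇒∃ G⊈R | G ⊆? H
  ... | h , h∈R , h∉G | k , k∈G , k∉R | yes G⊆H =
    G , QG , (G⊆H , h , R⊆H h∈R , h∉G) , (g , ∈∩ʳ g∈ , ∈∩ˡ g∈) , (k , k∈G , k∉R)
  ... | h , h∈R , h∉G | k , k∈G , k∉R | no G⊈H with ⊈⇒∃ G⊈H | r ∈? G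
  ... | l , l∈G , l∉H | yes r∈G =
    H ∩ G , ∩-closed QH QG (R⊆H (∈∩ˡ g∈)) (∈∩ʳ g∈) , (∈∩ˡ , h , R⊆H h∈R , h∉G ∘ ∈∩ʳ) ,
    (g , ∈∩⁺ (R⊆H (∈∩ˡ g∈)) (∈∩ʳ g∈) , ∈∩ˡ g∈) , (r , ∈∩⁺ r∈H r∈G , r∉R)
  -- The part of `H` outside `G` keeps both `r` and the point `h` of `R` that `G` misses.
  ... | l , l∈G , l∉H | no r∉G =
    H ─ G , ─-closed QH QG (R⊆H (∈∩ˡ g∈)) (∈∩ʳ g∈) (R⊆H h∈R) h∉G l∈G l∉H ,
    (∈─ˡ , g , R⊆H (∈∩ˡ g∈) , λ g∈─ → ∈─ʳ g∈─ (∈∩ʳ g∈)) ,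
    (h , ∈─⁺ (R⊆H h∈R) h∉G , h∈R) , (r , ∈─⁺ r∈H r∉G , r∉R)

  -- A member `H` crossing `C` is shrunk as long as it has a third point: then `C ∩ H` or `H ─ C`
  -- has two points and is itself crossed, and `crossing-part` turns this into a smaller member
  -- still meeting both sides of `C`. What remains is one point on each side.
  exit : ∀ C → Q C → Nontrivial C → ∃ λ p → ∃ λ q → p ∈ C × q ∉ C × Edge p q
  exit C QC nt with crossed C QC nt
  ... | H , QH , (x , x∈) , C⊈H , H⊈C with ⊈⇒∃ C⊈H | ⊈⇒∃ H⊈C
  ... | w , w∈C , w∉H | y , y∈H , y∉C =
    go H (<-wellFounded _) QH (∈∩ˡ x∈) (∈∩ʳ x∈) y∈H y∉C w∉H
    where
    -- The point `w` of `C` stays outside `H` throughout the shrinking; it makes `H` and `C` cross,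
    -- so that `H ─ C` is a member.
    go : ∀ H → Acc ℕ._<_ ∣ H ∣ → Q H → ∀ {p q} → p ∈ C → p ∈ H → q ∈ H → q ∉ C → w ∉ H →
         ∃ λ p → ∃ λ q → p ∈ C × q ∉ C × Edge p q
    go H (acc rec) QH {p} {q} p∈C p∈H q∈H q∉C w∉H
      with any? (λ r → (r ∈? H) ×-dec ¬? (r Fin.≟ p) ×-dec ¬? (r Fin.≟ q))
    ... | no none = p , q , p∈C , q∉C , respects QH
      (λ {r} r∈H → ∈-stable λ r∉ → none (r , r∈H , (λ { refl → r∉ ∈pairˡ }) , (λ { refl → r∉ ∈pairʳ })))
      (λ r∈ → [ (λ { refl → p∈H }) , (λ { refl → q∈H }) ]′ (∈pair⁻ r∈))
    ... | yes (r , r∈H , r≢p , r≢q) with r ∈? C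
    ...   | yes r∈C
      with crossing-part {H} {C ∩ H} {q} QH (∩-closed QC QH p∈C p∈H) ∈∩ʳ
             ((p , r , ∈∩⁺ p∈C p∈H , ∈∩⁺ r∈C r∈H , r≢p ∘ sym) , q , q∉C ∘ ∈∩ˡ) q∈H (q∉C ∘ ∈∩ˡ)
    ...     | G , QG , G⊂H , (a , a∈G , a∈) , (b , b∈G , b∉) =
      go G (rec (p⊂q⇒∣p∣<∣q∣ G⊂H)) QG (∈∩ˡ a∈) a∈G b∈G (λ b∈C → b∉ (∈∩⁺ b∈C (proj₁ G⊂H b∈G)))
         (w∉H ∘ proj₁ G⊂H)
    go H (acc rec) QH {p} {q} p∈C p∈H q∈H q∉C w∉H | yes (r , r∈H , r≢p , r≢q) | no r∉C
      with crossing-part {H} {H ─ C} {p} QH (─-closed QH QC p∈H p∈C q∈H q∉C w∈C w∉H) ∈─ˡ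
             ((q , r , ∈─⁺ q∈H q∉C , ∈─⁺ r∈H r∉C , r≢q ∘ sym) , p , λ p∈ → ∈─ʳ p∈ p∈C)
             p∈H (λ p∈ → ∈─ʳ p∈ p∈C)
    ...     | G , QG , G⊂H , (a , a∈G , a∈) , (b , b∈G , b∉) =
      go G (rec (p⊂q⇒∣p∣<∣q∣ G⊂H)) QG (∈-stable λ b∉C → b∉ (∈─⁺ (proj₁ G⊂H b∈G) b∉C)) b∈G a∈G (∈─ʳ a∈)
         (w∉H ∘ proj₁ G⊂H)

  -- Three disjoint members with all unions

  record Triple (A B D : Subset n) : Set where
    field
      QA  : Q A
      QB  : Q B
      QD  : Q D
      QAB : Q (A ∪ B)
      QAD : Q (A ∪ D)
      QBD : Q (B ∪ D)
      A#B : ∀ {x} → x ∈ A → x ∉ B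
      A#D : ∀ {x} → x ∈ A → x ∉ D
      B#D : ∀ {x} → x ∈ B → x ∉ D

  ∪-comm⇒ : ∀ {F G} → Q (F ∪ G) → Q (G ∪ F)
  ∪-comm⇒ {F} {G} = subst Q (∪-comm F G)

  swap : ∀ {A B D} → Triple A B D → Triple A D B
  swap t = record
    { QA = QA ; QB = QD ; QD = QB ; QAB = QAD ; QAD = QAB ; QBD = ∪-comm⇒ QBD
    ; A#B = A#D ; A#D = A#B ; B#D = λ x∈D x∈B → B#D x∈B x∈D }
    where open Triple t

  rotate : ∀ {A B D} → Triple A B D → Triple B D A
  rotate t = record
    { QA = QB ; QB = QD ; QD = QA ; QAB = QBD ; QAD = ∪-comm⇒ QAB ; QBD = ∪-comm⇒ QAD
    ; A#B = B#D ; A#D = λ x∈B x∈A → A#B x∈A x∈B ; B#D = λ x∈D x∈A → A#D x∈A x∈D }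
    where open Triple t

  -- As `H` misses `D`, the set `(A ─ H) ∪ D` is `(A ∪ D) ─ H`, a difference of crossing members.
  -- Joining it to `B ∪ D` and cutting with `A ∪ B` removes `D` again and leaves `(A ─ H) ∪ B`.
  shrink-disjoint : ∀ {A B D H u v w} → Triple A B D → Q H → (∀ {x} → x ∈ H → x ∉ D) →
    u ∈ A → u ∈ H → v ∈ A → v ∉ H → w ∈ H → w ∉ A → Triple (A ─ H) B D
  shrink-disjoint {A} {B} {D} {H} {u} {v} {w} t QH H#D u∈A u∈H v∈A v∉H w∈H w∉A = record
    { QA = ─-closed QA QH u∈A u∈H v∈A v∉H w∈H w∉A
    ; QB = QB
    ; QD = QD
    ; QAB = respects (∩-closed (∪-closed QA′D QBD (∈∪ʳ d∈D) (∈∪ʳ d∈D)) QAB (∈∪ʳ (∈∪ˡ b∈B)) (∈∪ʳ b∈B))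
              (λ x∈ → only (∈∪⁻ (∈∩ˡ x∈)) (∈∪⁻ (∈∩ʳ x∈)))
              (λ x∈ → [ (λ x∈A′ → ∈∩⁺ (∈∪ˡ (∈∪ˡ x∈A′)) (∈∪ˡ (∈─ˡ x∈A′))) ,
                        (λ x∈B → ∈∩⁺ (∈∪ʳ (∈∪ˡ x∈B)) (∈∪ʳ x∈B)) ]′ (∈∪⁻ x∈))
    ; QAD = QA′D
    ; QBD = QBD
    ; A#B = A#B ∘ ∈─ˡ
    ; A#D = A#D ∘ ∈─ˡ
    ; B#D = B#D
    }
    where
    open Triple t
    b = proj₁ (nonempty B QB)
    b∈B = proj₂ (nonempty B QB)
    d = proj₁ (nonempty D QD)
    d∈D = proj₂ (nonempty D QD)
    QA′D : Q ((A ─ H) ∪ D)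
    QA′D = respects (─-closed QAD QH (∈∪ˡ u∈A) u∈H (∈∪ʳ d∈D) (λ d∈H → H#D d∈H d∈D)
                      w∈H ([ w∉A , H#D w∈H ]′ ∘ ∈∪⁻))
      (λ x∈ → [ (λ x∈A → ∈∪ˡ (∈─⁺ x∈A (∈─ʳ x∈))) , ∈∪ʳ ]′ (∈∪⁻ (∈─ˡ x∈)))
      (λ x∈ → [ (λ x∈A′ → ∈─⁺ (∈∪ˡ (∈─ˡ x∈A′)) (∈─ʳ x∈A′)) ,
                (λ x∈D → ∈─⁺ (∈∪ʳ x∈D) (λ x∈H → H#D x∈H x∈D)) ]′ (∈∪⁻ x∈))
    only : ∀ {x} → x ∈ (A ─ H) ∪ D ⊎ x ∈ B ∪ D → x ∈ A ⊎ x ∈ B → x ∈ (A ─ H) ∪ B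
    only _ (inj₂ x∈B) = ∈∪ʳ x∈B
    only (inj₁ x∈) (inj₁ x∈A) = [ ∈∪ˡ , (λ x∈D → contradiction x∈D (A#D x∈A)) ]′ (∈∪⁻ x∈)
    only (inj₂ x∈) (inj₁ x∈A) = [ ∈∪ʳ , (λ x∈D → contradiction x∈D (A#D x∈A)) ]′ (∈∪⁻ x∈)

  -- A member crossing `A` can be made to miss one of the other parts. If it meets `B`, cutting it
  -- down to `A ∪ B` makes it miss `D`; if it misses `B`, the roles of `B` and `D` are exchanged.
  shrink : ∀ {A B D} → Triple A B D → Nontrivial A → ∃ λ A′ → A′ ⊂ A × Triple A′ B D
  shrink {A} {B} {D} t nt with crossed A (Triple.QA t) nt
  ... | H , QH , (u , u∈) , A⊈H , H⊈A with ⊈⇒∃ A⊈H | ⊈⇒∃ H⊈A | any? (λ x → (x ∈? H) ×-dec (x ∈? B))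
  ... | v , v∈A , v∉H | w , w∈H , w∉A | no H#B =
    A ─ H , (∈─ˡ , u , ∈∩ˡ u∈ , λ u∈─ → ∈─ʳ u∈─ (∈∩ʳ u∈)) ,
    swap (shrink-disjoint (swap t) QH (λ x∈H x∈B → H#B (_ , x∈H , x∈B)) (∈∩ˡ u∈) (∈∩ʳ u∈) v∈A v∉H w∈H w∉A)
  ... | v , v∈A , v∉H | w , w∈H , w∉A | yes (b , b∈H , b∈B) =
    A ─ H′ , (∈─ˡ , u , ∈∩ˡ u∈ , λ u∈─ → ∈─ʳ u∈─ u∈H′) ,
    shrink-disjoint t (∩-closed QH QAB (∈∩ʳ u∈) (∈∪ˡ (∈∩ˡ u∈)))
      (λ x∈H′ x∈D → [ (λ x∈A → A#D x∈A x∈D) , (λ x∈B → B#D x∈B x∈D) ]′ (∈∪⁻ (∈∩ʳ x∈H′)))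
      (∈∩ˡ u∈) u∈H′ v∈A (v∉H ∘ ∈∩ˡ) (∈∩⁺ b∈H (∈∪ʳ b∈B)) (λ b∈A → A#B b∈A b∈B)
    where
    open Triple t
    H′ = H ∩ (A ∪ B)
    u∈H′ : u ∈ H′
    u∈H′ = ∈∩⁺ (∈∩ʳ u∈) (∈∪ˡ (∈∩ˡ u∈))

  to-point : ∀ {A B D} → Triple A B D → ∃ λ a → Triple ⁅ a ⁆ B D
  to-point {A} t = go A (<-wellFounded _) t
    where
    go : ∀ A → Acc ℕ._<_ ∣ A ∣ → ∀ {B D} → Triple A B D → ∃ λ a → Triple ⁅ a ⁆ B D
    go A (acc rec) {B} t with nonempty A (Triple.QA t) | nonempty B (Triple.QB t)
    ... | a , a∈A | b , b∈B with any? (λ x → (x ∈? A) ×-dec ¬? (a Fin.≟ x))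
    ...   | yes (x , x∈A , a≢x)
      with shrink t ((a , x , a∈A , x∈A , a≢x) , b , λ b∈A → Triple.A#B t b∈A b∈B)
    ...     | A′ , A′⊂A , t′ = go A′ (rec (p⊂q⇒∣p∣<∣q∣ A′⊂A)) t′
    go A _ {B} {D} t | a , a∈A | b , b∈B | no none =
      a , subst (λ A → Triple A B D)
            (⊆-antisym (λ {x} x∈A → ∈-stable λ x∉ → none (x , x∈A , λ { refl → x∉ (x∈⁅x⁆ a) }))
                       (singleton-⊆ a∈A)) t

  -- Cliques of two-element members

  Clique : Subset n → Set
  Clique W = ∀ x y → x ∈ W → y ∈ W → x ≢ y → Edge x y

  clique? : Decidable Clique
  clique? W = all? λ x → all? λ y →
    (x ∈? W) →-dec (y ∈? W) →-dec ¬? (x Fin.≟ y) →-dec member? (pair x y)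

  -- If a largest member inside `I` fell short of `I`, the edge leaving it within `I` would enlarge
  -- it. This is how large members are assembled from edges, both for cliques and for intervals.
  connected : ∀ I → (∃ λ J → Q J × J ⊆ I) →
    (∀ J → Q J → J ⊂ I → ∃ λ p → ∃ λ q → p ∈ J × q ∈ I × q ∉ J × Edge p q) → Q I
  connected I start step with largest (λ J → member? J ×-dec (J ⊆? I)) start
  ... | J , (QJ , J⊆I) , max with I ⊆? J
  ...   | yes I⊆J = respects QJ J⊆I I⊆J
  ...   | no I⊈J with step J QJ (J⊆I , ⊈⇒∃ I⊈J)
  ...     | p , q , p∈J , q∈I , q∉J , e = ⊥-elim
    (max (J ∪ pair p q) (∪-closed QJ e p∈J ∈pairˡ ,
      λ x∈ → [ J⊆I , (λ x∈ → [ (λ { refl → J⊆I p∈J }) , (λ { refl → q∈I }) ]′ (∈pair⁻ x∈)) ]′ (∈∪⁻ x∈))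
      (∈∪ˡ , q , ∈∪ʳ ∈pairʳ , q∉J))

  clique-complete : ∀ W → Clique W → ∀ I → Nonempty I → I ⊆ W → Q I
  clique-complete W clique I (x , x∈I) I⊆W = connected I (⁅ x ⁆ , singleton x , singleton-⊆ x∈I) step
    where
    step : ∀ J → Q J → J ⊂ I → ∃ λ p → ∃ λ q → p ∈ J × q ∈ I × q ∉ J × Edge p q
    step J QJ (J⊆I , y , y∈I , y∉J) with nonempty J QJ
    ... | p , p∈J = p , y , p∈J , y∈I , y∉J ,
      clique p y (I⊆W (J⊆I p∈J)) (I⊆W y∈I) (λ { refl → y∉J p∈J })

  -- {q,y} is {p,q,y} minus {p,z}.
  third-edge : ∀ {p q y z} → q ≢ p → y ≢ p → q ≢ y → z ≢ q → z ≢ y → z ≢ p →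
    Edge p q → Edge p y → Edge p z → Edge q y
  third-edge {p} {q} {y} {z} q≢p y≢p q≢y z≢q z≢y z≢p pq py pz =
    respects (─-closed (∪-closed pq py ∈pairˡ ∈pairˡ) pz (∈∪ˡ ∈pairˡ) ∈pairˡ (∈∪ˡ ∈pairʳ) (∉pair q≢p (z≢q ∘ sym))
                ∈pairʳ ([ ∉pair z≢p z≢q , ∉pair z≢p z≢y ]′ ∘ ∈∪⁻))
      (λ x∈ → keep (∈─ʳ x∈) (∈∪⁻ (∈─ˡ x∈)))
      (λ x∈ → [ (λ { refl → ∈─⁺ (∈∪ˡ ∈pairʳ) (∉pair q≢p (z≢q ∘ sym)) }) ,
                (λ { refl → ∈─⁺ (∈∪ʳ ∈pairʳ) (∉pair y≢p (z≢y ∘ sym)) }) ]′ (∈pair⁻ x∈))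
    where
    keep : ∀ {x} → x ∉ pair p z → x ∈ pair p q ⊎ x ∈ pair p y → x ∈ pair q y
    keep x∉ (inj₁ x∈) = [ (λ { refl → contradiction ∈pairˡ x∉ }) , (λ { refl → ∈pairˡ }) ]′ (∈pair⁻ x∈)
    keep x∉ (inj₂ x∈) = [ (λ { refl → contradiction ∈pairˡ x∉ }) , (λ { refl → ∈pairʳ }) ]′ (∈pair⁻ x∈)

  -- A largest clique containing the triangle is a member, so unless it is everything, an edge
  -- leaves it to some `q`. Then `third-edge` joins `q` to the whole clique, against maximality.
  triangle-complete : ∀ {a b c} → a ≢ b → a ≢ c → b ≢ c → Edge a b → Edge a c → Edge b c →
    ∀ I → Nonempty I → Q I
  triangle-complete {a} {b} {c} a≢b a≢c b≢c ab ac bc I ne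
    with largest {P = λ W → Clique W × a ∈ W × b ∈ W × c ∈ W}
           (λ W → clique? W ×-dec (a ∈? W) ×-dec (b ∈? W) ×-dec (c ∈? W))
           (pair a b ∪ ⁅ c ⁆ , base , ∈∪ˡ ∈pairˡ , ∈∪ˡ ∈pairʳ , ∈∪ʳ (x∈⁅x⁆ c))
    where
    split : ∀ {x} → x ∈ pair a b ∪ ⁅ c ⁆ → (x ≡ a ⊎ x ≡ b) ⊎ x ≡ c
    split x∈ = [ inj₁ ∘ ∈pair⁻ , inj₂ ∘ x∈⁅y⁆⇒x≡y c ]′ (∈∪⁻ x∈)
    base : Clique (pair a b ∪ ⁅ c ⁆)
    base x y x∈ y∈ x≢y with split x∈ | split y∈
    ... | inj₁ (inj₁ refl) | inj₁ (inj₁ refl) = contradiction refl x≢y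
    ... | inj₁ (inj₁ refl) | inj₁ (inj₂ refl) = ab
    ... | inj₁ (inj₁ refl) | inj₂ refl = ac
    ... | inj₁ (inj₂ refl) | inj₁ (inj₁ refl) = Edge-sym ab
    ... | inj₁ (inj₂ refl) | inj₁ (inj₂ refl) = contradiction refl x≢y
    ... | inj₁ (inj₂ refl) | inj₂ refl = bc
    ... | inj₂ refl | inj₁ (inj₁ refl) = Edge-sym ac
    ... | inj₂ refl | inj₁ (inj₂ refl) = Edge-sym bc
    ... | inj₂ refl | inj₂ refl = contradiction refl x≢y
  ... | W , (clique , a∈W , b∈W , c∈W) , max with any? (λ z → ¬? (z ∈? W))
  ...   | no none = clique-complete W clique I ne (λ {x} _ → ∈-stable λ x∉W → none (x , x∉W))
  ...   | yes (z , z∉W)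
    with exit W (clique-complete W clique W (a , a∈W) id) ((a , b , a∈W , b∈W , a≢b) , z , z∉W)
  ...     | p , q , p∈W , q∉W , pq = ⊥-elim
    (max (W ∪ ⁅ q ⁆) (bigger , ∈∪ˡ a∈W , ∈∪ˡ b∈W , ∈∪ˡ c∈W)
      (∈∪ˡ , q , ∈∪ʳ (x∈⁅x⁆ q) , q∉W))
    where
    q≢ : ∀ {x} → x ∈ W → q ≢ x
    q≢ x∈W refl = q∉W x∈W
    -- The fourth point for `third-edge`, away from both `p` and `y`: one of the three corners of
    -- the triangle always qualifies.
    other : ∀ y → ∃ λ z → z ∈ W × z ≢ p × z ≢ y
    other y with a Fin.≟ p | a Fin.≟ y | b Fin.≟ p | b Fin.≟ y
    ... | no a≢p | no a≢y | _ | _ = a , a∈W , a≢p , a≢y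
    ... | yes refl | _ | _ | no b≢y = b , b∈W , a≢b ∘ sym , b≢y
    ... | yes refl | _ | _ | yes refl = c , c∈W , a≢c ∘ sym , b≢c ∘ sym
    ... | no _ | yes refl | no b≢p | _ = b , b∈W , b≢p , a≢b ∘ sym
    ... | no _ | yes refl | yes refl | _ = c , c∈W , b≢c ∘ sym , a≢c ∘ sym
    to-new : ∀ {y} → y ∈ W → Edge q y
    to-new {y} y∈W with y Fin.≟ p | other y
    ... | yes refl | _ = Edge-sym pq
    ... | no y≢p | z , z∈W , z≢p , z≢y =
      third-edge (q≢ p∈W) y≢p (q≢ y∈W) (q≢ z∈W ∘ sym) z≢y z≢p pq
        (clique p y p∈W y∈W (y≢p ∘ sym)) (clique p z p∈W z∈W (z≢p ∘ sym))
    bigger : Clique (W ∪ ⁅ q ⁆)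
    bigger x y x∈ y∈ x≢y with ∈∪⁻ x∈ | ∈∪⁻ y∈
    ... | inj₁ x∈W | inj₁ y∈W = clique x y x∈W y∈W x≢y
    ... | inj₁ x∈W | inj₂ y∈q with refl ← x∈⁅y⁆⇒x≡y q y∈q = Edge-sym (to-new x∈W)
    ... | inj₂ x∈q | inj₁ y∈W with refl ← x∈⁅y⁆⇒x≡y q x∈q = to-new y∈W
    ... | inj₂ x∈q | inj₂ y∈q = contradiction (trans (x∈⁅y⁆⇒x≡y q x∈q) (sym (x∈⁅y⁆⇒x≡y q y∈q))) x≢y

  -- Shrinking one part keeps the other two, so bringing each part to the front in turn reduces all
  -- three to points. The pairwise unions are then the edges of a triangle.
  triple-complete : ∀ {A B D} → Triple A B D → ∀ I → Nonempty I → Q I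
  triple-complete t with to-point t
  ... | a , t₁ with to-point (rotate t₁)
  ...   | b , t₂ with to-point (rotate t₂)
  ...     | d , t₃ = triangle-complete
    (λ { refl → A#B (x∈⁅x⁆ d) (x∈⁅x⁆ d) }) (λ { refl → A#D (x∈⁅x⁆ d) (x∈⁅x⁆ d) })
    (λ { refl → B#D (x∈⁅x⁆ a) (x∈⁅x⁆ a) }) QAB QAD QBD
    where open Triple t₃

  -- Members missing a single point

  Coatom : Fin n → Set
  Coatom e = Q (full ─ ⁅ e ⁆)

  ∈coatom⁺ : ∀ {e x : Fin n} → x ≢ e → x ∈ full ─ ⁅ e ⁆
  ∈coatom⁺ {e} x≢e = ∈─⁺ ∈⊤ (x≢e ∘ x∈⁅y⁆⇒x≡y e)

  ∉coatom : ∀ {e : Fin n} → e ∉ full ─ ⁅ e ⁆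
  ∉coatom {e} e∈ = ∈─ʳ e∈ (x∈⁅x⁆ e)

  abstract

    -- Let a largest non-trivial member `C` be left along an edge to `q`. The union of both is a
    -- larger member, hence trivial, hence everything; so `C` misses only `q`.
    coatom-exists : ∀ M → Q M → Nontrivial M → ∃ Coatom
    coatom-exists M QM nt with largest (λ C → member? C ×-dec nontrivial? C) (M , QM , nt)
    ... | C , (QC , ntC) , max with exit C QC ntC
    ...   | p , q , p∈C , q∉C , pq = q , respects QC
      (λ x∈C → ∈coatom⁺ (λ { refl → q∉C x∈C }))
      (λ {x} x∈ → ∈-stable λ x∉C → max (C ∪ pair p q)
        (∪-closed QC pq p∈C ∈pairˡ ,
         (p , q , ∈∪ˡ p∈C , ∈∪ʳ ∈pairʳ , (λ { refl → q∉C p∈C })) ,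
         x , [ x∉C , ∉pair (λ { refl → x∉C p∈C }) (λ { refl → ∉coatom x∈ }) ]′ ∘ ∈∪⁻)
        (∈∪ˡ , q , ∈∪ʳ ∈pairʳ , q∉C))

  -- The two differences of `F` and `G` form a triple with `F ∩ G`. Only the union of the
  -- differences is not at hand; the coatom helps by allowing `e` to be removed from `F ∪ G`.
  incomparable-complete : ∀ {e} → Coatom e → ∀ {F G} → Q F → Q G → e ∈ F → e ∈ G → F ⊈ G → G ⊈ F →
    ∀ I → Nonempty I → Q I
  incomparable-complete {e} co {F} {G} QF QG e∈F e∈G F⊈G G⊈F
    with ⊈⇒∃ F⊈G | ⊈⇒∃ G⊈F | closed F G QF QG ((e , ∈∩⁺ e∈F e∈G) , F⊈G , G⊈F)
  ... | f , f∈F , f∉G | g , g∈G , g∉F | Q∩ , QF─G , QG─F , Q∪ = triple-complete record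
    { QA = QF─G ; QB = QG─F ; QD = Q∩
    ; QAB = symmetric-difference
    ; QAD = respects QF
        (λ {x} x∈F → [ (λ x∈G → ∈∪ʳ (∈∩⁺ x∈F x∈G)) , (λ x∉G → ∈∪ˡ (∈─⁺ x∈F x∉G)) ]′ (decide x G))
        (λ x∈ → [ ∈─ˡ , ∈∩ˡ ]′ (∈∪⁻ x∈))
    ; QBD = respects QG
        (λ {x} x∈G → [ (λ x∈F → ∈∪ʳ (∈∩⁺ x∈F x∈G)) , (λ x∉F → ∈∪ˡ (∈─⁺ x∈G x∉F)) ]′ (decide x F))
        (λ x∈ → [ ∈─ˡ , ∈∩ʳ ]′ (∈∪⁻ x∈))
    ; A#B = λ x∈A x∈B → ∈─ʳ x∈A (∈─ˡ x∈B)
    ; A#D = λ x∈A x∈D → ∈─ʳ x∈A (∈∩ʳ x∈D)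
    ; B#D = λ x∈B x∈D → ∈─ʳ x∈B (∈∩ˡ x∈D)
    }
    where
    decide : ∀ x (X : Subset n) → x ∈ X ⊎ x ∉ X
    decide x X with x ∈? X
    ... | yes x∈ = inj₁ x∈
    ... | no x∉ = inj₂ x∉
    W = (F ∪ G) ∩ (full ─ ⁅ e ⁆)
    f∈W : f ∈ W
    f∈W = ∈∩⁺ (∈∪ˡ f∈F) (∈coatom⁺ (λ { refl → f∉G e∈G }))
    QW : Q W
    QW = ∩-closed Q∪ co (∈∩ˡ f∈W) (∈∩ʳ f∈W)
    into : ∀ {x} → x ∉ F ∩ G → x ∈ F ∪ G → x ∈ (F ─ G) ∪ (G ─ F)
    into x∉ x∈ = [ (λ x∈F → ∈∪ˡ (∈─⁺ x∈F (λ x∈G → x∉ (∈∩⁺ x∈F x∈G)))) ,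
                   (λ x∈G → ∈∪ʳ (∈─⁺ x∈G (λ x∈F → x∉ (∈∩⁺ x∈F x∈G)))) ]′ (∈∪⁻ x∈)
    from : ∀ {x} → x ∈ (F ─ G) ∪ (G ─ F) → x ∈ W × x ∉ F ∩ G
    from x∈ with ∈∪⁻ x∈
    ... | inj₁ x∈A = ∈∩⁺ (∈∪ˡ (∈─ˡ x∈A)) (∈coatom⁺ (λ { refl → ∈─ʳ x∈A e∈G })) , ∈─ʳ x∈A ∘ ∈∩ʳ
    ... | inj₂ x∈B = ∈∩⁺ (∈∪ʳ (∈─ˡ x∈B)) (∈coatom⁺ (λ { refl → ∈─ʳ x∈B e∈F })) , ∈─ʳ x∈B ∘ ∈∩ˡ
    symmetric-difference : Q ((F ─ G) ∪ (G ─ F))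
    -- If `F ∩ G` has a second point `d`, then `W` and `F ∩ G` cross, since `e` lies only in the
    -- latter, and their difference is the set wanted. Otherwise removing `e` has already removed
    -- all of `F ∩ G`.
    symmetric-difference with any? (λ d → (d ∈? F ∩ G) ×-dec ¬? (d Fin.≟ e))
    ... | yes (d , d∈ , d≢e) = respects
      (─-closed QW Q∩ (∈∩⁺ (∈∪ˡ (∈∩ˡ d∈)) (∈coatom⁺ d≢e)) d∈ f∈W (f∉G ∘ ∈∩ʳ)
        (∈∩⁺ e∈F e∈G) (∉coatom ∘ ∈∩ʳ))
      (λ x∈ → into (∈─ʳ x∈) (∈∩ˡ (∈─ˡ x∈)))
      (λ x∈ → uncurry ∈─⁺ (from x∈))
    ... | no none = respects QW
      (λ {x} x∈ → into (λ x∈D → none (x , x∈D , λ { refl → ∉coatom (∈∩ʳ x∈) })) (∈∩ˡ x∈))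
      (λ x∈ → proj₁ (from x∈))

  -- The linear order of an incomplete family with a coatom

  module Linear
    (M : Subset n) (QM : Q M) (M-nontrivial : Nontrivial M)
    (incomplete : ¬ (∀ I → Nonempty I → Q I))
    (e : Fin n) (e-coatom : Coatom e)
    where

    infix 4 _⊴_ _⊴?_
    -- Once the members containing `e` are known to form a chain, this is the order in which points
    -- enter along that chain, starting from `e`.
    _⊴_ : Fin n → Fin n → Set
    i ⊴ j = ∀ Y → Q Y → e ∈ Y → j ∈ Y → i ∈ Y

    _⊴?_ : ∀ i j → Dec (i ⊴ j)
    i ⊴? j = allSubset? λ Y → member? Y →-dec (e ∈? Y) →-dec (j ∈? Y) →-dec (i ∈? Y)

    ⋬⇒∃ : ∀ {i j} → ¬ (i ⊴ j) → ∃ λ Y → Q Y × e ∈ Y × j ∈ Y × i ∉ Y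
    ⋬⇒∃ {i} {j} ⋬ with anySubset? (λ Y → member? Y ×-dec (e ∈? Y) ×-dec (j ∈? Y) ×-dec ¬? (i ∈? Y))
    ... | yes found = found
    ... | no none = contradiction (λ Y QY e∈ j∈ → ∈-stable λ i∉ → none (Y , QY , e∈ , j∈ , i∉)) ⋬

    chain : ∀ {F G} → Q F → Q G → e ∈ F → e ∈ G → F ⊆ G ⊎ G ⊆ F
    chain {F} {G} QF QG e∈F e∈G with F ⊆? G | G ⊆? F
    ... | yes F⊆G | _ = inj₁ F⊆G
    ... | no _ | yes G⊆F = inj₂ G⊆F
    ... | no F⊈G | no G⊈F = contradiction (incomparable-complete e-coatom QF QG e∈F e∈G F⊈G G⊈F) incomplete

    ⊴-total : ∀ i j → i ⊴ j ⊎ j ⊴ i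
    ⊴-total i j with i ⊴? j
    ... | yes i⊴j = inj₁ i⊴j
    ... | no ⋬ with ⋬⇒∃ ⋬
    ...   | Y , QY , e∈Y , j∈Y , i∉Y = inj₂ λ Y′ QY′ e∈Y′ i∈Y′ →
      [ (λ Y⊆Y′ → Y⊆Y′ j∈Y) , (λ Y′⊆Y → contradiction (Y′⊆Y i∈Y′) i∉Y) ]′ (chain QY QY′ e∈Y e∈Y′)

    coatom-nontrivial : Nontrivial (full ─ ⁅ e ⁆)
    coatom-nontrivial = go M-nontrivial
      where
      go : Nontrivial M → Nontrivial (full ─ ⁅ e ⁆)
      go ((x , y , x∈M , y∈M , x≢y) , z , z∉M) with x Fin.≟ e | y Fin.≟ e
      ... | yes refl | _ = (y , z , ∈coatom⁺ (x≢y ∘ sym) , ∈coatom⁺ (λ { refl → z∉M x∈M }) ,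
                              (λ { refl → z∉M y∈M })) , e , ∉coatom
      ... | no x≢e | yes refl = (x , z , ∈coatom⁺ x≢e , ∈coatom⁺ (λ { refl → z∉M y∈M }) ,
                              (λ { refl → z∉M x∈M })) , e , ∉coatom
      ... | no x≢e | no y≢e = (x , y , ∈coatom⁺ x≢e , ∈coatom⁺ y≢e , x≢y) , e , ∉coatom

    -- The singleton of `e` is trivial, so `exit` does not apply to it. In that case the edge
    -- leaving the coatom is read backwards, as it can only end in `e`.
    exit-initial : ∀ {Y z} → Q Y → e ∈ Y → z ∉ Y → ∃ λ p → ∃ λ q → p ∈ Y × q ∉ Y × Edge p q
    exit-initial {Y} {z} QY e∈Y z∉Y with any? (λ x → (x ∈? Y) ×-dec ¬? (e Fin.≟ x))
    ... | yes (x , x∈Y , e≢x) = exit Y QY ((e , x , e∈Y , x∈Y , e≢x) , z , z∉Y)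
    ... | no none with exit _ e-coatom coatom-nontrivial
    ...   | p , q , p∈ , q∉ , pq with q Fin.≟ e
    ...     | no q≢e = contradiction (∈coatom⁺ q≢e) q∉
    ...     | yes refl = q , p , e∈Y , (λ p∈Y → none (p , p∈Y , λ { refl → ∉coatom p∈ })) , Edge-sym pq

    -- A largest member that contains `e` and neither of two points other than `e` is left along an
    -- edge. Maximality forces the edge to end in `a` or in `b`, and adding it takes in just that
    -- one.
    separator : ∀ {a b} → a ≢ b → ∃ λ Y → Q Y × e ∈ Y × (a ∈ Y × b ∉ Y ⊎ b ∈ Y × a ∉ Y)
    separator {a} {b} a≢b with a Fin.≟ e | b Fin.≟ e
    ... | yes refl | _ = ⁅ e ⁆ , singleton e , x∈⁅x⁆ e , inj₁ (x∈⁅x⁆ e , (λ b∈ → a≢b (sym (x∈⁅y⁆⇒x≡y e b∈))))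
    ... | no _ | yes refl = ⁅ e ⁆ , singleton e , x∈⁅x⁆ e , inj₂ (x∈⁅x⁆ e , (λ a∈ → a≢b (x∈⁅y⁆⇒x≡y e a∈)))
    ... | no a≢e | no b≢e
      with largest {P = λ Y → Q Y × e ∈ Y × a ∉ Y × b ∉ Y}
             (λ Y → member? Y ×-dec (e ∈? Y) ×-dec ¬? (a ∈? Y) ×-dec ¬? (b ∈? Y))
             (⁅ e ⁆ , singleton e , x∈⁅x⁆ e , a≢e ∘ x∈⁅y⁆⇒x≡y e , b≢e ∘ x∈⁅y⁆⇒x≡y e)
    ...   | Y , (QY , e∈Y , a∉Y , b∉Y) , max with exit-initial QY e∈Y a∉Y
    ...     | p , q , p∈Y , q∉Y , pq with q Fin.≟ a | q Fin.≟ b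
    ...       | yes refl | _ = Y ∪ pair p q , ∪-closed QY pq p∈Y ∈pairˡ , ∈∪ˡ e∈Y ,
                inj₁ (∈∪ʳ ∈pairʳ , [ b∉Y , ∉pair (λ { refl → b∉Y p∈Y }) (a≢b ∘ sym) ]′ ∘ ∈∪⁻)
    ...       | no _ | yes refl = Y ∪ pair p q , ∪-closed QY pq p∈Y ∈pairˡ , ∈∪ˡ e∈Y ,
                inj₂ (∈∪ʳ ∈pairʳ , [ a∉Y , ∉pair (λ { refl → a∉Y p∈Y }) a≢b ]′ ∘ ∈∪⁻)
    ...       | no q≢a | no q≢b = ⊥-elim
                (max (Y ∪ pair p q) (∪-closed QY pq p∈Y ∈pairˡ , ∈∪ˡ e∈Y ,
                  [ a∉Y , ∉pair (λ { refl → a∉Y p∈Y }) (q≢a ∘ sym) ]′ ∘ ∈∪⁻ ,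
                  [ b∉Y , ∉pair (λ { refl → b∉Y p∈Y }) (q≢b ∘ sym) ]′ ∘ ∈∪⁻)
                  (∈∪ˡ , q , ∈∪ʳ ∈pairʳ , q∉Y))

    ⊴-antisym : ∀ {i j} → i ⊴ j → j ⊴ i → i ≡ j
    ⊴-antisym {i} {j} i⊴j j⊴i with i Fin.≟ j
    ... | yes i≡j = i≡j
    ... | no i≢j with separator i≢j
    ...   | Y , QY , e∈Y , inj₁ (i∈Y , j∉Y) = contradiction (j⊴i Y QY e∈Y i∈Y) j∉Y
    ...   | Y , QY , e∈Y , inj₂ (j∈Y , i∉Y) = contradiction (i⊴j Y QY e∈Y j∈Y) i∉Y

    -- Members as intervals

    module Monotone (monotone : ∀ i j → i Fin.< j → i ⊴ j) where

      prefix : ∀ {i j} → i Fin.< j → ∃ λ Y → Q Y × e ∈ Y × i ∈ Y × j ∉ Y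
      prefix {i} {j} i<j with separator {i} {j} (λ { refl → ℕ.<-irrefl refl i<j })
      ... | Y , QY , e∈Y , inj₁ (i∈Y , j∉Y) = Y , QY , e∈Y , i∈Y , j∉Y
      ... | Y , QY , e∈Y , inj₂ (j∈Y , i∉Y) = contradiction (monotone i j i<j Y QY e∈Y j∈Y) i∉Y

      -- Take a member `Y` around `e` with `i` and without `j`. If `j` were missing from `I`, then
      -- `Y ∪ I` would be a member around `e` containing `k` but not `j`, against the order.
      member⇒interval : ∀ {I} → Q I → Interval I
      member⇒interval {I} QI i j k i≤j j≤k i∈I k∈I with i Fin.≟ j | j Fin.≟ k | j ∈? I
      ... | yes refl | _ | _ = i∈I
      ... | _ | yes refl | _ = k∈I
      ... | _ | _ | yes j∈I = j∈I
      ... | no i≢j | no j≢k | no j∉I with prefix (ℕ.≤∧≢⇒< i≤j (i≢j ∘ toℕ-injective))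
      ...   | Y , QY , e∈Y , i∈Y , j∉Y = contradiction
        (monotone j k (ℕ.≤∧≢⇒< j≤k (j≢k ∘ toℕ-injective)) (Y ∪ I) (∪-closed QY QI i∈Y i∈I) (∈∪ˡ e∈Y) (∈∪ʳ k∈I))
        ([ j∉Y , j∉I ]′ ∘ ∈∪⁻)

      -- A member around `e` that separates `i` from `j` is left along an edge `p q`. As the member
      -- is initial, `p` is at most `i` and `q` at least `j`; as the edge is an interval, it
      -- contains both, so it is the pair itself.
      successor-edge : ∀ {i j} → toℕ j ≡ suc (toℕ i) → Edge i j
      successor-edge {i} {j} j≡1+i with prefix {i} {j} (ℕ.≤-reflexive (sym j≡1+i))
      ... | Y , QY , e∈Y , i∈Y , j∉Y with exit-initial QY e∈Y j∉Y
      ...   | p , q , p∈Y , q∉Y , pq = subst₂ Edge p≡i q≡j pq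
        where
        p≤i : p Fin.≤ i
        p≤i = ℕ.≮⇒≥ λ i<p → j∉Y ([ (λ j<p → monotone j p j<p Y QY e∈Y p∈Y) ,
                                    (λ j≡p → subst (_∈ Y) (sym (toℕ-injective j≡p)) p∈Y) ]′
                                  (ℕ.m≤n⇒m<n∨m≡n (subst (ℕ._≤ toℕ p) (sym j≡1+i) i<p)))
        i<q : i Fin.< q
        i<q = ℕ.≰⇒> λ q≤i → q∉Y ([ (λ q<i → monotone q i q<i Y QY e∈Y i∈Y) ,
                                    (λ q≡i → subst (_∈ Y) (sym (toℕ-injective q≡i)) i∈Y) ]′
                                  (ℕ.m≤n⇒m<n∨m≡n q≤i))
        p≡i : p ≡ i
        p≡i = [ sym , (λ i≡q → contradiction (cong toℕ i≡q) (ℕ.<⇒≢ i<q)) ]′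
          (∈pair⁻ (member⇒interval pq p i q p≤i (ℕ.<⇒≤ i<q) ∈pairˡ ∈pairʳ))
        j≤q : j Fin.≤ q
        j≤q = subst (ℕ._≤ toℕ q) (sym j≡1+i) i<q
        q≡j : q ≡ j
        q≡j = [ (λ j≡p → contradiction (cong toℕ (trans j≡p p≡i))
                  (λ j≡i → ℕ.1+n≢n (trans (sym j≡1+i) j≡i))) , sym ]′
          (∈pair⁻ (member⇒interval pq p j q
            (ℕ.≤-trans p≤i (subst (toℕ i ℕ.≤_) (sym j≡1+i) (ℕ.n≤1+n _))) j≤q ∈pairˡ ∈pairʳ))

      -- A discrete intermediate value property: on the way from `x` to `y`, with `d` positions
      -- strictly between, membership in `J` changes at two consecutive positions. The components
      -- treat leaving and entering `J`.
      between : ∀ (J : Subset n) d {x y} → toℕ y ≡ suc (d + toℕ x) →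
        (x ∈ J → y ∉ J → ∃ λ p → ∃ λ q → x Fin.≤ p × q Fin.≤ y × p ∈ J × q ∉ J × toℕ q ≡ suc (toℕ p)) ×
        (x ∉ J → y ∈ J → ∃ λ p → ∃ λ q → x Fin.≤ q × p Fin.≤ y × p ∈ J × q ∉ J × toℕ p ≡ suc (toℕ q))
      between J zero y≡ =
        (λ x∈ y∉ → _ , _ , ℕ.≤-refl , ℕ.≤-refl , x∈ , y∉ , y≡) ,
        (λ x∉ y∈ → _ , _ , ℕ.≤-refl , ℕ.≤-refl , y∈ , x∉ , y≡)
      between J (suc d) {x} {y} y≡ = up , down
        where
        1+x<n : suc (toℕ x) ℕ.< n
        1+x<n = ℕ.≤-trans (s≤s (subst (suc (toℕ x) ℕ.≤_) (sym y≡) (s≤s (ℕ.m≤n+m (toℕ x) (suc d))))) (toℕ<n y)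
        x′ = Fin.fromℕ< 1+x<n
        x′≡ : toℕ x′ ≡ suc (toℕ x)
        x′≡ = toℕ-fromℕ< 1+x<n
        y≡′ : toℕ y ≡ suc (d + toℕ x′)
        y≡′ = trans y≡ (cong suc (trans (sym (ℕ.+-suc d (toℕ x))) (cong (d +_) (sym x′≡))))
        x≤x′ : x Fin.≤ x′
        x≤x′ = subst (toℕ x ℕ.≤_) (sym x′≡) (ℕ.n≤1+n _)
        x′≤y : x′ Fin.≤ y
        x′≤y = subst (toℕ x′ ℕ.≤_) (sym y≡′) (ℕ.≤-trans (ℕ.m≤n+m _ d) (ℕ.n≤1+n _))
        up : x ∈ J → y ∉ J → _
        up x∈ y∉ with x′ ∈? J
        ... | no x′∉ = x , x′ , ℕ.≤-refl , x′≤y , x∈ , x′∉ , x′≡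
        ... | yes x′∈ with proj₁ (between J d y≡′) x′∈ y∉
        ...   | p , q , x′≤p , rest = p , q , ℕ.≤-trans x≤x′ x′≤p , rest
        down : x ∉ J → y ∈ J → _
        down x∉ y∈ with x′ ∈? J
        ... | yes x′∈ = x′ , x , ℕ.≤-refl , x′≤y , x′∈ , x∉ , x′≡
        ... | no x′∉ with proj₂ (between J d y≡′) x′∉ y∈
        ...   | p , q , x′≤q , rest = p , q , ℕ.≤-trans x≤x′ x′≤q , rest

      difference : ∀ {x y : Fin n} → x Fin.< y → toℕ y ≡ suc ((toℕ y ∸ suc (toℕ x)) + toℕ x)
      difference {x} {y} x<y = trans (sym (ℕ.m∸n+n≡m x<y)) (ℕ.+-suc _ (toℕ x))

      -- A member falling short of the interval has two consecutive positions of the interval across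
      -- its border, and these form an edge.
      interval⇒member : ∀ {I} → Nonempty I → Interval I → Q I
      interval⇒member {I} (x , x∈I) int = connected I (⁅ x ⁆ , singleton x , singleton-⊆ x∈I) step
        where
        step : ∀ J → Q J → J ⊂ I → ∃ λ p → ∃ λ q → p ∈ J × q ∈ I × q ∉ J × Edge p q
        step J QJ (J⊆I , y , y∈I , y∉J) with nonempty J QJ
        ... | x , x∈J with toℕ x ℕ.<? toℕ y
        ...   | yes x<y with proj₁ (between J _ (difference x<y)) x∈J y∉J
        ...     | p , q , x≤p , q≤y , p∈J , q∉J , q≡ = p , q , p∈J ,
          int x q y (ℕ.≤-trans x≤p (subst (toℕ p ℕ.≤_) (sym q≡) (ℕ.n≤1+n _))) q≤y (J⊆I x∈J) y∈I ,
          q∉J , successor-edge q≡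
        step J QJ (J⊆I , y , y∈I , y∉J) | x , x∈J | no x≮y
          with proj₂ (between J _ (difference {y} {x} (ℕ.≤∧≢⇒< (ℕ.≮⇒≥ x≮y)
                 (λ y≡x → y∉J (subst (_∈ J) (sym (toℕ-injective y≡x)) x∈J))))) y∉J x∈J
        ...     | p , q , y≤q , p≤x , p∈J , q∉J , p≡ = p , q , p∈J ,
          int y q x y≤q (ℕ.≤-trans (subst (toℕ q ℕ.≤_) (sym p≡) (ℕ.n≤1+n _)) p≤x) y∈I (J⊆I x∈J) , q∉J ,
          Edge-sym (successor-edge p≡)

-- Finite enumerations

record Enumeration {A : Set} (P : A → Set) : Set where
  field
    total     : ℕ
    element   : Fin total → A
    injective : ∀ {i j} → element i ≡ element j → i ≡ j
    sound     : ∀ i → P (element i)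
    complete  : ∀ a → P a → ∃ λ i → element i ≡ a

lookup-injective : ∀ {A : Set} {as : List A} → Unique as → ∀ i j → List.lookup as i ≡ List.lookup as j → i ≡ j
lookup-injective (a∉ ∷ u) zero    zero    _  = refl
lookup-injective (a∉ ∷ u) zero    (suc j) eq = contradiction eq (All.lookup a∉ (∈-lookup j))
lookup-injective (a∉ ∷ u) (suc i) zero    eq = contradiction (sym eq) (All.lookup a∉ (∈-lookup i))
lookup-injective (a∉ ∷ u) (suc i) (suc j) eq = cong suc (lookup-injective u i j eq)

enumeration : ∀ {A : Set} {P : A → Set} (as : List A) → Unique as → (∀ a → a List.∈ as) →
  Decidable P → Enumeration P
enumeration {P = P} as unique exhaustive P? = record
  { total     = List.length bs
  ; element   = List.lookup bs
  ; injective = λ {i} {j} → lookup-injective (Unique.filter⁺ P? unique) i j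
  ; sound     = λ i → proj₂ (∈-filter⁻ P? {xs = as} (∈-lookup {xs = bs} i))
  ; complete  = λ a pa → let a∈ = ∈-filter⁺ P? (exhaustive a) pa in index a∈ , sym (lookup-index a∈)
  }
  where bs = List.filter P? as

allSubsets : ∀ n → List (Subset n)
allSubsets zero    = [] ∷ []
allSubsets (suc n) = List.map (true ∷_) (allSubsets n) List.++ List.map (false ∷_) (allSubsets n)

∈-allSubsets : ∀ {n} (X : Subset n) → X List.∈ allSubsets n
∈-allSubsets []          = here refl
∈-allSubsets (true ∷ X)  = ∈-++⁺ˡ (∈-map⁺ (true ∷_) (∈-allSubsets X))
∈-allSubsets (false ∷ X) = ∈-++⁺ʳ (List.map (true ∷_) (allSubsets _)) (∈-map⁺ (false ∷_) (∈-allSubsets X))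

allSubsets-unique : ∀ n → Unique (allSubsets n)
allSubsets-unique zero    = [] ∷ []
allSubsets-unique (suc n) = Unique.++⁺
  (Unique.map⁺ (cong Vec.tail) (allSubsets-unique n))
  (Unique.map⁺ (cong Vec.tail) (allSubsets-unique n))
  disjoint
  where
  disjoint : ∀ {X} → X List.∈ List.map (true ∷_) (allSubsets n) ×
                     X List.∈ List.map (false ∷_) (allSubsets n) → ⊥
  disjoint (X∈ , X∈′) with ∈-map⁻ (true ∷_) X∈ | ∈-map⁻ (false ∷_) X∈′
  ... | _ , _ , refl | _ , _ , ()

enumerateFin : ∀ {n} {P : Fin n → Set} → Decidable P → Enumeration P
enumerateFin {n} = enumeration (List.allFin n) (Unique.allFin⁺ n) ∈-allFin

enumerateSubset : ∀ {n} {P : Subset n → Set} → Decidable P → Enumeration P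
enumerateSubset {n} = enumeration (allSubsets n) (allSubsets-unique n) ∈-allSubsets

-- Unions

module _ {n : ℕ} where

  ∈⋃⁻ : ∀ (Xs : List (Subset n)) {x} → x ∈ Data.Fin.Subset.⋃ Xs → ∃ λ X → X List.∈ Xs × x ∈ X
  ∈⋃⁻ [] x∈ = contradiction x∈ ∉⊥
  ∈⋃⁻ (X ∷ Xs) x∈ with ∈∪⁻ x∈
  ... | inj₁ x∈X = X , here refl , x∈X
  ... | inj₂ x∈⋃ with ∈⋃⁻ Xs x∈⋃
  ...   | Y , Y∈ , x∈Y = Y , there Y∈ , x∈Y

  ∈⋃⁺ : ∀ {Xs : List (Subset n)} {X x} → X List.∈ Xs → x ∈ X → x ∈ Data.Fin.Subset.⋃ Xs
  ∈⋃⁺ (here refl) x∈X = ∈∪ˡ x∈X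
  ∈⋃⁺ (there X∈) x∈X = ∈∪ʳ (∈⋃⁺ X∈ x∈X)

module _ {k n : ℕ} (F : Fin k → Subset n) where

  ∈⋃[]⁺ : ∀ {I i x} → i ∈ I → x ∈ F i → x ∈ ⋃[ I ] F
  ∈⋃[]⁺ {I} {i} i∈I x∈ = ∈⋃⁺ (∈-map⁺ F (∈-filter⁺ (_∈? I) (∈-allFin i) i∈I)) x∈

  ∈⋃[]⁻ : ∀ {I x} → x ∈ ⋃[ I ] F → ∃ λ i → i ∈ I × x ∈ F i
  ∈⋃[]⁻ {I} x∈ with ∈⋃⁻ (List.map F (List.filter (_∈? I) (List.allFin _))) x∈
  ... | X , X∈ , x∈X with ∈-map⁻ F X∈
  ...   | i , i∈ , refl = i , proj₂ (∈-filter⁻ (_∈? I) {xs = List.allFin _} i∈) , x∈X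

-- Strong sets

cross? : ∀ {n} (F G : Subset n) → Dec (Cross F G)
cross? F G = nonempty? (F ∩ G) ×-dec ¬? (F ⊆? G) ×-dec ¬? (G ⊆? F)

module StrongSets (𝒮 : SetSystem) where

  open SetSystem 𝒮

  member? : Decidable _∈𝒮
  member? X = T? (member X)

  abstract

    strong? : Decidable (Strong 𝒮)
    strong? X = member? X ×-dec allSubset? λ Y → member? Y →-dec ¬? (cross? X Y)

  strong-nonempty : ∀ {X} → Strong 𝒮 X → Nonempty X
  strong-nonempty (X∈ , _) = members-nonempty _ X∈

  nested : ∀ {X Y x} → Strong 𝒮 X → Y ∈𝒮 → x ∈ X → x ∈ Y → X ⊆ Y ⊎ Y ⊆ X
  nested {X} {Y} (_ , uncrossed) Y∈𝒮 x∈X x∈Y with X ⊆? Y | Y ⊆? X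
  ... | yes X⊆Y | _ = inj₁ X⊆Y
  ... | no _ | yes Y⊆X = inj₂ Y⊆X
  ... | no X⊈Y | no Y⊈X = ⊥-elim (uncrossed Y Y∈𝒮 ((_ , ∈∩⁺ x∈X x∈Y) , X⊈Y , Y⊈X))

  strong-full : Strong 𝒮 full
  strong-full = whole∈𝒮 , λ { Y _ (_ , _ , Y⊈full) → Y⊈full (λ _ → ∈⊤) }

  strong-singleton : ∀ u → Strong 𝒮 ⁅ u ⁆
  strong-singleton u = singleton∈𝒮 u , λ { Y _ ((x , x∈) , u⊈Y , _) →
    u⊈Y (singleton-⊆ (subst (_∈ Y) (x∈⁅y⁆⇒x≡y u (∈∩ˡ x∈)) (∈∩ʳ x∈))) }

  ChildOf : Subset card → Subset card → Set
  ChildOf X P = Strong 𝒮 X × Strong 𝒮 P × X ⊂ P × (∀ Z → Strong 𝒮 Z → X ⊂ Z → ¬ (Z ⊂ P))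

  abstract

    childOf? : ∀ X P → Dec (ChildOf X P)
    childOf? X P = strong? X ×-dec strong? P ×-dec (X ⊂? P) ×-dec
      allSubset? λ Z → strong? Z →-dec (X ⊂? Z) →-dec ¬? (Z ⊂? P)

  -- All singletons are strong, so a strong set has another one properly below it exactly when it
  -- has two elements.
  Inner : Subset card → Set
  Inner X = ∃ λ x → ∃ λ y → x ∈ X × y ∈ X × x ≢ y

  inner? : Decidable Inner
  inner? X = any? λ x → any? λ y → (x ∈? X) ×-dec (y ∈? X) ×-dec ¬? (x Fin.≟ y)

  ¬inner⇒singleton : ∀ {X u} → ¬ Inner X → u ∈ X → X ≡ ⁅ u ⁆
  ¬inner⇒singleton {X} {u} ¬inner u∈X = ⊆-antisym
    (λ {x} x∈X → ∈-stable λ x∉ → ¬inner (x , u , x∈X , u∈X , λ { refl → x∉ (x∈⁅x⁆ u) }))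
    (singleton-⊆ u∈X)

  ¬inner-singleton : ∀ {u} → ¬ Inner ⁅ u ⁆
  ¬inner-singleton {u} (x , y , x∈ , y∈ , x≢y) = x≢y (trans (x∈⁅y⁆⇒x≡y u x∈) (sym (x∈⁅y⁆⇒x≡y u y∈)))

  ⊂⇒inner : ∀ {X P} → Nonempty X → X ⊂ P → Inner P
  ⊂⇒inner (x , x∈X) (X⊆P , y , y∈P , y∉X) = x , y , X⊆P x∈X , y∈P , λ { refl → y∉X x∈X }

  abstract

    parent-exists : ∀ {X} → Strong 𝒮 X → X ≢ full → ∃ λ P → ChildOf X P
    parent-exists {X} sX X≢full
      with smallest (λ P → strong? P ×-dec (X ⊂? P)) (full , strong-full , ⊆∧≢⇒⊂ (λ _ → ∈⊤) X≢full)
    ... | P , (sP , X⊂P) , min = P , sX , sP , X⊂P , λ Z sZ X⊂Z → min Z (sZ , X⊂Z)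

    parent-below : ∀ {X P Z} → ChildOf X P → Strong 𝒮 Z → X ⊂ Z → P ⊆ Z
    parent-below {X} {P} {Z} (sX , sP , X⊂P , none) sZ X⊂Z with strong-nonempty sX
    ... | x , x∈X with nested sP (proj₁ sZ) (proj₁ X⊂P x∈X) (proj₁ X⊂Z x∈X)
    ...   | inj₁ P⊆Z = P⊆Z
    ...   | inj₂ Z⊆P with P ⊆? Z
    ...     | yes P⊆Z = P⊆Z
    ...     | no P⊈Z = ⊥-elim (none Z sZ X⊂Z (Z⊆P , ⊈⇒∃ P⊈Z))

    parent-unique : ∀ {X P P′} → ChildOf X P → ChildOf X P′ → P ≡ P′
    parent-unique c@(_ , sP , X⊂P , _) c′@(_ , sP′ , X⊂P′ , _) =
      ⊆-antisym (parent-below c sP′ X⊂P′) (parent-below c′ sP X⊂P)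

    child-at : ∀ {P x} → Strong 𝒮 P → Inner P → x ∈ P → ∃ λ X → ChildOf X P × x ∈ X
    child-at {P} {x} sP inner x∈P
      with largest (λ X → strong? X ×-dec (x ∈? X) ×-dec (X ⊂? P))
             (⁅ x ⁆ , strong-singleton x , x∈⁅x⁆ x ,
              ⊆∧≢⇒⊂ (singleton-⊆ x∈P) (λ eq → ¬inner-singleton (subst Inner (sym eq) inner)))
    ... | X , (sX , x∈X , X⊂P) , max =
      X , (sX , sP , X⊂P , λ Z sZ X⊂Z Z⊂P → max Z (sZ , proj₁ X⊂Z x∈X , Z⊂P) X⊂Z) , x∈X

    child-above : ∀ {X C P x} → Strong 𝒮 X → X ⊂ P → ChildOf C P → x ∈ X → x ∈ C → X ⊆ C
    child-above {X} {C} sX X⊂P (sC , _ , _ , none) x∈X x∈C with nested sX (proj₁ sC) x∈X x∈C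
    ... | inj₁ X⊆C = X⊆C
    ... | inj₂ C⊆X with X ⊆? C
    ...   | yes X⊆C = X⊆C
    ...   | no X⊈C = ⊥-elim (none X sX (C⊆X , ⊈⇒∃ X⊈C) X⊂P)

    children-disjoint : ∀ {X Y P x} → ChildOf X P → ChildOf Y P → x ∈ X → x ∈ Y → X ≡ Y
    children-disjoint cX@(sX , _ , X⊂P , _) cY@(sY , _ , Y⊂P , _) x∈X x∈Y =
      ⊆-antisym (child-above sX X⊂P cY x∈X x∈Y) (child-above sY Y⊂P cX x∈Y x∈X)

    two-children : ∀ {P} → Strong 𝒮 P → Inner P → ∀ {X} → ChildOf X P → ∃ λ Y → ChildOf Y P × X ≢ Y
    two-children sP inner (_ , _ , (X⊆P , y , y∈P , y∉X) , _) with child-at sP inner y∈P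
    ... | Y , cY , y∈Y = Y , cY , λ { refl → y∉X y∈Y }

  -- The types of nodes are phrased without numbering the children, so that they can be written in
  -- the logic.
  Prime : Subset card → Set
  Prime P = ∀ Y → Y ∈𝒮 → Y ⊂ P → ∃ λ C → ChildOf C P × Y ⊆ C

  -- The sets `Y` in question are the non-empty unions of children.
  Degenerate : Subset card → Set
  Degenerate P = ∀ Y → Y ⊆ P → Nonempty Y → (∀ C → ChildOf C P → Nonempty (C ∩ Y) → C ⊆ Y) → Y ∈𝒮

  -- The coatoms of the family of children; at a linear node these are the two extreme children.
  End : Subset card → Subset card → Set
  End E P = ChildOf E P × (P ─ E) ∈𝒮

  -- The order `⊴` of the family of children, read on subsets of the node, with the end `E` as base
  -- point.
  Precedes : Subset card → Subset card → Subset card → Subset card → Set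
  Precedes P E A B = ∀ Y → Y ∈𝒮 → Y ⊆ P → E ⊆ Y → B ⊆ Y → A ⊆ Y

  abstract

    prime? : Decidable Prime
    prime? P = allSubset? λ Y → member? Y →-dec (Y ⊂? P) →-dec someSubset? λ C → childOf? C P ×-dec (Y ⊆? C)

    degenerate? : Decidable Degenerate
    degenerate? P = allSubset? λ Y → (Y ⊆? P) →-dec nonempty? Y →-dec
      (allSubset? λ C → childOf? C P →-dec nonempty? (C ∩ Y) →-dec (C ⊆? Y)) →-dec member? Y

  -- The children of a node as a crossed family

  record Blocks (P : Subset card) : Set where
    field
      count     : ℕ
      block     : Fin count → Subset card
      is-child  : ∀ i → ChildOf (block i) P
      injective : ∀ {i j} → block i ≡ block j → i ≡ j
      complete  : ∀ C → ChildOf C P → ∃ λ i → block i ≡ C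

  abstract

    blocks : ∀ P → Blocks P
    blocks P = record
      { count = total ; block = element ; is-child = sound ; injective = injective ; complete = complete }
      where open Enumeration (enumerateSubset (λ C → childOf? C P))

  module BlockFamily (wp : WeaklyPartitive 𝒮) {P} (sP : Strong 𝒮 P) (inner : Inner P) (bs : Blocks P) where

    open Blocks bs

    abstract

      L : Subset count → Subset card
      L I = ⋃[ I ] block

      L≡⋃ : ∀ I → L I ≡ ⋃[ I ] block
      L≡⋃ I = refl

      L⁺ : ∀ {I i x} → i ∈ I → x ∈ block i → x ∈ L I
      L⁺ = ∈⋃[]⁺ block

      L⁻ : ∀ {I x} → x ∈ L I → ∃ λ i → i ∈ I × x ∈ block i
      L⁻ = ∈⋃[]⁻ block

    Q : Subset count → Set
    Q I = L I ∈𝒮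

    block-strong : ∀ i → Strong 𝒮 (block i)
    block-strong i = proj₁ (is-child i)

    block-⊂ : ∀ i → block i ⊂ P
    block-⊂ i = proj₁ (proj₂ (proj₂ (is-child i)))

    block-nonempty : ∀ i → Nonempty (block i)
    block-nonempty i = strong-nonempty (block-strong i)

    abstract

      block-at : ∀ {x} → x ∈ P → ∃ λ i → x ∈ block i
      block-at x∈P with child-at sP inner x∈P
      ... | C , cC , x∈C with complete C cC
      ...   | i , refl = i , x∈C

      block-unique : ∀ {i j x} → x ∈ block i → x ∈ block j → i ≡ j
      block-unique {i} {j} x∈i x∈j = injective (children-disjoint (is-child i) (is-child j) x∈i x∈j)

    L-index : ∀ {I i x} → x ∈ L I → x ∈ block i → i ∈ I
    L-index {I} x∈L x∈i with L⁻ x∈L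
    ... | j , j∈I , x∈j = subst (_∈ I) (block-unique x∈j x∈i) j∈I

    L-⊆P : ∀ {I} → L I ⊆ P
    L-⊆P x∈ with L⁻ x∈
    ... | i , _ , x∈i = proj₁ (block-⊂ i) x∈i

    block-⊆L : ∀ {I i} → i ∈ I → block i ⊆ L I
    block-⊆L i∈I x∈ = L⁺ i∈I x∈

    block-⊆L⁻ : ∀ {I i} → block i ⊆ L I → i ∈ I
    block-⊆L⁻ {i = i} ⊆L = L-index (⊆L (proj₂ (block-nonempty i))) (proj₂ (block-nonempty i))

    L-mono : ∀ {I J} → I ⊆ J → L I ⊆ L J
    L-mono I⊆J x∈ with L⁻ x∈
    ... | i , i∈I , x∈i = L⁺ (I⊆J i∈I) x∈i

    L-mono⁻ : ∀ {I J} → L I ⊆ L J → I ⊆ J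
    L-mono⁻ L⊆ i∈I = block-⊆L⁻ (λ x∈ → L⊆ (L⁺ i∈I x∈))

    L-full : L full ≡ P
    L-full = ⊆-antisym L-⊆P (λ x∈P → let i , x∈i = block-at x∈P in L⁺ ∈⊤ x∈i)

    L-singleton : ∀ i → L ⁅ i ⁆ ≡ block i
    L-singleton i = ⊆-antisym
      (λ x∈ → let j , j∈ , x∈j = L⁻ x∈ in subst (λ j → _ ∈ block j) (x∈⁅y⁆⇒x≡y i j∈) x∈j)
      (L⁺ (x∈⁅x⁆ i))

    L-∩ : ∀ I J → L (I ∩ J) ≡ L I ∩ L J
    L-∩ I J = ⊆-antisym
      (λ x∈ → ∈∩⁺ (L-mono {I ∩ J} ∈∩ˡ x∈) (L-mono {I ∩ J} ∈∩ʳ x∈))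
      (λ x∈ → let i , i∈I , x∈i = L⁻ (∈∩ˡ x∈) in L⁺ (∈∩⁺ i∈I (L-index (∈∩ʳ x∈) x∈i)) x∈i)

    L-∪ : ∀ I J → L (I ∪ J) ≡ L I ∪ L J
    L-∪ I J = ⊆-antisym
      (λ x∈ → let i , i∈ , x∈i = L⁻ x∈ in
        [ (λ i∈I → ∈∪ˡ (L⁺ i∈I x∈i)) , (λ i∈J → ∈∪ʳ (L⁺ i∈J x∈i)) ]′ (∈∪⁻ i∈))
      (λ x∈ → [ L-mono {I} ∈∪ˡ , L-mono {J} ∈∪ʳ ]′ (∈∪⁻ x∈))

    L-─ : ∀ I J → L (I ─ J) ≡ L I ─ L J
    L-─ I J = ⊆-antisym
      (λ x∈ → let i , i∈ , x∈i = L⁻ x∈ in ∈─⁺ (L⁺ (∈─ˡ i∈) x∈i) (λ x∈J → ∈─ʳ i∈ (L-index x∈J x∈i)))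
      (λ x∈ → let i , i∈I , x∈i = L⁻ (∈─ˡ x∈) in L⁺ (∈─⁺ i∈I (λ i∈J → ∈─ʳ x∈ (L⁺ i∈J x∈i))) x∈i)

    L-nonempty : ∀ {I} → Nonempty I → Nonempty (L I)
    L-nonempty (i , i∈I) = let x , x∈i = block-nonempty i in x , L⁺ i∈I x∈i

    cross-L : ∀ {I J} → Cross I J → Cross (L I) (L J)
    cross-L {I} {J} ((i , i∈) , I⊈J , J⊈I) =
      (let x , x∈i = block-nonempty i in x , ∈∩⁺ (L⁺ (∈∩ˡ i∈) x∈i) (L⁺ (∈∩ʳ i∈) x∈i)) ,
      (λ L⊆ → I⊈J (L-mono⁻ L⊆)) , (λ L⊆ → J⊈I (L-mono⁻ L⊆))

    cross-L⁻ : ∀ {I J} → Cross (L I) (L J) → Cross I J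
    cross-L⁻ {I} {J} ((x , x∈) , I⊈J , J⊈I) =
      (let i , i∈I , x∈i = L⁻ (∈∩ˡ x∈) in i , ∈∩⁺ i∈I (L-index (∈∩ʳ x∈) x∈i)) ,
      (λ I⊆J → I⊈J (L-mono I⊆J)) , (λ J⊆I → J⊈I (L-mono J⊆I))

    trace : Subset card → Subset count
    trace Y = comprehension (λ i → block i ⊆? Y)

    trace⁺ : ∀ {Y i} → block i ⊆ Y → i ∈ trace Y
    trace⁺ {Y} = ∈comprehension⁺ (λ i → block i ⊆? Y)

    trace⁻ : ∀ {Y i} → i ∈ trace Y → block i ⊆ Y
    trace⁻ {Y} = ∈comprehension⁻ (λ i → block i ⊆? Y)

    Saturated : Subset card → Set
    Saturated Y = ∀ i x → x ∈ block i → x ∈ Y → block i ⊆ Y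

    L-trace : ∀ {Y} → Y ⊆ P → Saturated Y → L (trace Y) ≡ Y
    L-trace {Y} Y⊆P saturated = ⊆-antisym
      (λ x∈ → let i , i∈ , x∈i = L⁻ {trace Y} x∈ in trace⁻ {Y} i∈ x∈i)
      (λ {x} x∈Y → let i , x∈i = block-at (Y⊆P x∈Y) in
        L⁺ {trace Y} (trace⁺ {Y} (saturated i x x∈i x∈Y)) x∈i)

    -- Blocks are strong, so a member meeting a block contains it or lies inside it, and the latter
    -- is excluded.
    spread-saturated : ∀ {Y} → Y ∈𝒮 → (∀ i → Y ⊈ block i) → Saturated Y
    spread-saturated {Y} Y∈𝒮 spread i x x∈i x∈Y = saturated (nested (block-strong i) Y∈𝒮 x∈i x∈Y)
      where
      saturated : block i ⊆ Y ⊎ Y ⊆ block i → block i ⊆ Y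
      saturated (inj₁ ⊆Y) = ⊆Y
      saturated (inj₂ Y⊆) = ⊥-elim (spread i Y⊆)

    member-trace : ∀ {Y} → Y ∈𝒮 → Y ⊆ P → (∀ i → Y ⊈ block i) → L (trace Y) ≡ Y
    member-trace Y∈𝒮 Y⊆P spread = L-trace Y⊆P (spread-saturated Y∈𝒮 spread)

    -- An uncrossed `L I` would be strong and lie strictly between the block of `x` and `P`,
    -- although that block is a child of `P`.
    crossing-member : ∀ I → Q I → Nontrivial I → ∃ λ Y → Y ∈𝒮 × Cross (L I) Y
    crossing-member I QI ((x , y , x∈I , y∈I , x≢y) , z , z∉I)
      with someSubset? (λ Y → member? Y ×-dec cross? (L I) Y)
    ... | yes found = found
    ... | no none = ⊥-elim (proj₂ (proj₂ (proj₂ (is-child x))) (L I)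
      (QI , λ Y Y∈𝒮 crosses → none (Y , Y∈𝒮 , crosses))
      (block-⊆L x∈I , (let u , u∈y = block-nonempty y in
        u , L⁺ y∈I u∈y , λ u∈x → x≢y (block-unique u∈x u∈y)))
      (L-⊆P , (let u , u∈z = block-nonempty z in
        u , proj₁ (block-⊂ z) u∈z , λ u∈L → z∉I (L-index u∈L u∈z))))

    abstract

      family : CrossedFamily Q
      family = record
        { member?   = λ I → member? (L I)
        ; nonempty  = λ I QI → let x , x∈ = members-nonempty _ QI ; i , i∈I , _ = L⁻ x∈ in i , i∈I
        ; whole     = subst _∈𝒮 (sym L-full) (proj₁ sP)
        ; singleton = λ i → subst _∈𝒮 (sym (L-singleton i)) (proj₁ (block-strong i))
        ; closed    = λ I J QI QJ c → let c∩ , c─ , c─′ , c∪ = wp (L I) (L J) QI QJ (cross-L c) in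
            subst _∈𝒮 (sym (L-∩ I J)) c∩ , subst _∈𝒮 (sym (L-─ I J)) c─ ,
            subst _∈𝒮 (sym (L-─ J I)) c─′ , subst _∈𝒮 (sym (L-∪ I J)) c∪
        ; crossed   = crossed
        }
        where
        crossed : ∀ I → Q I → Nontrivial I → ∃ λ H → Q H × Cross I H
        crossed I QI nt with crossing-member I QI nt
        -- A member crossing `L I` stays inside `P`, which is strong, and inside no block, since a
        -- block meeting `L I` is contained in it. So it is the union over its trace, and the
        -- crossing passes to index sets.
        ... | Y , Y∈𝒮 , c@((x , x∈) , L⊈Y , Y⊈L) = trace Y , subst _∈𝒮 (sym eq) Y∈𝒮 , cross-L⁻ (subst (Cross (L I)) (sym eq) c)
          where
          Y⊆P : Y ⊆ P
          Y⊆P = [ (λ P⊆Y → ⊥-elim (L⊈Y (λ x∈ → P⊆Y (L-⊆P x∈)))) , (λ Y⊆P → Y⊆P) ]′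
            (nested sP Y∈𝒮 (L-⊆P (∈∩ˡ x∈)) (∈∩ʳ x∈))
          eq : L (trace Y) ≡ Y
          eq = member-trace Y∈𝒮 Y⊆P λ i Y⊆i →
            Y⊈L (λ y∈Y → block-⊆L (L-index (∈∩ˡ x∈) (Y⊆i (∈∩ʳ x∈))) (Y⊆i y∈Y))

    open CrossedFamilyProperties family using (Coatom; coatom-exists; module Linear)

    prime⇒trivial : Prime P → ∀ I → Nontrivial I → ¬ Q I
    prime⇒trivial isPrime I ((x , y , x∈I , y∈I , x≢y) , z , z∉I) QI
      with isPrime (L I) QI (L-⊆P , (let u , u∈z = block-nonempty z in
             u , proj₁ (block-⊂ z) u∈z , λ u∈L → z∉I (L-index u∈L u∈z)))
    ... | C , cC , L⊆C with complete C cC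
    ...   | i , refl = x≢y (trans (sym (at x∈I)) (at y∈I))
      where
      at : ∀ {j} → j ∈ I → i ≡ j
      at {j} j∈I = let u , u∈j = block-nonempty j in block-unique (L⊆C (L⁺ j∈I u∈j)) u∈j

    -- The counterexamples to `Prime P`; by saturation they are unions of at least two blocks, but
    -- not of all.
    Spread : Subset card → Set
    Spread Y = Y ∈𝒮 × Y ⊂ P × (∀ i → Y ⊈ block i)

    spread? : Decidable Spread
    spread? Y = member? Y ×-dec (Y ⊂? P) ×-dec all? λ i → ¬? (Y ⊆? block i)

    ¬spread⇒prime : ¬ (∃ Spread) → Prime P
    ¬spread⇒prime none Y Y∈𝒮 Y⊂P = in-child (any? λ i → Y ⊆? block i)
      where
      in-child : Dec (∃ λ i → Y ⊆ block i) → ∃ λ C → ChildOf C P × Y ⊆ C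
      in-child (yes (i , Y⊆i)) = block i , is-child i , Y⊆i
      in-child (no out) = ⊥-elim (none (Y , Y∈𝒮 , Y⊂P , λ i Y⊆i → out (i , Y⊆i)))

    spread⇒nontrivial : ∀ {Y} → Spread Y → Q (trace Y) × Nontrivial (trace Y)
    spread⇒nontrivial {Y} (Y∈𝒮 , (Y⊆P , z , z∈P , z∉Y) , spread) =
      subst _∈𝒮 (sym (member-trace Y∈𝒮 Y⊆P spread)) Y∈𝒮 ,
      two (members-nonempty Y Y∈𝒮) , outside (block-at z∈P)
      where
      index-in : ∀ {x} → x ∈ Y → ∃ λ i → i ∈ trace Y × x ∈ block i
      index-in {x} x∈Y with block-at (Y⊆P x∈Y)
      ... | i , x∈i = i , trace⁺ {Y} (spread-saturated Y∈𝒮 spread i x x∈i x∈Y) , x∈i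
      outside : (∃ λ i → z ∈ block i) → ∃ λ i → i ∉ trace Y
      outside (i , z∈i) = i , λ i∈ → z∉Y (trace⁻ {Y} i∈ z∈i)
      two : Nonempty Y → ∃ λ x → ∃ λ y → x ∈ trace Y × y ∈ trace Y × x ≢ y
      two (x , x∈Y) with index-in x∈Y
      ... | i , i∈ , x∈i with ⊈⇒∃ (spread i)
      ...   | y , y∈Y , y∉i with index-in y∈Y
      ...     | j , j∈ , y∈j = i , j , i∈ , j∈ , λ { refl → y∉i y∈j }

    abstract

      ¬prime⇒nontrivial : ¬ Prime P → ∃ λ M → Q M × Nontrivial M
      ¬prime⇒nontrivial ¬prime = found (someSubset? spread?)
        where
        found : Dec (∃ Spread) → ∃ λ M → Q M × Nontrivial M
        found (yes (Y , spread)) = trace Y , spread⇒nontrivial spread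
        found (no none) = ⊥-elim (¬prime (¬spread⇒prime none))

    degenerate⇒complete : Degenerate P → ∀ I → Nonempty I → Q I
    degenerate⇒complete isDegenerate I I≢∅ = isDegenerate (L I) L-⊆P (L-nonempty I≢∅) λ C cC (x , x∈) → saturated C cC x x∈
      where
      saturated : ∀ C → ChildOf C P → ∀ x → x ∈ C ∩ L I → C ⊆ L I
      saturated C cC x x∈ with complete C cC
      ... | i , refl = block-⊆L (L-index (∈∩ʳ x∈) (∈∩ˡ x∈))

    complete⇒degenerate : (∀ I → Nonempty I → Q I) → Degenerate P
    complete⇒degenerate all Y Y⊆P (y , y∈Y) saturated = subst _∈𝒮 (L-trace Y⊆P saturates) (all (trace Y)
      (let i , y∈i = block-at (Y⊆P y∈Y) in i , trace⁺ {Y} (saturates i y y∈i y∈Y)))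
      where
      saturates : Saturated Y
      saturates i x x∈i x∈Y = saturated (block i) (is-child i) (x , ∈∩⁺ x∈i x∈Y)

    abstract

      coatom-block : ∀ i → L (full ─ ⁅ i ⁆) ≡ P ─ block i
      coatom-block i = trans (L-─ full ⁅ i ⁆)
        (trans (cong (_─ L ⁅ i ⁆) L-full) (cong (P ─_) (L-singleton i)))

      end-exists : ¬ Prime P → ∃ λ E → End E P
      end-exists ¬prime = from-coatom (coatom-exists (proj₁ M) (proj₁ (proj₂ M)) (proj₂ (proj₂ M)))
        where
        M : ∃ λ M → Q M × Nontrivial M
        M = ¬prime⇒nontrivial ¬prime
        from-coatom : ∃ Coatom → ∃ λ E → End E P
        from-coatom (e , co) = block e , is-child e , subst _∈𝒮 (coatom-block e) co

    module LinearNode (¬prime : ¬ Prime P) (¬degenerate : ¬ Degenerate P) {E} (end : End E P) where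

      e : Fin count
      e = proj₁ (complete E (proj₁ end))

      block-e : block e ≡ E
      block-e = proj₂ (complete E (proj₁ end))

      e-coatom : Coatom e
      e-coatom = subst _∈𝒮 (sym (trans (coatom-block e) (cong (P ─_) block-e))) (proj₂ end)

      module Order = Linear
        (proj₁ (¬prime⇒nontrivial ¬prime)) (proj₁ (proj₂ (¬prime⇒nontrivial ¬prime)))
        (proj₂ (proj₂ (¬prime⇒nontrivial ¬prime)))
        (λ all → ¬degenerate (complete⇒degenerate all)) e e-coatom

      open Order using (_⊴_)

      precedes⇒⊴ : ∀ {i j} → Precedes P E (block i) (block j) → i ⊴ j
      precedes⇒⊴ {i} {j} prec I QI e∈I j∈I = block-⊆L⁻
        (λ x∈ → prec (L I) QI L-⊆P (λ x∈E → block-⊆L e∈I (subst (_ ∈_) (sym block-e) x∈E)) (block-⊆L j∈I) x∈)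

      ⊴⇒precedes : ∀ {i j} → i ⊴ j → Precedes P E (block i) (block j)
      -- Containing the blocks of both `e` and `j`, the set `Y` can lie inside one block only if `j`
      -- is `e`; then the member `⁅ e ⁆` forces `i` to be `e` as well. In all other cases `Y` is the
      -- union over its trace.
      ⊴⇒precedes {i} {j} i⊴j Y Y∈𝒮 Y⊆P E⊆Y j⊆Y with j Fin.≟ e
      ... | yes j≡e = subst (λ i → block i ⊆ Y) (trans j≡e (sym i≡e)) j⊆Y
        where
        i≡e : i ≡ e
        i≡e = x∈⁅y⁆⇒x≡y e (i⊴j ⁅ e ⁆ (CrossedFamily.singleton family e) (x∈⁅x⁆ e)
                (subst (_∈ ⁅ e ⁆) (sym j≡e) (x∈⁅x⁆ e)))
      ... | no j≢e = trace⁻ {Y} (i⊴j (trace Y) (subst _∈𝒮 (sym (member-trace Y∈𝒮 Y⊆P spread)) Y∈𝒮)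
            (trace⁺ {Y} (subst (_⊆ Y) (sym block-e) E⊆Y)) (trace⁺ {Y} j⊆Y))
        where
        spread : ∀ k → Y ⊈ block k
        spread k Y⊆k with block-nonempty j | block-nonempty e
        ... | x , x∈j | y , y∈e = j≢e (trans (block-unique x∈j (Y⊆k (j⊆Y x∈j)))
          (sym (block-unique y∈e (Y⊆k (E⊆Y (subst (y ∈_) block-e y∈e))))))

    module _ (¬prime : ¬ Prime P) (¬degenerate : ¬ Degenerate P) {E} (end : End E P) where

      private module N = LinearNode ¬prime ¬degenerate end

      abstract

        precedes-antisym : ∀ {i j} → Precedes P E (block i) (block j) → Precedes P E (block j) (block i) → i ≡ j
        precedes-antisym p q = N.Order.⊴-antisym (N.precedes⇒⊴ p) (N.precedes⇒⊴ q)

        precedes-total : ∀ i j → Precedes P E (block i) (block j) ⊎ Precedes P E (block j) (block i)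
        precedes-total i j = [ (λ i⊴j → inj₁ (N.⊴⇒precedes i⊴j)) , (λ j⊴i → inj₂ (N.⊴⇒precedes j⊴i)) ]′
          (N.Order.⊴-total i j)

        member⇔interval : (∀ i j → i Fin.< j → Precedes P E (block i) (block j)) →
          ∀ I → Nonempty I → Q I ⇔ Interval I
        member⇔interval monotone I I≢∅ = mk⇔ M.member⇒interval (M.interval⇒member I≢∅)
          where module M = N.Order.Monotone (λ i j i<j → N.precedes⇒⊴ (monotone i j i<j))

-- Colours on the leaves

module Colours (𝒮 : SetSystem) (G C : Fin 3 → Fin (SetSystem.card 𝒮) → Set) where

  open SetSystem 𝒮
  open StrongSets 𝒮

  -- With respect to the leaves Z of a strategy, Full claims that W has colour i and
  -- its negation that it has not; Alternating says that the claims are consistent.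

  Full : Fin 3 → Subset card → Subset card → Set
  Full i Z W = (∀ u → W ≡ ⁅ u ⁆ → G i u) × (∀ X → ChildOf X W → Nonempty (X ∩ Z))

  Alternating : Fin 3 → Subset card → Subset card → Set
  Alternating i Z V = ∀ W → Strong 𝒮 W → W ⊆ V → Nonempty (W ∩ Z) →
    ∀ X → ChildOf X W → Nonempty (X ∩ Z) → (Full i Z X → ¬ Full i Z W) × (¬ Full i Z W → Full i Z X)

  Coloured : Fin 3 → Subset card → Set
  Coloured i V = ∃ λ Z → Nonempty (V ∩ Z) × Alternating i Z V × Full i Z V

  Rep : Fin 3 → Fin card → Subset card → Set
  Rep i x X = C i x × Strong 𝒮 X × Inner X × Coloured i X × x ∈ X ×
    (∀ Y → Strong 𝒮 Y → x ∈ Y → Y ⊂ X → ¬ Coloured i Y)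

  -- Copy 0 of x codes the leaf x, copy i + 1 the inner node represented by x in colour i.

  Node : Fin 4 → Fin card → Subset card → Set
  Node zero    x X = X ≡ ⁅ x ⁆
  Node (suc i) x X = Rep i x X

  -- A node with two children satisfies both `Prime` and `Degenerate`; asking for `Prime` first
  -- makes the label unique.
  HasLabel : Label → Subset card → Set
  HasLabel prime      X = Strong 𝒮 X × Inner X × Prime X
  HasLabel degenerate X = Strong 𝒮 X × Inner X × ¬ Prime X × Degenerate X
  HasLabel linear     X = Strong 𝒮 X × Inner X × ¬ Prime X × ¬ Degenerate X

  -- Between siblings, `¬ (B ⊆ A)` says that they differ and makes the order strict. The base point
  -- `E` is the child of `P` containing the leaf that represents `P`; `Accepted` makes it an end.
  Less : Subset card → Subset card → Set
  Less A B = ¬ (B ⊆ A) × ∃ λ P → ChildOf A P × ChildOf B P × HasLabel linear P ×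
    (∃ λ i → ∃ λ x → Rep i x P × ∃ λ E → ChildOf E P × x ∈ E × Precedes P E A B)

  Accepted : Set
  Accepted =
    (∀ X → Strong 𝒮 X → Inner X → ∃ λ i → ∃ λ x → Rep i x X) ×
    (∀ i j X x y → Rep i x X → Rep j y X → i ≡ j × x ≡ y) ×
    (∀ i P x E → HasLabel linear P → Rep i x P → ChildOf E P → x ∈ E → End E P)

-- Satisfaction

abstract

  sat? : ∀ {Γ e s} (𝔸 : Structure Γ) (φ : Formula Γ e s) ρ σ → Dec (𝔸 ⊨ φ [ ρ , σ ])
  sat? 𝔸 (x ≈̇ y) ρ σ          = lookup ρ x Fin.≟ lookup ρ y
  sat? 𝔸 (x ∈̇ X) ρ σ          = lookup ρ x ∈? lookup σ X
  sat? 𝔸 (relation R xs) ρ σ  = T? (rel 𝔸 R (Vec.map (lookup ρ) xs))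
  sat? 𝔸 (predicate R Xs) ρ σ = T? (pred 𝔸 R (Vec.map (lookup σ) Xs))
  sat? 𝔸 (¬̇ φ) ρ σ            = ¬? (sat? 𝔸 φ ρ σ)
  sat? 𝔸 (φ ∧̇ ψ) ρ σ          = sat? 𝔸 φ ρ σ ×-dec sat? 𝔸 ψ ρ σ
  sat? 𝔸 (φ ∨̇ ψ) ρ σ          = sat? 𝔸 φ ρ σ ⊎-dec sat? 𝔸 ψ ρ σ
  sat? 𝔸 (∃ᵉ φ) ρ σ           = any? λ x → sat? 𝔸 φ (x ∷ ρ) σ
  sat? 𝔸 (∀ᵉ φ) ρ σ           = all? λ x → sat? 𝔸 φ (x ∷ ρ) σ
  sat? 𝔸 (∃ˢ φ) ρ σ           = someSubset? λ X → sat? 𝔸 φ ρ (X ∷ σ)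
  sat? 𝔸 (∀ˢ φ) ρ σ           = allSubset? λ X → sat? 𝔸 φ ρ (X ∷ σ)

infixr 3 _⇒̇_
_⇒̇_ : ∀ {Γ e s} → Formula Γ e s → Formula Γ e s → Formula Γ e s
φ ⇒̇ ψ = ¬̇ φ ∨̇ ψ

⋁̇ : ∀ {Γ e s k} → (Fin (suc k) → Formula Γ e s) → Formula Γ e s
⋁̇ {k = zero}  φ = φ zero
⋁̇ {k = suc k} φ = φ zero ∨̇ ⋁̇ (φ ∘ suc)

⋀̇ : ∀ {Γ e s k} → (Fin (suc k) → Formula Γ e s) → Formula Γ e s
⋀̇ {k = zero}  φ = φ zero
⋀̇ {k = suc k} φ = φ zero ∧̇ ⋀̇ (φ ∘ suc)

module Satisfaction {Γ} (𝔸 : Structure Γ) where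

  record Means {e s} (φ : Formula Γ e s) (ρ : Vec (Fin (size 𝔸)) e) (σ : Vec (Subset (size 𝔸)) s) (P : Set) : Set where
    field
      sound    : 𝔸 ⊨ φ [ ρ , σ ] → P
      complete : P → 𝔸 ⊨ φ [ ρ , σ ]

  open Means public

  means-dec : ∀ {e s} {φ : Formula Γ e s} {ρ σ P} → Means φ ρ σ P → Dec P
  means-dec {φ = φ} {ρ} {σ} m = map′ (sound m) (complete m) (sat? 𝔸 φ ρ σ)

  literal : ∀ {e s} {φ : Formula Γ e s} {ρ σ} → Means φ ρ σ (𝔸 ⊨ φ [ ρ , σ ])
  literal = record { sound = id ; complete = id }

  rephrase : ∀ {e s} {φ : Formula Γ e s} {ρ σ} {P Q : Set} → Means φ ρ σ P → (P → Q) → (Q → P) → Means φ ρ σ Q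
  rephrase m f g = record { sound = f ∘ sound m ; complete = complete m ∘ g }

  module _ {e s : ℕ} {φ ψ : Formula Γ e s} {ρ : Vec (Fin (size 𝔸)) e} {σ : Vec (Subset (size 𝔸)) s} {P Q : Set} where

    ∧-means : Means φ ρ σ P → Means ψ ρ σ Q → Means (φ ∧̇ ψ) ρ σ (P × Q)
    ∧-means m n = record
      { sound    = λ (p , q) → sound m p , sound n q
      ; complete = λ (p , q) → complete m p , complete n q }

    -- Implication abbreviates `¬̇ φ ∨̇ ψ`, so the direction into the formula has to decide `φ`.
    ⇒-means : Means φ ρ σ P → Means ψ ρ σ Q → Means (φ ⇒̇ ψ) ρ σ (P → Q)
    ⇒-means m n = record
      { sound    = λ { (inj₁ ¬φ) p → contradiction (complete m p) ¬φ ; (inj₂ ψ) _ → sound n ψ }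
      ; complete = λ h → decide h (sat? 𝔸 φ ρ σ) }
      where
      decide : (P → Q) → Dec (𝔸 ⊨ φ [ ρ , σ ]) → 𝔸 ⊨ φ ⇒̇ ψ [ ρ , σ ]
      decide h (yes φ) = inj₂ (complete n (h (sound m φ)))
      decide h (no ¬φ) = inj₁ ¬φ

  ¬-means : ∀ {e s} {φ : Formula Γ e s} {ρ σ} {P : Set} → Means φ ρ σ P → Means (¬̇ φ) ρ σ (¬ P)
  ¬-means m = record { sound = _∘ complete m ; complete = _∘ sound m }

  module _ {e s : ℕ} {φ : Formula Γ (suc e) s} {ρ : Vec (Fin (size 𝔸)) e} {σ : Vec (Subset (size 𝔸)) s}
           {P : Fin (size 𝔸) → Set} where

    ∀ᵉ-means : (∀ x → Means φ (x ∷ ρ) σ (P x)) → Means (∀ᵉ φ) ρ σ (∀ x → P x)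
    ∀ᵉ-means m = record { sound = λ h x → sound (m x) (h x) ; complete = λ h x → complete (m x) (h x) }

    ∃ᵉ-means : (∀ x → Means φ (x ∷ ρ) σ (P x)) → Means (∃ᵉ φ) ρ σ (∃ P)
    ∃ᵉ-means m = record { sound = λ (x , h) → x , sound (m x) h ; complete = λ (x , h) → x , complete (m x) h }

  module _ {e s : ℕ} {φ : Formula Γ e (suc s)} {ρ : Vec (Fin (size 𝔸)) e} {σ : Vec (Subset (size 𝔸)) s}
           {P : Subset (size 𝔸) → Set} where

    ∀ˢ-means : (∀ X → Means φ ρ (X ∷ σ) (P X)) → Means (∀ˢ φ) ρ σ (∀ X → P X)
    ∀ˢ-means m = record { sound = λ h X → sound (m X) (h X) ; complete = λ h X → complete (m X) (h X) }

    ∃ˢ-means : (∀ X → Means φ ρ (X ∷ σ) (P X)) → Means (∃ˢ φ) ρ σ (∃ P)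
    ∃ˢ-means m = record { sound = λ (X , h) → X , sound (m X) h ; complete = λ (X , h) → X , complete (m X) h }

  ⋁-means : ∀ {e s k} (φ : Fin (suc k) → Formula Γ e s) {ρ σ} {P : Fin (suc k) → Set} →
    (∀ i → Means (φ i) ρ σ (P i)) → Means (⋁̇ φ) ρ σ (∃ P)
  ⋁-means {k = zero} φ m = record
    { sound    = λ h → zero , sound (m zero) h
    ; complete = λ { (zero , p) → complete (m zero) p } }
  ⋁-means {k = suc k} φ m = record
    { sound    = λ { (inj₁ h) → zero , sound (m zero) h
                   ; (inj₂ h) → let i , p = sound (⋁-means (φ ∘ suc) (m ∘ suc)) h in suc i , p }
    ; complete = λ { (zero , p)  → inj₁ (complete (m zero) p)
                   ; (suc i , p) → inj₂ (complete (⋁-means (φ ∘ suc) (m ∘ suc)) (i , p)) } }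

  ⋀-means : ∀ {e s k} (φ : Fin (suc k) → Formula Γ e s) {ρ σ} {P : Fin (suc k) → Set} →
    (∀ i → Means (φ i) ρ σ (P i)) → Means (⋀̇ φ) ρ σ (∀ i → P i)
  ⋀-means {k = zero} φ m = record
    { sound    = λ { h zero → sound (m zero) h }
    ; complete = λ p → complete (m zero) (p zero) }
  ⋀-means {k = suc k} φ m = record
    { sound    = λ { (h , _) zero → sound (m zero) h
                   ; (_ , h) (suc i) → sound (⋀-means (φ ∘ suc) (m ∘ suc)) h i }
    ; complete = λ p → complete (m zero) (p zero) , complete (⋀-means (φ ∘ suc) (m ∘ suc)) (p ∘ suc) }

-- Formulas over coloured set systems

Γ₁ : Vocabulary
Γ₁ = withColours 6 setVocabulary

-- The colouring step hands over a bare structure; these properties of what remains after forgetting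
-- the colours let a set system be rebuilt from it.
record IsSetSystem (𝔸 : Structure setVocabulary) : Set where
  field
    size≢0           : ℕ.NonZero (size 𝔸)
    members-nonempty : ∀ X → T (pred 𝔸 SET (X ∷ [])) → Nonempty X
    whole∈𝒮          : T (pred 𝔸 SET (full ∷ []))
    singleton∈𝒮      : ∀ u → T (pred 𝔸 SET (⁅ u ⁆ ∷ []))

systemOf : (𝔸 : Structure setVocabulary) → IsSetSystem 𝔸 → SetSystem
systemOf 𝔸 isSystem = record
  { card = size 𝔸 ; card≢0 = size≢0 ; member = λ X → pred 𝔸 SET (X ∷ [])
  ; members-nonempty = members-nonempty ; whole∈𝒮 = whole∈𝒮 ; singleton∈𝒮 = singleton∈𝒮 }
  where open IsSetSystem isSystem

markG markC : Fin 3 → Fin 6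
markG i = i Fin.↑ˡ 3
markC i = 3 Fin.↑ʳ i

module _ {e s : ℕ} where

  memberᶠ : Fin s → Formula Γ₁ e s
  memberᶠ X = predicate SET (X ∷ [])

  ⊆ᶠ : Fin s → Fin s → Formula Γ₁ e s
  ⊆ᶠ X Y = ∀ᵉ (zero ∈̇ X ⇒̇ zero ∈̇ Y)

  ⊂ᶠ : Fin s → Fin s → Formula Γ₁ e s
  ⊂ᶠ X Y = ⊆ᶠ X Y ∧̇ ∃ᵉ (zero ∈̇ Y ∧̇ ¬̇ zero ∈̇ X)

  meetsᶠ : Fin s → Fin s → Formula Γ₁ e s
  meetsᶠ X Y = ∃ᵉ (zero ∈̇ X ∧̇ zero ∈̇ Y)

  nonemptyᶠ : Fin s → Formula Γ₁ e s
  nonemptyᶠ X = ∃ᵉ (zero ∈̇ X)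

  crossᶠ : Fin s → Fin s → Formula Γ₁ e s
  crossᶠ X Y = meetsᶠ X Y ∧̇ ¬̇ ⊆ᶠ X Y ∧̇ ¬̇ ⊆ᶠ Y X

  innerᶠ : Fin s → Formula Γ₁ e s
  innerᶠ X = ∃ᵉ (∃ᵉ (suc zero ∈̇ X ∧̇ zero ∈̇ X ∧̇ ¬̇ suc zero ≈̇ zero))

  singletonᶠ : Fin e → Fin s → Formula Γ₁ e s
  singletonᶠ x X = x ∈̇ X ∧̇ ¬̇ innerᶠ X

  markᶠ : Fin 6 → Fin e → Formula Γ₁ e s
  markᶠ i x = relation (colour i) (x ∷ [])

module _ {e s : ℕ} where

  strongᶠ : Fin s → Formula Γ₁ e s
  strongᶠ X = memberᶠ X ∧̇ ∀ˢ (memberᶠ zero ⇒̇ ¬̇ crossᶠ (suc X) zero)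

module _ {e s : ℕ} where

  childᶠ : Fin s → Fin s → Formula Γ₁ e s
  childᶠ X P = strongᶠ X ∧̇ strongᶠ P ∧̇ ⊂ᶠ X P ∧̇
    ∀ˢ (strongᶠ zero ⇒̇ ⊂ᶠ (suc X) zero ⇒̇ ¬̇ ⊂ᶠ zero (suc P))

module _ {e s : ℕ} where

  fullᶠ : Fin 3 → Fin s → Fin s → Formula Γ₁ e s
  fullᶠ i Z W = ∀ᵉ (singletonᶠ zero W ⇒̇ markᶠ (markG i) zero) ∧̇
                ∀ˢ (childᶠ zero (suc W) ⇒̇ meetsᶠ zero (suc Z))

  primeᶠ : Fin s → Formula Γ₁ e s
  primeᶠ P = ∀ˢ (memberᶠ zero ⇒̇ ⊂ᶠ zero (suc P) ⇒̇
    ∃ˢ (childᶠ zero (suc (suc P)) ∧̇ ⊆ᶠ (suc zero) zero))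

  degenerateᶠ : Fin s → Formula Γ₁ e s
  degenerateᶠ P = ∀ˢ (⊆ᶠ zero (suc P) ⇒̇ nonemptyᶠ zero ⇒̇
    ∀ˢ (childᶠ zero (suc (suc P)) ⇒̇ meetsᶠ zero (suc zero) ⇒̇ ⊆ᶠ zero (suc zero)) ⇒̇ memberᶠ zero)

  differenceᶠ : Fin s → Fin s → Fin s → Formula Γ₁ e s
  differenceᶠ D P E = ∀ᵉ ((zero ∈̇ D ⇒̇ zero ∈̇ P ∧̇ ¬̇ zero ∈̇ E) ∧̇ (zero ∈̇ P ∧̇ ¬̇ zero ∈̇ E ⇒̇ zero ∈̇ D))

  precedesᶠ : Fin s → Fin s → Fin s → Fin s → Formula Γ₁ e s
  precedesᶠ P E A B = ∀ˢ (memberᶠ zero ⇒̇ ⊆ᶠ zero (suc P) ⇒̇ ⊆ᶠ (suc E) zero ⇒̇ ⊆ᶠ (suc B) zero ⇒̇ ⊆ᶠ (suc A) zero)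

module _ {e s : ℕ} where

  endᶠ : Fin s → Fin s → Formula Γ₁ e s
  endᶠ E P = childᶠ E P ∧̇ ∃ˢ (differenceᶠ zero (suc P) (suc E) ∧̇ memberᶠ zero)

  alternatingᶠ : Fin 3 → Fin s → Fin s → Formula Γ₁ e s
  alternatingᶠ i Z V = ∀ˢ (strongᶠ zero ⇒̇ ⊆ᶠ zero (suc V) ⇒̇ meetsᶠ zero (suc Z) ⇒̇
    ∀ˢ (childᶠ zero (suc zero) ⇒̇ meetsᶠ zero (suc (suc Z)) ⇒̇
      (fullᶠ i (suc (suc Z)) zero ⇒̇ ¬̇ fullᶠ i (suc (suc Z)) (suc zero)) ∧̇
      (¬̇ fullᶠ i (suc (suc Z)) (suc zero) ⇒̇ fullᶠ i (suc (suc Z)) zero)))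

  labelᶠ : Label → Fin s → Formula Γ₁ e s
  labelᶠ prime      X = strongᶠ X ∧̇ innerᶠ X ∧̇ primeᶠ X
  labelᶠ degenerate X = strongᶠ X ∧̇ innerᶠ X ∧̇ ¬̇ primeᶠ X ∧̇ degenerateᶠ X
  labelᶠ linear     X = strongᶠ X ∧̇ innerᶠ X ∧̇ ¬̇ primeᶠ X ∧̇ ¬̇ degenerateᶠ X

module _ {e s : ℕ} where

  colouredᶠ : Fin 3 → Fin s → Formula Γ₁ e s
  colouredᶠ i V = ∃ˢ (meetsᶠ (suc V) zero ∧̇ alternatingᶠ i zero (suc V) ∧̇ fullᶠ i zero (suc V))

module _ {e s : ℕ} where

  repᶠ : Fin 3 → Fin e → Fin s → Formula Γ₁ e s
  repᶠ i x X = markᶠ (markC i) x ∧̇ strongᶠ X ∧̇ innerᶠ X ∧̇ colouredᶠ i X ∧̇ x ∈̇ X ∧̇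
    ∀ˢ (strongᶠ zero ⇒̇ x ∈̇ zero ⇒̇ ⊂ᶠ zero (suc X) ⇒̇ ¬̇ colouredᶠ i zero)

module _ {e s : ℕ} where

  nodeᶠ : Fin 4 → Fin e → Fin s → Formula Γ₁ e s
  nodeᶠ zero    x X = singletonᶠ x X
  nodeᶠ (suc i) x X = repᶠ i x X

  lessᶠ : Fin s → Fin s → Formula Γ₁ e s
  lessᶠ A B = ¬̇ ⊆ᶠ B A ∧̇ ∃ˢ (childᶠ (suc A) zero ∧̇ childᶠ (suc B) zero ∧̇ labelᶠ linear zero ∧̇
    ⋁̇ (λ i → ∃ᵉ (repᶠ i zero zero ∧̇
      ∃ˢ (childᶠ zero (suc zero) ∧̇ zero ∈̇ zero ∧̇ precedesᶠ (suc zero) zero (suc (suc A)) (suc (suc B))))))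

  -- Formulas have no truth constants, hence the variable.
  constantᶠ : Bool → Fin e → Formula Γ₁ e s
  constantᶠ true  x = x ≈̇ x
  constantᶠ false x = ¬̇ x ≈̇ x

acceptedᶠ : Formula Γ₁ 0 0
acceptedᶠ =
  ∀ˢ (strongᶠ zero ⇒̇ innerᶠ zero ⇒̇ ⋁̇ λ i → ∃ᵉ (repᶠ i zero zero)) ∧̇
  (⋀̇ λ i → ⋀̇ λ j → ∀ˢ (∀ᵉ (∀ᵉ (repᶠ i (suc zero) zero ⇒̇ repᶠ j zero zero ⇒̇
    constantᶠ (does (i Fin.≟ j)) zero ∧̇ suc zero ≈̇ zero)))) ∧̇
  (⋀̇ λ i → ∀ˢ (∀ᵉ (∀ˢ (labelᶠ linear (suc zero) ⇒̇ repᶠ i zero (suc zero) ⇒̇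
    childᶠ zero (suc zero) ⇒̇ zero ∈̇ zero ⇒̇ endᶠ zero (suc zero)))))

module Meaning (𝔹 : Structure Γ₁) (isSystem : IsSetSystem (forgetColours 𝔹)) where

  𝒮 : SetSystem
  𝒮 = systemOf (forgetColours 𝔹) isSystem

  open SetSystem 𝒮
  open StrongSets 𝒮
  open Satisfaction 𝔹

  G C : Fin 3 → Fin card → Set
  G i u = T (rel 𝔹 (colour (markG i)) (u ∷ []))
  C i u = T (rel 𝔹 (colour (markC i)) (u ∷ []))

  open Colours 𝒮 G C

  module _ {e s : ℕ} {ρ : Vec (Fin card) e} {σ : Vec (Subset card) s} where

    member-means : ∀ X → Means (memberᶠ X) ρ σ (lookup σ X ∈𝒮)
    member-means X = literal

    ⊆-means : ∀ X Y → Means (⊆ᶠ X Y) ρ σ (lookup σ X ⊆ lookup σ Y)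
    ⊆-means X Y = rephrase (∀ᵉ-means λ x → ⇒-means literal literal) (λ h {x} → h x) (λ h x → h)

    ⊂-means : ∀ X Y → Means (⊂ᶠ X Y) ρ σ (lookup σ X ⊂ lookup σ Y)
    ⊂-means X Y = ∧-means (⊆-means X Y) literal

    meets-means : ∀ X Y → Means (meetsᶠ X Y) ρ σ (Nonempty (lookup σ X ∩ lookup σ Y))
    meets-means X Y = rephrase literal (λ (x , x∈X , x∈Y) → x , ∈∩⁺ x∈X x∈Y) (λ (x , x∈) → x , ∈∩ˡ x∈ , ∈∩ʳ x∈)

    nonempty-means : ∀ X → Means (nonemptyᶠ X) ρ σ (Nonempty (lookup σ X))
    nonempty-means X = literal

    cross-means : ∀ X Y → Means (crossᶠ X Y) ρ σ (Cross (lookup σ X) (lookup σ Y))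
    cross-means X Y = ∧-means (meets-means X Y) (∧-means (¬-means (⊆-means X Y)) (¬-means (⊆-means Y X)))

    inner-means : ∀ X → Means (innerᶠ X) ρ σ (Inner (lookup σ X))
    inner-means X = literal

    singleton-means : ∀ x X → Means (singletonᶠ x X) ρ σ (lookup σ X ≡ ⁅ lookup ρ x ⁆)
    singleton-means x X = rephrase (∧-means literal (¬-means (inner-means X)))
      (λ (x∈X , ¬inner) → ¬inner⇒singleton ¬inner x∈X)
      (λ eq → subst (lookup ρ x ∈_) (sym eq) (x∈⁅x⁆ _) , λ inner → ¬inner-singleton (subst Inner eq inner))

    mark-means : ∀ i x → Means (markᶠ i x) ρ σ (T (rel 𝔹 (colour i) (lookup ρ x ∷ [])))
    mark-means i x = literal

  module _ {e s : ℕ} {ρ : Vec (Fin card) e} {σ : Vec (Subset card) s} where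

    strong-means : ∀ X → Means (strongᶠ X) ρ σ (Strong 𝒮 (lookup σ X))
    strong-means X = ∧-means (member-means X)
      (∀ˢ-means λ Y → ⇒-means (member-means zero) (¬-means (cross-means (suc X) zero)))

  module _ {e s : ℕ} {ρ : Vec (Fin card) e} {σ : Vec (Subset card) s} where

    child-means : ∀ X P → Means (childᶠ X P) ρ σ (ChildOf (lookup σ X) (lookup σ P))
    child-means X P = ∧-means (strong-means X) (∧-means (strong-means P) (∧-means (⊂-means X P)
      (∀ˢ-means λ Z → ⇒-means (strong-means zero) (⇒-means (⊂-means (suc X) zero) (¬-means (⊂-means zero (suc P)))))))

  module _ {e s : ℕ} {ρ : Vec (Fin card) e} {σ : Vec (Subset card) s} where

    full-means : ∀ i Z W → Means (fullᶠ i Z W) ρ σ (Full i (lookup σ Z) (lookup σ W))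
    full-means i Z W = ∧-means
      (∀ᵉ-means λ u → ⇒-means (singleton-means zero W) (mark-means (markG i) zero))
      (∀ˢ-means λ X → ⇒-means (child-means zero (suc W)) (meets-means zero (suc Z)))

    prime-means : ∀ P → Means (primeᶠ P) ρ σ (Prime (lookup σ P))
    prime-means P = ∀ˢ-means λ Y → ⇒-means (member-means zero) (⇒-means (⊂-means zero (suc P))
      (∃ˢ-means λ C → ∧-means (child-means zero (suc (suc P))) (⊆-means (suc zero) zero)))

    degenerate-means : ∀ P → Means (degenerateᶠ P) ρ σ (Degenerate (lookup σ P))
    degenerate-means P = ∀ˢ-means λ Y → ⇒-means (⊆-means zero (suc P)) (⇒-means (nonempty-means zero)
      (⇒-means (∀ˢ-means λ C → ⇒-means (child-means zero (suc (suc P)))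
        (⇒-means (meets-means zero (suc zero)) (⊆-means zero (suc zero)))) (member-means zero)))

    difference-means : ∀ D P E → Means (differenceᶠ D P E) ρ σ (lookup σ D ≡ lookup σ P ─ lookup σ E)
    difference-means D P E = rephrase
      (∀ᵉ-means λ x → ∧-means (⇒-means literal literal) (⇒-means literal literal))
      (λ h → ⊆-antisym (λ {x} x∈D → let x∈P , x∉E = proj₁ (h x) x∈D in ∈─⁺ x∈P x∉E)
                       (λ {x} x∈ → proj₂ (h x) (∈─ˡ x∈ , ∈─ʳ x∈)))
      (λ eq x → (λ x∈D → let x∈ = subst (x ∈_) eq x∈D in ∈─ˡ x∈ , ∈─ʳ x∈) ,
                (λ (x∈P , x∉E) → subst (x ∈_) (sym eq) (∈─⁺ x∈P x∉E)))

    precedes-means : ∀ P E A B →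
      Means (precedesᶠ P E A B) ρ σ (Precedes (lookup σ P) (lookup σ E) (lookup σ A) (lookup σ B))
    precedes-means P E A B = ∀ˢ-means λ Y → ⇒-means (member-means zero) (⇒-means (⊆-means zero (suc P))
      (⇒-means (⊆-means (suc E) zero) (⇒-means (⊆-means (suc B) zero) (⊆-means (suc A) zero))))

  module _ {e s : ℕ} {ρ : Vec (Fin card) e} {σ : Vec (Subset card) s} where

    end-means : ∀ E P → Means (endᶠ E P) ρ σ (End (lookup σ E) (lookup σ P))
    end-means E P = ∧-means (child-means E P)
      (rephrase (∃ˢ-means λ D → ∧-means (difference-means zero (suc P) (suc E)) (member-means zero))
        (λ (D , eq , D∈𝒮) → subst _∈𝒮 eq D∈𝒮) (λ ∈𝒮 → _ , refl , ∈𝒮))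

    alternating-means : ∀ i Z V → Means (alternatingᶠ i Z V) ρ σ (Alternating i (lookup σ Z) (lookup σ V))
    alternating-means i Z V = ∀ˢ-means λ W → ⇒-means (strong-means zero) (⇒-means (⊆-means zero (suc V))
      (⇒-means (meets-means zero (suc Z)) (∀ˢ-means λ X → ⇒-means (child-means zero (suc zero))
        (⇒-means (meets-means zero (suc (suc Z))) (∧-means
          (⇒-means (full-means i (suc (suc Z)) zero) (¬-means (full-means i (suc (suc Z)) (suc zero))))
          (⇒-means (¬-means (full-means i (suc (suc Z)) (suc zero))) (full-means i (suc (suc Z)) zero)))))))

    label-means : ∀ l X → Means (labelᶠ l X) ρ σ (HasLabel l (lookup σ X))
    label-means prime X = ∧-means (strong-means X) (∧-means (inner-means X) (prime-means X))
    label-means degenerate X = ∧-means (strong-means X) (∧-means (inner-means X)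
      (∧-means (¬-means (prime-means X)) (degenerate-means X)))
    label-means linear X = ∧-means (strong-means X) (∧-means (inner-means X)
      (∧-means (¬-means (prime-means X)) (¬-means (degenerate-means X))))

  module _ {e s : ℕ} {ρ : Vec (Fin card) e} {σ : Vec (Subset card) s} where

    coloured-means : ∀ i V → Means (colouredᶠ i V) ρ σ (Coloured i (lookup σ V))
    coloured-means i V = ∃ˢ-means λ Z → ∧-means (meets-means (suc V) zero)
      (∧-means (alternating-means i zero (suc V)) (full-means i zero (suc V)))

  module _ {e s : ℕ} {ρ : Vec (Fin card) e} {σ : Vec (Subset card) s} where

    rep-means : ∀ i x X → Means (repᶠ i x X) ρ σ (Rep i (lookup ρ x) (lookup σ X))
    rep-means i x X = ∧-means (mark-means (markC i) x) (∧-means (strong-means X) (∧-means (inner-means X)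
      (∧-means (coloured-means i X) (∧-means literal
        (∀ˢ-means λ Y → ⇒-means (strong-means zero) (⇒-means literal (⇒-means (⊂-means zero (suc X))
          (¬-means (coloured-means i zero)))))))))

  module _ {e s : ℕ} {ρ : Vec (Fin card) e} {σ : Vec (Subset card) s} where

    node-means : ∀ i x X → Means (nodeᶠ i x X) ρ σ (Node i (lookup ρ x) (lookup σ X))
    node-means zero    x X = singleton-means x X
    node-means (suc i) x X = rep-means i x X

    less-means : ∀ A B → Means (lessᶠ A B) ρ σ (Less (lookup σ A) (lookup σ B))
    less-means A B = ∧-means (¬-means (⊆-means B A)) (∃ˢ-means λ P →
      ∧-means (child-means (suc A) zero) (∧-means (child-means (suc B) zero) (∧-means (label-means linear zero)
        (⋁-means _ λ i → ∃ᵉ-means λ x → ∧-means (rep-means i zero zero)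
          (∃ˢ-means λ E → ∧-means (child-means zero (suc zero))
            (∧-means (literal {φ = zero ∈̇ zero}) (precedes-means (suc zero) zero (suc (suc A)) (suc (suc B)))))))))

    constant-means : ∀ {P : Set} (P? : Dec P) x → Means (constantᶠ (does P?) x) ρ σ P
    constant-means (yes p) x = rephrase literal (λ _ → p) (λ _ → refl)
    constant-means (no ¬p) x = rephrase literal (λ ¬refl → contradiction refl ¬refl) (λ p → contradiction p ¬p)

  accepted-means : Means acceptedᶠ [] [] Accepted
  accepted-means = ∧-means
    (∀ˢ-means λ X → ⇒-means (strong-means zero) (⇒-means (inner-means zero)
      (⋁-means _ λ i → ∃ᵉ-means λ x → rep-means i zero zero)))
    (∧-means
      (⋀-means _ λ i → ⋀-means _ λ j → ∀ˢ-means λ X → ∀ᵉ-means λ x → ∀ᵉ-means λ y →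
        ⇒-means (rep-means i (suc zero) zero) (⇒-means (rep-means j zero zero)
          (∧-means (constant-means (i Fin.≟ j) zero) (literal {φ = suc zero ≈̇ zero}))))
      (⋀-means _ λ i → ∀ˢ-means λ P → ∀ᵉ-means λ x → ∀ˢ-means λ E →
        ⇒-means (label-means linear (suc zero)) (⇒-means (rep-means i zero (suc zero))
          (⇒-means (child-means zero (suc zero)) (⇒-means (literal {φ = zero ∈̇ zero}) (end-means zero (suc zero)))))))

-- A three-colouring of the strong sets

next : Fin 3 → Fin 3
next zero             = suc zero
next (suc zero)       = suc (suc zero)
next (suc (suc zero)) = zero

next≢ : ∀ a → next a ≢ a
next≢ zero ()
next≢ (suc zero) ()
next≢ (suc (suc zero)) ()

next²≢ : ∀ a → next (next a) ≢ a
next²≢ zero ()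
next²≢ (suc zero) ()
next²≢ (suc (suc zero)) ()

≢⇒next : ∀ {i} a → i ≢ a → i ≡ next a ⊎ i ≡ next (next a)
≢⇒next {zero}           zero             i≢a = contradiction refl i≢a
≢⇒next {zero}           (suc zero)       i≢a = inj₂ refl
≢⇒next {zero}           (suc (suc zero)) i≢a = inj₁ refl
≢⇒next {suc zero}       zero             i≢a = inj₁ refl
≢⇒next {suc zero}       (suc zero)       i≢a = contradiction refl i≢a
≢⇒next {suc zero}       (suc (suc zero)) i≢a = inj₂ refl
≢⇒next {suc (suc zero)} zero             i≢a = inj₂ refl
≢⇒next {suc (suc zero)} (suc zero)       i≢a = inj₁ refl
≢⇒next {suc (suc zero)} (suc (suc zero)) i≢a = contradiction refl i≢a

module Colouring (𝒮 : SetSystem) (wp : WeaklyPartitive 𝒮) where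

  open SetSystem 𝒮
  open StrongSets 𝒮

  shift : Bool → Fin 3 → Fin 3
  shift true  a = next a
  shift false a = next (next a)

  shift≢ : ∀ b a → shift b a ≢ a
  shift≢ true  = next≢
  shift≢ false = next²≢

  -- Singles out the child containing one fixed element of `P`, hence exactly one child of an inner
  -- node. As there are at least two children, shifting its colour by one and that of the others by
  -- two makes both colours occur.
  distinguished : Subset card → Subset card → Bool
  distinguished X P with nonempty? P
  ... | yes (x , _) = does (x ∈? X)
  ... | no _        = false

  data Colour : Subset card → Fin 3 → Set where
    root : Colour full zero
    step : ∀ {X P a} → ChildOf X P → Colour P a → Colour X (shift (distinguished X P) a)

  colour-unique : ∀ {X a b} → Colour X a → Colour X b → a ≡ b
  colour-unique root root = refl
  colour-unique root (step (_ , _ , (_ , _ , _ , x∉) , _) _) = contradiction ∈⊤ x∉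
  colour-unique (step (_ , _ , (_ , _ , _ , x∉) , _) _) root = contradiction ∈⊤ x∉
  colour-unique (step {X} {P} c p) (step c′ q) with refl ← parent-unique c c′ =
    cong (shift (distinguished X P)) (colour-unique p q)

  abstract

    distinguished-child : ∀ {P} → Strong 𝒮 P → Inner P → ∃ λ X → ChildOf X P × distinguished X P ≡ true
    distinguished-child {P} sP inner with nonempty? P
    ... | no empty = contradiction (strong-nonempty sP) empty
    ... | yes (x , x∈P) with child-at sP inner x∈P
    ...   | X , cX , x∈X = X , cX , dec-true (x ∈? X) x∈X

    undistinguished-child : ∀ {P X Y} → ChildOf X P → ChildOf Y P → X ≢ Y →
      distinguished X P ≡ true → distinguished Y P ≡ false
    undistinguished-child {P} {X} {Y} cX cY X≢Y eq with nonempty? P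
    ... | yes (x , x∈P) with x ∈? X
    ...   | yes x∈X = dec-false (x ∈? Y) (λ x∈Y → X≢Y (children-disjoint cX cY x∈X x∈Y))

    colour-total : ∀ {X} → Strong 𝒮 X → ∃ (Colour X)
    colour-total {X} sX = go X sX (<-wellFounded _)
      where
      go : ∀ X → Strong 𝒮 X → Acc ℕ._<_ (card ∸ ∣ X ∣) → ∃ (Colour X)
      go X sX (acc rec) with ≡-dec Bool._≟_ X full
      ... | yes refl = zero , root
      ... | no X≢full with parent-exists sX X≢full
      ...   | P , c@(_ , sP , X⊂P , _) with go P sP (rec (ℕ.∸-monoʳ-< (p⊂q⇒∣p∣<∣q∣ X⊂P) (∣p∣≤n P)))
      ...     | a , p = _ , step c p

    κ : Subset card → Fin 3
    κ X with strong? X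
    ... | yes sX = proj₁ (colour-total sX)
    ... | no _   = zero

    κ-colour : ∀ {X} → Strong 𝒮 X → Colour X (κ X)
    κ-colour {X} sX with strong? X
    ... | yes sX′ = proj₂ (colour-total sX′)
    ... | no ¬sX = contradiction sX ¬sX

  κ-child : ∀ {X P} → ChildOf X P → κ X ≡ shift (distinguished X P) (κ P)
  κ-child c@(sX , sP , _) = colour-unique (κ-colour sX) (step c (κ-colour sP))

  κ-child≢ : ∀ {X P} → ChildOf X P → κ X ≢ κ P
  κ-child≢ {X} {P} c eq = shift≢ (distinguished X P) (κ P) (trans (sym (κ-child c)) eq)

  module _ {P} (sP : Strong 𝒮 P) (inner : Inner P) where

    κ-hits-next : ∃ λ X → ChildOf X P × κ X ≡ next (κ P)
    κ-hits-next with distinguished-child sP inner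
    ... | X , cX , eq = X , cX , trans (κ-child cX) (cong (λ b → shift b (κ P)) eq)

    κ-hits-next² : ∃ λ X → ChildOf X P × κ X ≡ next (next (κ P))
    κ-hits-next² with distinguished-child sP inner
    ... | X , cX , eq with two-children sP inner cX
    ...   | Y , cY , X≢Y = Y , cY ,
      trans (κ-child cY) (cong (λ b → shift b (κ P)) (undistinguished-child cX cY X≢Y eq))

    κ-hits : ∀ {i} → i ≢ κ P → ∃ λ X → ChildOf X P × κ X ≡ i
    κ-hits i≢ with ≢⇒next (κ P) i≢
    ... | inj₁ refl = κ-hits-next
    ... | inj₂ refl = κ-hits-next²

    κ-avoids : ∀ i → ∃ λ X → ChildOf X P × κ X ≢ i
    κ-avoids i with next (κ P) Fin.≟ i
    ... | no ≢i = let X , cX , eq = κ-hits-next in X , cX , λ κX≡i → ≢i (trans (sym eq) κX≡i)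
    ... | yes refl = let X , cX , eq = κ-hits-next² in X , cX , λ κX≡ → next≢ (next (κ P)) (trans (sym eq) κX≡)

  abstract

    -- The children of an inner node carry two colours, so one of them differs from `i` and the
    -- descent never gets stuck.
    avoiding-leaf : ∀ i {X} → Strong 𝒮 X → κ X ≢ i →
      ∃ λ u → u ∈ X × (∀ Y → Strong 𝒮 Y → u ∈ Y → Y ⊆ X → κ Y ≢ i)
    avoiding-leaf i {X} sX κX≢i = go X sX κX≢i (<-wellFounded _)
      where
      go : ∀ X → Strong 𝒮 X → κ X ≢ i → Acc ℕ._<_ ∣ X ∣ →
        ∃ λ u → u ∈ X × (∀ Y → Strong 𝒮 Y → u ∈ Y → Y ⊆ X → κ Y ≢ i)
      go X sX κX≢i (acc rec) with inner? X
      ... | no ¬inner with strong-nonempty sX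
      ...   | u , u∈X = u , u∈X , λ Y _ u∈Y Y⊆X → subst (λ Y → κ Y ≢ i)
        (⊆-antisym (subst (_⊆ Y) (sym (¬inner⇒singleton ¬inner u∈X)) (singleton-⊆ u∈Y)) Y⊆X) κX≢i
      go X sX κX≢i (acc rec) | yes inner with κ-avoids sX inner i
      ...   | X′ , c@(sX′ , _ , X′⊂X , _) , κX′≢i with go X′ sX′ κX′≢i (rec (p⊂q⇒∣p∣<∣q∣ X′⊂X))
      ...     | u , u∈X′ , avoids = u , proj₁ X′⊂X u∈X′ , λ Y sY u∈Y Y⊆X → below Y sY u∈Y Y⊆X (X ⊆? Y)
        where
        below : ∀ Y → Strong 𝒮 Y → u ∈ Y → Y ⊆ X → Dec (X ⊆ Y) → κ Y ≢ i
        below Y sY u∈Y Y⊆X (yes X⊆Y) = subst (λ Y → κ Y ≢ i) (⊆-antisym X⊆Y Y⊆X) κX≢i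
        below Y sY u∈Y Y⊆X (no X⊈Y) = avoids Y sY u∈Y (child-above sY (Y⊆X , ⊈⇒∃ X⊈Y) c u∈Y u∈X′)

  -- Representing leaves

  Represents : Subset card → Fin card → Set
  Represents P u = u ∈ P × (∀ Y → Strong 𝒮 Y → u ∈ Y → Y ⊂ P → κ Y ≢ κ P) ×
    (¬ Prime P → ∀ E → ChildOf E P → u ∈ E → End E P)

  abstract

    representative : ∀ {P} → Strong 𝒮 P → Inner P → ∃ (Represents P)
    representative {P} sP inner = from-child first-child
      where
      first-child : ∃ λ E → ChildOf E P × (¬ Prime P → End E P)
      first-child with prime? P
      ... | yes isPrime = let x , x∈P = strong-nonempty sP ; E , cE , _ = child-at sP inner x∈P in
        E , cE , λ ¬prime → contradiction isPrime ¬prime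
      ... | no ¬prime = let E , end = BlockFamily.end-exists wp sP inner (blocks P) ¬prime in
        E , proj₁ end , λ _ → end
      from-child : (∃ λ E → ChildOf E P × (¬ Prime P → End E P)) → ∃ (Represents P)
      from-child (E , c@(sE , _ , E⊂P , _) , isEnd) with avoiding-leaf (κ P) sE (κ-child≢ c)
      ... | u , u∈E , avoids = u , proj₁ E⊂P u∈E ,
        (λ Y sY u∈Y Y⊂P → avoids Y sY u∈Y (child-above sY Y⊂P c u∈Y u∈E)) ,
        (λ ¬prime E′ c′ u∈E′ → subst (λ E → End E P) (children-disjoint c c′ u∈E u∈E′) (isEnd ¬prime))

    -- One representative is fixed per inner node: marking several would give the node several
    -- codes, which `Accepted` forbids.
    Chosen : Subset card → Fin card → Set
    Chosen P u with strong? P ×-dec inner? P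
    ... | yes (sP , inner) = proj₁ (representative sP inner) ≡ u
    ... | no _ = ⊥

    chosen? : ∀ P u → Dec (Chosen P u)
    chosen? P u with strong? P ×-dec inner? P
    ... | yes (sP , inner) = proj₁ (representative sP inner) Fin.≟ u
    ... | no _ = no id

    chosen-exists : ∀ {P} → Strong 𝒮 P → Inner P → ∃ (Chosen P)
    chosen-exists {P} sP inner with strong? P ×-dec inner? P
    ... | yes _ = _ , refl
    ... | no ¬p = contradiction (sP , inner) ¬p

    chosen-sound : ∀ {P u} → Chosen P u → Strong 𝒮 P × Represents P u
    chosen-sound {P} h with strong? P ×-dec inner? P
    chosen-sound refl | yes (sP , inner) = sP , proj₂ (representative sP inner)

    chosen-unique : ∀ {P u v} → Chosen P u → Chosen P v → u ≡ v
    chosen-unique {P} h h′ with strong? P ×-dec inner? P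
    chosen-unique refl refl | yes _ = refl

    -- The move at `W`: one child of colour `i` where there is one, and otherwise `W` itself, which
    -- stands for no restriction.
    pick : Fin 3 → Subset card → Subset card
    pick i W with someSubset? (λ X → childOf? X W ×-dec (κ X Fin.≟ i))
    ... | yes (X , _) = X
    ... | no _        = W

    pick-child : ∀ {i W} → Strong 𝒮 W → Inner W → κ W ≢ i → ChildOf (pick i W) W × κ (pick i W) ≡ i
    pick-child {i} {W} sW inner κW≢i with someSubset? (λ X → childOf? X W ×-dec (κ X Fin.≟ i))
    ... | yes (X , c , κX≡i) = c , κX≡i
    ... | no none = contradiction (κ-hits sW inner (κW≢i ∘ sym)) none

    pick-self : ∀ {i W} → κ W ≡ i → pick i W ≡ W
    pick-self {i} {W} κW≡i with someSubset? (λ X → childOf? X W ×-dec (κ X Fin.≟ i))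
    ... | yes (X , c , κX≡i) = contradiction (trans κX≡i (sym κW≡i)) (κ-child≢ c)
    ... | no _ = refl

    pick-cases : ∀ i W → ChildOf (pick i W) W ⊎ pick i W ≡ W
    pick-cases i W with someSubset? (λ X → childOf? X W ×-dec (κ X Fin.≟ i))
    ... | yes (X , c , _) = inj₁ c
    ... | no _ = inj₂ refl

    pick-leaf : ∀ {i W} → ¬ Inner W → pick i W ≡ W
    pick-leaf {i} {W} ¬inner with someSubset? (λ X → childOf? X W ×-dec (κ X Fin.≟ i))
    ... | yes (X , (sX , _ , X⊂W , _) , _) = contradiction (⊂⇒inner (strong-nonempty sX) X⊂W) ¬inner
    ... | no _ = refl

  -- The leaves of a strategy

  module Strategy (i : Fin 3) {V : Subset card} where

    Kept : Fin card → Set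
    Kept u = u ∈ V × (∀ W → Strong 𝒮 W → u ∈ W → W ⊆ V → u ∈ pick i W)

    kept? : Decidable Kept
    kept? u = (u ∈? V) ×-dec allSubset? λ W → strong? W →-dec (u ∈? W) →-dec (W ⊆? V) →-dec (u ∈? pick i W)

    Z : Subset card
    Z = comprehension kept?

    -- The positions that a play from `V` following `pick` can visit. Among the strong subsets of
    -- `V` they are exactly those meeting `Z`, by `meets⇒reached` and `reached⇒meets`.
    Reached : Subset card → Set
    Reached W = ∀ W′ → Strong 𝒮 W′ → W ⊂ W′ → W′ ⊆ V → W ⊆ pick i W′

    abstract

      meets⇒reached : ∀ {W z} → Strong 𝒮 W → z ∈ W → z ∈ Z → Reached W
      meets⇒reached {W} sW z∈W z∈Z W′ sW′ W⊂W′ W′⊆V with pick-cases i W′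
      ... | inj₂ eq = subst (W ⊆_) (sym eq) (proj₁ W⊂W′)
      ... | inj₁ c = child-above sW W⊂W′ c z∈W (proj₂ (∈comprehension⁻ kept? z∈Z) W′ sW′ (proj₁ W⊂W′ z∈W) W′⊆V)

      reached-child : ∀ {X W} → Reached W → ChildOf X W → X ⊆ pick i W → Reached X
      reached-child {X} {W} reached c X⊆pick W′ sW′ X⊂W′ W′⊆V with W′ ⊆? W
      ... | yes W′⊆W = subst (λ W → X ⊆ pick i W) (⊆-antisym (parent-below c sW′ X⊂W′) W′⊆W) X⊆pick
      ... | no W′⊈W = λ x∈X → reached W′ sW′ (parent-below c sW′ X⊂W′ , ⊈⇒∃ W′⊈W) W′⊆V
        (proj₁ (proj₁ (proj₂ (proj₂ c))) x∈X)

      -- From a reached inner node the play continues in a reached child, the picked one or any one,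
      -- until it arrives at a leaf; a reached leaf is kept.
      reached⇒meets : ∀ {W} → Strong 𝒮 W → W ⊆ V → Reached W → Nonempty (W ∩ Z)
      reached⇒meets {W} sW W⊆V reached = go W sW W⊆V reached (<-wellFounded _)
        where
        go : ∀ W → Strong 𝒮 W → W ⊆ V → Reached W → Acc ℕ._<_ ∣ W ∣ → Nonempty (W ∩ Z)
        go W sW W⊆V reached (acc rec) = cases (inner? W)
          where
          descend : ∀ X → ChildOf X W → X ⊆ pick i W → Nonempty (W ∩ Z)
          descend X c@(sX , _ , X⊂W , _) X⊆pick
            with go X sX (λ x∈X → W⊆V (proj₁ X⊂W x∈X)) (reached-child reached c X⊆pick) (rec (p⊂q⇒∣p∣<∣q∣ X⊂W))
          ... | x , x∈ = x , ∈∩⁺ (proj₁ X⊂W (∈∩ˡ x∈)) (∈∩ʳ x∈)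
          cases : Dec (Inner W) → Nonempty (W ∩ Z)
          cases (yes inner) with κ W Fin.≟ i
          ... | no κW≢i = descend _ (proj₁ (pick-child sW inner κW≢i)) id
          ... | yes κW≡i = let x , x∈W = strong-nonempty sW ; X , cX , _ = child-at sW inner x∈W in
            descend X cX (subst (X ⊆_) (sym (pick-self κW≡i)) (proj₁ (proj₁ (proj₂ (proj₂ cX)))))
          cases (no ¬inner) with strong-nonempty sW
          ... | u , u∈W = u , ∈∩⁺ u∈W (∈comprehension⁺ kept? (W⊆V u∈W , λ W′ sW′ u∈W′ W′⊆V →
                  kept W′ sW′ u∈W′ W′⊆V (W′ ⊆? W)))
            where
            W⊆ : ∀ {W′} → u ∈ W′ → W ⊆ W′
            W⊆ {W′} u∈W′ = subst (_⊆ W′) (sym (¬inner⇒singleton ¬inner u∈W)) (singleton-⊆ u∈W′)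
            kept : ∀ W′ → Strong 𝒮 W′ → u ∈ W′ → W′ ⊆ V → Dec (W′ ⊆ W) → u ∈ pick i W′
            kept W′ sW′ u∈W′ W′⊆V (no W′⊈W) = reached W′ sW′ (W⊆ u∈W′ , ⊈⇒∃ W′⊈W) W′⊆V u∈W
            kept W′ sW′ u∈W′ W′⊆V (yes W′⊆W) = subst (λ W → u ∈ pick i W)
              (⊆-antisym (W⊆ u∈W′) W′⊆W) (subst (u ∈_) (sym (pick-leaf ¬inner)) u∈W)

  -- The game decides the intended colouring

  module Accepting (G C : Fin 3 → Fin card → Set)
    (G⁺ : ∀ {i u} → κ ⁅ u ⁆ ≡ i → G i u) (G⁻ : ∀ {i u} → G i u → κ ⁅ u ⁆ ≡ i)
    (C⁺ : ∀ {i u} P → κ P ≡ i → Chosen P u → C i u)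
    (C⁻ : ∀ {i u} → C i u → ∃ λ P → κ P ≡ i × Chosen P u)
    where

    open Colours 𝒮 G C

    leaf-full : ∀ {i Z W} → ¬ Inner W → κ W ≡ i → Full i Z W
    leaf-full ¬inner κW≡i = (λ { u refl → G⁺ κW≡i }) ,
      λ X (sX , _ , X⊂W , _) → contradiction (⊂⇒inner (strong-nonempty sX) X⊂W) ¬inner

    full-leaf : ∀ {i Z W} → Strong 𝒮 W → ¬ Inner W → Full i Z W → κ W ≡ i
    full-leaf {i} sW ¬inner (leaf , _) =
      let u , u∈W = strong-nonempty sW ; eq = ¬inner⇒singleton ¬inner u∈W in
      subst (λ W → κ W ≡ i) (sym eq) (G⁻ (leaf u eq))

    -- By induction from the leaves, any consistent `Z` tells the truth. If an inner `W` is full but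
    -- lacks colour `i`, some child of colour `i` meets `Z` and cannot be full, against the
    -- induction. If `W` is not full, a child meeting `Z` is full and so has colour `i`, hence `W`
    -- has not.
    alternating-sound : ∀ {i Z V} → Alternating i Z V → ∀ {W} → Strong 𝒮 W → W ⊆ V → Nonempty (W ∩ Z) →
      (Full i Z W → κ W ≡ i) × (¬ Full i Z W → κ W ≢ i)
    alternating-sound {i} {Z} {V} alternating {W} = go W (<-wellFounded _)
      where
      go : ∀ W → Acc ℕ._<_ ∣ W ∣ → Strong 𝒮 W → W ⊆ V → Nonempty (W ∩ Z) →
        (Full i Z W → κ W ≡ i) × (¬ Full i Z W → κ W ≢ i)
      go W (acc rec) sW W⊆V meets = cases (inner? W)
        where
        child : ∀ {X} → ChildOf X W → Nonempty (X ∩ Z) → (Full i Z X → κ X ≡ i) × (¬ Full i Z X → κ X ≢ i)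
        child {X} (sX , _ , X⊂W , _) = go X (rec (p⊂q⇒∣p∣<∣q∣ X⊂W)) sX (λ x∈X → W⊆V (proj₁ X⊂W x∈X))
        cases : Dec (Inner W) → (Full i Z W → κ W ≡ i) × (¬ Full i Z W → κ W ≢ i)
        cases (no ¬inner) = full-leaf sW ¬inner , λ ¬full κW≡i → ¬full (leaf-full ¬inner κW≡i)
        cases (yes inner) = isFull , notFull meets
          where
          isFull : Full i Z W → κ W ≡ i
          isFull full with κ W Fin.≟ i
          ... | yes κW≡i = κW≡i
          ... | no κW≢i with κ-hits sW inner (κW≢i ∘ sym)
          ...   | X , cX , κX≡i = contradiction κX≡i (proj₂ (child cX meetsX)
                  (λ fullX → proj₁ (alternating W sW W⊆V meets X cX meetsX) fullX full))
            where meetsX = proj₂ full X cX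
          notFull : Nonempty (W ∩ Z) → ¬ Full i Z W → κ W ≢ i
          notFull (z , z∈) ¬full κW≡i with child-at sW inner (∈∩ˡ z∈)
          ... | X , cX , z∈X = κ-child≢ cX (trans
                  (proj₁ (child cX meetsX) (proj₂ (alternating W sW W⊆V meets X cX meetsX) ¬full)) (sym κW≡i))
            where
            meetsX : Nonempty (X ∩ Z)
            meetsX = z , ∈∩⁺ z∈X (∈∩ʳ z∈)

    coloured-sound : ∀ {i V} → Strong 𝒮 V → Coloured i V → κ V ≡ i
    coloured-sound sV (Z , meets , alternating , full) = proj₁ (alternating-sound alternating sV id meets) full

    -- The strategy is the certificate: below a node of colour `i` that it meets, it meets every
    -- child, and below any other inner node at most the picked child of colour `i`. So `Full`
    -- agrees with the colour.
    coloured-complete : ∀ {i V} → Strong 𝒮 V → κ V ≡ i → Coloured i V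
    coloured-complete {i} {V} sV κV≡i = Z , meetsV , alternating , κ⇒full sV id meetsV κV≡i
      where
      open Strategy i {V}
      meetsV : Nonempty (V ∩ Z)
      meetsV = reached⇒meets sV id λ W′ _ (_ , x , x∈W′ , x∉V) W′⊆V → contradiction (W′⊆V x∈W′) x∉V
      in-pick : ∀ {W z} → Strong 𝒮 W → W ⊆ V → z ∈ W → z ∈ Z → z ∈ pick i W
      in-pick sW W⊆V z∈W z∈Z = proj₂ (∈comprehension⁻ kept? z∈Z) _ sW z∈W W⊆V
      meeting-child : ∀ {W X} → Strong 𝒮 W → W ⊆ V → κ W ≢ i → ChildOf X W → Nonempty (X ∩ Z) → κ X ≡ i
      meeting-child sW W⊆V κW≢i cX@(sX , _ , X⊂W , _) (z , z∈) with
        pick-child sW (⊂⇒inner (strong-nonempty sX) X⊂W) κW≢i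
      ... | c , κ≡i = trans (cong κ (children-disjoint cX c (∈∩ˡ z∈)
              (in-pick sW W⊆V (proj₁ X⊂W (∈∩ˡ z∈)) (∈∩ʳ z∈)))) κ≡i
      κ⇒full : ∀ {W} → Strong 𝒮 W → W ⊆ V → Nonempty (W ∩ Z) → κ W ≡ i → Full i Z W
      κ⇒full {W} sW W⊆V (z , z∈) κW≡i = (λ { u refl → G⁺ κW≡i }) , λ X cX@(sX , _ , X⊂W , _) →
        reached⇒meets sX (λ x∈X → W⊆V (proj₁ X⊂W x∈X))
          (reached-child (meets⇒reached sW (∈∩ˡ z∈) (∈∩ʳ z∈)) cX (subst (X ⊆_) (sym (pick-self κW≡i)) (proj₁ X⊂W)))
      full⇒κ : ∀ {W} → Strong 𝒮 W → W ⊆ V → Full i Z W → κ W ≡ i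
      full⇒κ {W} sW W⊆V full with inner? W | κ W Fin.≟ i
      ... | _ | yes κW≡i = κW≡i
      ... | no ¬inner | _ = full-leaf sW ¬inner full
      ... | yes inner | no κW≢i with κ-avoids sW inner i
      ...   | X , cX , κX≢i = contradiction (meeting-child sW W⊆V κW≢i cX (proj₂ full X cX)) κX≢i
      alternating : Alternating i Z V
      alternating W sW W⊆V meets X cX@(sX , _ , X⊂W , _) meetsX =
        (λ fullX fullW → κ-child≢ cX (trans (full⇒κ sX X⊆V fullX) (sym (full⇒κ sW W⊆V fullW)))) ,
        (λ ¬fullW → κ⇒full sX X⊆V meetsX
          (meeting-child sW W⊆V (λ κW≡i → ¬fullW (κ⇒full sW W⊆V meets κW≡i)) cX meetsX))
        where
        X⊆V : X ⊆ V
        X⊆V x∈X = W⊆V (proj₁ X⊂W x∈X)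

    -- Both `X` and the node `P` that chose `x` contain `x` and have colour `i`, so they are nested.
    -- `P` is not smaller because `X` is least, and not larger because `x` avoids the colour of `P`
    -- below `P`.
    rep-chosen : ∀ {i x X} → Rep i x X → Chosen X x
    rep-chosen {i} {x} {X} (Cx , sX , _ , colouredX , x∈X , least) with C⁻ Cx
    ... | P , κP≡i , chosen with chosen-sound chosen
    ...   | sP , x∈P , avoids , _ with X ⊆? P | P ⊆? X
    ...     | yes X⊆P | yes P⊆X = subst (λ P → Chosen P x) (⊆-antisym P⊆X X⊆P) chosen
    ...     | yes X⊆P | no P⊈X = contradiction
                (trans (coloured-sound sX colouredX) (sym κP≡i)) (avoids X sX x∈X (X⊆P , ⊈⇒∃ P⊈X))
    ...     | no X⊈P | yes P⊆X = contradiction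
                (coloured-complete sP κP≡i) (least P sP x∈P (P⊆X , ⊈⇒∃ X⊈P))
    ...     | no X⊈P | no P⊈X with nested sX (proj₁ sP) x∈X x∈P
    ...       | inj₁ X⊆P = ⊥-elim (X⊈P X⊆P)
    ...       | inj₂ P⊆X = ⊥-elim (P⊈X P⊆X)

    accepted : Accepted
    accepted =
      (λ X sX inner → let x , chosen = chosen-exists sX inner
                          _ , x∈X , avoids , _ = chosen-sound chosen in
        κ X , x , C⁺ X refl chosen , sX , inner , coloured-complete sX refl , x∈X ,
        λ Y sY x∈Y Y⊂X coloured → avoids Y sY x∈Y Y⊂X (coloured-sound sY coloured)) ,
      (λ i j X x y r@(_ , sX , _ , coloured , _) r′@(_ , _ , _ , coloured′ , _) →
        trans (sym (coloured-sound sX coloured)) (coloured-sound sX coloured′) ,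
        chosen-unique (rep-chosen r) (rep-chosen r′)) ,
      (λ i P x E (_ , _ , ¬prime , _) r cE x∈E → proj₂ (proj₂ (proj₂ (chosen-sound (rep-chosen r)))) ¬prime E cE x∈E)

-- From codes to trees

T-does⁺ : ∀ {P : Set} (P? : Dec P) → P → T (does P?)
T-does⁺ (yes _) _ = _
T-does⁺ (no ¬p) p = contradiction p ¬p

T-does⁻ : ∀ {P : Set} (P? : Dec P) → T (does P?) → P
T-does⁻ (yes p) _ = p

T-ext : ∀ {a b} → (T a → T b) → (T b → T a) → a ≡ b
T-ext {true}  {true}  f g = refl
T-ext {true}  {false} f g = ⊥-elim (f _)
T-ext {false} {true}  f g = ⊥-elim (g _)
T-ext {false} {false} f g = refl

two-elements : ∀ {n} (I : Subset n) → 2 ℕ.≤ ∣ I ∣ → ∃ λ x → ∃ λ y → x ∈ I × y ∈ I × x ≢ y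
two-elements {n} I 2≤ with nonempty? I
... | no empty with refl ← Empty-unique empty = contradiction 2≤ (ℕ.<⇒≱ (subst (ℕ._< 2) (sym (∣⊥∣≡0 n)) (s≤s z≤n)))
... | yes (x , x∈I) with any? (λ y → (y ∈? I) ×-dec ¬? (x Fin.≟ y))
...   | yes (y , y∈I , x≢y) = x , y , x∈I , y∈I , x≢y
...   | no none = contradiction 2≤ (ℕ.<⇒≱ (s≤s (subst (∣ I ∣ ℕ.≤_) (∣⁅x⁆∣≡1 x) (p⊆q⇒∣p∣≤∣q∣ {p = I} {q = ⁅ x ⁆}
          λ {y} y∈I → ∈-stable λ y∉ → none (y , y∈I , λ { refl → y∉ (x∈⁅x⁆ x) })))))

element-outside : ∀ {n} (I : Subset n) → ∣ I ∣ ℕ.< n → ∃ λ z → z ∉ I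
element-outside {n} I I<n with any? (λ z → ¬? (z ∈? I))
... | yes found = found
... | no none = contradiction I<n (ℕ.≤⇒≯ (subst (ℕ._≤ ∣ I ∣) (∣⊤∣≡n n)
        (p⊆q⇒∣p∣≤∣q∣ {p = full} {q = I} λ {z} _ → ∈-stable λ z∉I → none (z , z∉I))))

module _ {𝒮 : SetSystem} (W : WeaklyPartitiveTree 𝒮) where

  open WeaklyPartitiveTree W

  marked⁻ : ∀ l t → T (rel (treeStructure W) (marked l) (t ∷ [])) → Σ (Inner t) λ i → label t i ≡ l
  marked⁻ l t h with inner? t
  ... | yes i = i , T-does⁻ (label t i ≟ˡ l) h

  marked⁺ : ∀ l t (i : Inner t) → label t i ≡ l → T (rel (treeStructure W) (marked l) (t ∷ []))
  marked⁺ l t i eq with inner? t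
  ... | yes _ = T-does⁺ (label t i ≟ˡ l) eq
  ... | no ¬i = ¬i i

module Tree (𝔸 : Structure Γ₁) (isSystem : IsSetSystem (forgetColours 𝔸)) where

  open Meaning 𝔸 isSystem
  open SetSystem 𝒮
  open StrongSets 𝒮
  open Colours 𝒮 G C
  open Satisfaction 𝔸 using (means-dec)

  -- The interface between the transduction and the decoding: elements of the output are the pairs
  -- of a copy number and a leaf that code some set, and its relations are those of the coded sets.
  record Code (𝔹 : Structure treeVocabulary) : Set where
    field
      tag : Fin (size 𝔹) → Fin 4
      leaf  : Fin (size 𝔹) → Fin card

    Set-of : Fin (size 𝔹) → Subset card → Set
    Set-of t = Node (tag t) (leaf t)

    field
      code-injective : ∀ {s t} → tag s ≡ tag t → leaf s ≡ leaf t → s ≡ t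
      code-complete  : ∀ i u X → Node i u X → ∃ λ t → tag t ≡ i × leaf t ≡ u
      node-set       : ∀ t → ∃ (Set-of t)
      desc⇔          : ∀ s t → T (rel 𝔹 desc (s ∷ t ∷ [])) ⇔ (∃ λ X → ∃ λ Y → Set-of s X × Set-of t Y × X ⊆ Y)
      marked⇔        : ∀ l t → T (rel 𝔹 (marked l) (t ∷ [])) ⇔ (∃ λ X → Set-of t X × HasLabel l X)
      less⇔          : ∀ s t → T (rel 𝔹 less (s ∷ t ∷ [])) ⇔ (∃ λ X → ∃ λ Y → Set-of s X × Set-of t Y × Less X Y)

  -- Reading the tree off its codes

  module Decode (wp : WeaklyPartitive 𝒮) (accepted : Accepted) {𝔹} (code : Code 𝔹) where

    open Code code

    node-strong : ∀ i {u X} → Node i u X → Strong 𝒮 X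
    node-strong zero    refl         = strong-singleton _
    node-strong (suc i) (_ , sX , _) = sX

    -- Strong sets containing `u` are nested, so two of them that are both least of their colour
    -- coincide.
    node-functional : ∀ i {u X Y} → Node i u X → Node i u Y → X ≡ Y
    node-functional zero refl refl = refl
    node-functional (suc i) {u} {X} {Y} (_ , sX , _ , cX , u∈X , leastX) (_ , sY , _ , cY , u∈Y , leastY)
      with X ⊆? Y | Y ⊆? X
    ... | yes X⊆Y | yes Y⊆X = ⊆-antisym X⊆Y Y⊆X
    ... | yes X⊆Y | no Y⊈X = contradiction cX (leastY X sX u∈X (X⊆Y , ⊈⇒∃ Y⊈X))
    ... | no X⊈Y | yes Y⊆X = contradiction cY (leastX Y sY u∈Y (Y⊆X , ⊈⇒∃ X⊈Y))
    ... | no X⊈Y | no Y⊈X with nested sX (proj₁ sY) u∈X u∈Y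
    ...   | inj₁ X⊆Y = ⊥-elim (X⊈Y X⊆Y)
    ...   | inj₂ Y⊆X = ⊥-elim (Y⊈X Y⊆X)

    node-injective : ∀ i j {u v X} → Node i u X → Node j v X → i ≡ j × u ≡ v
    node-injective zero zero {u} {v} refl eq = refl , x∈⁅y⁆⇒x≡y v (subst (u ∈_) eq (x∈⁅x⁆ u))
    node-injective zero (suc j) refl (_ , _ , inner , _) = contradiction inner ¬inner-singleton
    node-injective (suc i) zero (_ , _ , inner , _) refl = contradiction inner ¬inner-singleton
    node-injective (suc i) (suc j) r r′ = let i≡j , u≡v = proj₁ (proj₂ accepted) i j _ _ _ r r′ in cong suc i≡j , u≡v

    node-total : ∀ {X} → Strong 𝒮 X → ∃ λ i → ∃ λ u → Node i u X
    node-total {X} sX with inner? X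
    ... | yes inner = let i , u , r = proj₁ accepted X sX inner in suc i , u , r
    ... | no ¬inner = let u , u∈X = strong-nonempty sX in zero , u , ¬inner⇒singleton ¬inner u∈X

    leaves : Fin (size 𝔹) → Subset card
    leaves t = proj₁ (node-set t)

    leaves-node : ∀ t → Set-of t (leaves t)
    leaves-node t = proj₂ (node-set t)

    set-of⇒leaves : ∀ {t X} → Set-of t X → leaves t ≡ X
    set-of⇒leaves {t} = node-functional (tag t) (leaves-node t)

    leaves-strong : ∀ t → Strong 𝒮 (leaves t)
    leaves-strong t = node-strong (tag t) (leaves-node t)

    leaves-injective : ∀ {s t} → leaves s ≡ leaves t → s ≡ t
    leaves-injective {s} {t} eq =
      let i≡j , u≡v = node-injective (tag s) (tag t) (leaves-node s) (subst (Set-of t) (sym eq) (leaves-node t)) in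
      code-injective i≡j u≡v

    leaves-complete : ∀ X → Strong 𝒮 X → ∃ λ t → leaves t ≡ X
    leaves-complete X sX with node-total sX
    ... | i , u , node with code-complete i u X node
    ...   | t , refl , refl = t , set-of⇒leaves node

    tree : LaminarTree 𝒮
    tree = record
      { nodes = size 𝔹 ; leaves = leaves ; strong = leaves-strong
      ; injective = leaves-injective ; complete = leaves-complete }

    open LaminarTree tree using (Child; Children; _≺_) renaming (Inner to InnerNode; inner? to innerNode?)
    open Children

    inner⁺ : ∀ {t} → InnerNode t → Inner (leaves t)
    inner⁺ (s , s≺t) = ⊂⇒inner (strong-nonempty (leaves-strong s)) s≺t

    inner⁻ : ∀ {t} → Inner (leaves t) → InnerNode t
    inner⁻ {t} inner with strong-nonempty (leaves-strong t)
    ... | x , x∈ with child-at (leaves-strong t) inner x∈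
    ...   | X , (sX , _ , X⊂ , _) , _ with leaves-complete X sX
    ...     | s , refl = s , X⊂

    child⁺ : ∀ {s t} → Child s t → ChildOf (leaves s) (leaves t)
    child⁺ {s} {t} (s≺t , none) = leaves-strong s , leaves-strong t , s≺t , between
      where
      between : ∀ Z → Strong 𝒮 Z → leaves s ⊂ Z → ¬ (Z ⊂ leaves t)
      between Z sZ s⊂Z Z⊂t with leaves-complete Z sZ
      ... | r , refl = none (r , s⊂Z , Z⊂t)

    child⁻ : ∀ {s t} → ChildOf (leaves s) (leaves t) → Child s t
    child⁻ (_ , _ , s⊂t , none) = s⊂t , λ (r , s≺r , r≺t) → none (leaves r) (leaves-strong r) s≺r r≺t

    children-blocks : ∀ {t} → Children t → Blocks (leaves t)
    children-blocks c = record
      { count     = suc (ℓ c)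
      ; block     = leaves ∘ child c
      ; is-child  = λ i → child⁺ (is-child c i)
      ; injective = λ eq → child-injective c (leaves-injective eq)
      ; complete  = complete
      }
      where
      complete : ∀ C → ChildOf C _ → ∃ λ i → leaves (child c i) ≡ C
      complete C cC with leaves-complete C (proj₁ cC)
      ... | s , refl with child-complete c s (child⁻ cC)
      ...   | i , refl = i , refl

    abstract

      classify : Subset card → Label
      classify X with prime? X | degenerate? X
      ... | yes _ | _     = prime
      ... | no _  | yes _ = degenerate
      ... | no _  | no _  = linear

      classify⁺ : ∀ {l X} → HasLabel l X → classify X ≡ l
      classify⁺ {l} {X} h with prime? X | degenerate? X
      classify⁺ {prime}      _                     | yes _ | _     = refl
      classify⁺ {degenerate} (_ , _ , ¬p , _)      | yes p | _     = contradiction p ¬p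
      classify⁺ {linear}     (_ , _ , ¬p , _)      | yes p | _     = contradiction p ¬p
      classify⁺ {prime}      (_ , _ , p)           | no ¬p | yes _ = contradiction p ¬p
      classify⁺ {degenerate} _                     | no _  | yes _ = refl
      classify⁺ {linear}     (_ , _ , _ , ¬d)      | no _  | yes d = contradiction d ¬d
      classify⁺ {prime}      (_ , _ , p)           | no ¬p | no _  = contradiction p ¬p
      classify⁺ {degenerate} (_ , _ , _ , d)       | no _  | no ¬d = contradiction d ¬d
      classify⁺ {linear}     _                     | no _  | no _  = refl

      classify⁻ : ∀ {l X} → Strong 𝒮 X → Inner X → classify X ≡ l → HasLabel l X
      classify⁻ {X = X} sX inner eq with prime? X | degenerate? X
      classify⁻ sX inner refl | yes p | _     = sX , inner , p
      classify⁻ sX inner refl | no ¬p | yes d = sX , inner , ¬p , d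
      classify⁻ sX inner refl | no ¬p | no ¬d = sX , inner , ¬p , ¬d

      less? : ∀ A B → Dec (Less A B)
      less? A B = means-dec (less-means {ρ = []} {σ = A ∷ B ∷ []} zero (suc zero))

    -- The end of a linear node from which its children are ordered.
    Origin : Subset card → Subset card → Set
    Origin P E = ∃ λ i → ∃ λ x → Rep i x P × ChildOf E P × x ∈ E

    origin-exists : ∀ {P} → Strong 𝒮 P → Inner P → ∃ (Origin P)
    origin-exists {P} sP inner with proj₁ accepted P sP inner
    ... | i , x , r@(_ , _ , _ , _ , x∈P , _) with child-at sP inner x∈P
    ...   | E , cE , x∈E = E , i , x , r , cE , x∈E

    -- Codes are unique, so the base point hidden in `Less` is the same for all pairs of children of
    -- a node. This lets instances of `Less` be compared.
    origin-unique : ∀ {P E E′} → Origin P E → Origin P E′ → E ≡ E′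
    origin-unique (i , x , r , cE , x∈E) (j , y , r′ , cE′ , y∈E′) with proj₁ (proj₂ accepted) i j _ x y r r′
    ... | refl , refl = children-disjoint cE cE′ x∈E y∈E′

    origin-end : ∀ {P E} → HasLabel linear P → Origin P E → End E P
    origin-end lin (i , x , r , cE , x∈E) = proj₂ (proj₂ accepted) i _ x _ lin r cE x∈E

    less⁻ : ∀ {A B P E} → Less A B → ChildOf A P → Origin P E → Precedes P E A B
    less⁻ {A} {B} {P} (_ , P′ , cA′ , _ , _ , i , x , r , E′ , cE′ , x∈E′ , prec) cA origin
      with parent-unique cA′ cA
    ... | refl = subst (λ E → Precedes P E A B) (origin-unique (i , x , r , cE′ , x∈E′) origin) prec

    less⁺ : ∀ {A B P E} → ¬ (B ⊆ A) → ChildOf A P → ChildOf B P → HasLabel linear P → Origin P E →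
      Precedes P E A B → Less A B
    less⁺ B⊈A cA cB lin (i , x , r , cE , x∈E) prec = B⊈A , _ , cA , cB , lin , i , x , r , _ , cE , x∈E , prec

    child-⊆⇒≡ : ∀ {A B P} → ChildOf A P → ChildOf B P → A ⊆ B → A ≡ B
    child-⊆⇒≡ cA cB A⊆B = let x , x∈A = strong-nonempty (proj₁ cA) in children-disjoint cA cB x∈A (A⊆B x∈A)

    precedes-antisym : ∀ {P E A B} → HasLabel linear P → Origin P E → ChildOf A P → ChildOf B P →
      Precedes P E A B → Precedes P E B A → A ≡ B
    precedes-antisym {P} {A = A} {B} lin origin cA cB prec prec′
      with Blocks.complete (blocks P) A cA | Blocks.complete (blocks P) B cB
    ... | i , refl | j , refl = cong (Blocks.block (blocks P))
      (BlockFamily.precedes-antisym wp (proj₁ lin) (proj₁ (proj₂ lin)) (blocks P)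
        (proj₁ (proj₂ (proj₂ lin))) (proj₂ (proj₂ (proj₂ lin))) (origin-end lin origin) prec prec′)

    precedes-total : ∀ {P E A B} → HasLabel linear P → Origin P E → ChildOf A P → ChildOf B P →
      Precedes P E A B ⊎ Precedes P E B A
    precedes-total {P} {A = A} {B} lin origin cA cB
      with Blocks.complete (blocks P) A cA | Blocks.complete (blocks P) B cB
    ... | i , refl | j , refl =
      BlockFamily.precedes-total wp (proj₁ lin) (proj₁ (proj₂ lin)) (blocks P)
        (proj₁ (proj₂ (proj₂ lin))) (proj₂ (proj₂ (proj₂ lin))) (origin-end lin origin) i j

    _<_ : Fin (size 𝔹) → Fin (size 𝔹) → Set
    s < t = Less (leaves s) (leaves t)

    <-trans : ∀ {r s t} → r < s → s < t → r < t
    <-trans {r} {s} {t} r<s@(s⊈r , P , cr , cs , lin , i , x , rep , E , cE , x∈E , prec) s<t@(_ , P′ , cs′ , ct , _)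
      with parent-unique cs′ cs
    ... | refl = less⁺ t⊈r cr ct lin origin prec-rt
      where
      origin : Origin P E
      origin = i , x , rep , cE , x∈E
      prec-st : Precedes P E (leaves s) (leaves t)
      prec-st = less⁻ s<t cs origin
      prec-rt : Precedes P E (leaves r) (leaves t)
      prec-rt Y Y∈𝒮 Y⊆P E⊆Y t⊆Y = prec Y Y∈𝒮 Y⊆P E⊆Y (prec-st Y Y∈𝒮 Y⊆P E⊆Y t⊆Y)
      -- If the set of `t` lay inside that of `r`, they would be the same child, and antisymmetry
      -- would identify `s` with `r`.
      t⊈r : ¬ (leaves t ⊆ leaves r)
      t⊈r t⊆r = s⊈r (⊆-reflexive (precedes-antisym lin origin cs cr
        (subst (Precedes P E (leaves s)) (child-⊆⇒≡ ct cr t⊆r) prec-st) prec))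

    linear⁻ : ∀ {t} → InnerNode t → classify (leaves t) ≡ linear → HasLabel linear (leaves t)
    linear⁻ {t} i eq = classify⁻ {linear} (leaves-strong t) (inner⁺ i) eq

    <-total : ∀ t → (∃ λ (i : InnerNode t) → classify (leaves t) ≡ linear) →
      ∀ s s′ → Child s t → Child s′ t → s ≢ s′ → s < s′ ⊎ s′ < s
    <-total t (i , eq) s s′ cs cs′ s≢s′ with linear⁻ {t} i eq
    ... | lin with origin-exists (proj₁ lin) (proj₁ (proj₂ lin))
    ...   | E , origin = [ (λ p → inj₁ (less⁺ (λ ⊆ → s≢s′ (sym (leaves-injective (child-⊆⇒≡ c′ c ⊆)))) c c′ lin origin p)) ,
                           (λ p → inj₂ (less⁺ (λ ⊆ → s≢s′ (leaves-injective (child-⊆⇒≡ c c′ ⊆))) c′ c lin origin p)) ]′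
                         (precedes-total lin origin c c′)
      where
      c : ChildOf (leaves s) (leaves t)
      c = child⁺ cs
      c′ : ChildOf (leaves s′) (leaves t)
      c′ = child⁺ cs′

    <-only : ∀ s s′ → s < s′ →
      ∃ λ t → (∃ λ (i : InnerNode t) → classify (leaves t) ≡ linear) × Child s t × Child s′ t
    <-only s s′ (_ , P , c , c′ , lin , _) with leaves-complete P (proj₁ lin)
    ... | t , refl = t , (inner⁻ (proj₁ (proj₂ lin)) , classify⁺ {linear} lin) , child⁻ c , child⁻ c′

    L≡ : ∀ {t} (i : InnerNode t) (c : Children t) I →
      BlockFamily.L wp (leaves-strong t) (inner⁺ i) (children-blocks c) I ≡ L c I
    L≡ {t} i c = BlockFamily.L≡⋃ wp (leaves-strong t) (inner⁺ i) (children-blocks c)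

    prime-node : ∀ t (i : InnerNode t) → classify (leaves t) ≡ prime →
      leaves t ∈𝒮 × (∀ (c : Children t) I → 2 ℕ.≤ ∣ I ∣ → ∣ I ∣ ℕ.≤ ℓ c → ¬ (L c I ∈𝒮))
    prime-node t i eq = proj₁ (leaves-strong t) , λ c I 2≤ ≤ℓ I∈𝒮 →
      BlockFamily.prime⇒trivial wp (leaves-strong t) (inner⁺ i) (children-blocks c)
        (proj₂ (proj₂ (classify⁻ {prime} (leaves-strong t) (inner⁺ i) eq))) I
        (two-elements I 2≤ , element-outside I (s≤s ≤ℓ))
        (subst _∈𝒮 (sym (L≡ i c I)) I∈𝒮)

    degenerate-node : ∀ t (i : InnerNode t) → classify (leaves t) ≡ degenerate →
      ∀ (c : Children t) I → Nonempty I → L c I ∈𝒮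
    degenerate-node t i eq c I I≢∅ = subst _∈𝒮 (L≡ i c I)
      (BlockFamily.degenerate⇒complete wp (leaves-strong t) (inner⁺ i) (children-blocks c)
        (proj₂ (proj₂ (proj₂ (classify⁻ {degenerate} (leaves-strong t) (inner⁺ i) eq)))) I I≢∅)

    linear-node : ∀ t (i : InnerNode t) → classify (leaves t) ≡ linear →
      ∀ (c : Children t) → (∀ i j → i Fin.< j → child c i < child c j) →
      ∀ I → Nonempty I → L c I ∈𝒮 ⇔ Interval I
    linear-node t i eq c monotone I I≢∅ = from-origin (origin-exists (leaves-strong t) (inner⁺ i))
      where
      lin : HasLabel linear (leaves t)
      lin = classify⁻ {linear} (leaves-strong t) (inner⁺ i) eq
      from-origin : ∃ (Origin (leaves t)) → L c I ∈𝒮 ⇔ Interval I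
      from-origin (E , origin) = subst (λ X → X ∈𝒮 ⇔ Interval I) (L≡ i c I)
        (BlockFamily.member⇔interval wp (leaves-strong t) (inner⁺ i) (children-blocks c)
          (proj₁ (proj₂ (proj₂ lin))) (proj₂ (proj₂ (proj₂ lin))) (origin-end lin origin)
          (λ j k j<k → less⁻ (monotone j k j<k) (child⁺ (is-child c j)) origin) I I≢∅)

    children : ∀ {t} → InnerNode t → Children t
    children {t} i = nonzero (enumerateFin child?)
      where
      child? : Decidable (λ s → Child s t)
      child? s = map′ child⁻ child⁺ (childOf? (leaves s) (leaves t))
      some-child : ∃ λ s → Child s t
      some-child with strong-nonempty (leaves-strong t)
      ... | x , x∈ with child-at (leaves-strong t) (inner⁺ i) x∈
      ...   | C , cC , _ with leaves-complete C (proj₁ cC)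
      ...     | s , refl = s , child⁻ cC
      nonzero : Enumeration (λ s → Child s t) → Children t
      nonzero record { total = zero ; complete = complete } =
        contradiction (proj₁ (complete _ (proj₂ some-child))) λ ()
      nonzero record { total = suc ℓ ; element = element ; injective = injective ; sound = sound ; complete = complete } =
        record { ℓ = ℓ ; child = element ; child-injective = injective ; is-child = sound ; child-complete = complete }

    -- A member with two elements is assigned to the least strong set containing it. It lies in no
    -- child of that node, so it is a union of children.
    exhaustive : ∀ X → X ∈𝒮 → (∃ λ u → X ≡ ⁅ u ⁆) ⊎
      (∃ λ t → InnerNode t × ∃ λ (c : Children t) → ∃ λ I → X ≡ L c I)
    exhaustive X X∈𝒮 with inner? X
    ... | no ¬inner = let u , u∈X = members-nonempty X X∈𝒮 in inj₁ (u , ¬inner⇒singleton ¬inner u∈X)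
    ... | yes (x , y , x∈X , y∈X , x≢y)
      with smallest (λ P → strong? P ×-dec (X ⊆? P)) (full , strong-full , λ _ → ∈⊤)
    ...   | P , (sP , X⊆P) , least with leaves-complete P sP
    ...     | t , refl = inj₂ (t , i , c ,
                BlockFamily.trace wp (leaves-strong t) (inner⁺ i) (children-blocks c) X ,
                trans (sym (BlockFamily.member-trace wp (leaves-strong t) (inner⁺ i) (children-blocks c) X∈𝒮 X⊆P spread))
                  (L≡ i c _))
      where
      i : InnerNode t
      i = inner⁻ (x , y , X⊆P x∈X , X⊆P y∈X , x≢y)
      c : Children t
      c = children i
      spread : ∀ k → X ⊈ leaves (child c k)
      spread k X⊆k = least (leaves (child c k)) (leaves-strong (child c k) , X⊆k) (proj₁ (is-child c k))

    weaklyPartitiveTree : WeaklyPartitiveTree 𝒮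
    weaklyPartitiveTree = record
      { tree            = tree
      ; label           = λ t _ → classify (leaves t)
      ; _<_             = _<_
      ; _<?_            = λ s t → less? (leaves s) (leaves t)
      ; <-strict        = record
        { isEquivalence = isEquivalence
        ; irrefl        = λ { refl (s⊈s , _) → s⊈s id }
        ; trans         = <-trans
        ; <-resp-≈      = (λ { refl → id }) , (λ { refl → id })
        }
      ; <-total         = <-total
      ; <-only          = <-only
      ; prime-node      = prime-node
      ; degenerate-node = degenerate-node
      ; linear-node     = linear-node
      ; exhaustive      = exhaustive
      }

    isomorphic : 𝔹 ≅ treeStructure weaklyPartitiveTree
    isomorphic = record
      { bijection = mk↔ₛ′ id id (λ _ → refl) (λ _ → refl)
      ; rel-≅     = rel-≅
      ; pred-≅    = λ ()
      }
      where
      rel-≅ : ∀ {r} (R : TreeName r) ts → rel 𝔹 R ts ≡ rel (treeStructure weaklyPartitiveTree) R (Vec.map id ts)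
      rel-≅ desc (s ∷ t ∷ []) = T-ext
        (λ h → let X , Y , nX , nY , X⊆Y = Equivalence.to (desc⇔ s t) h in
          T-does⁺ (leaves s ⊆? leaves t)
            (subst (_⊆ leaves t) (sym (set-of⇒leaves {s} nX)) (subst (X ⊆_) (sym (set-of⇒leaves {t} nY)) X⊆Y)))
        (λ h → Equivalence.from (desc⇔ s t)
          (_ , _ , leaves-node s , leaves-node t , T-does⁻ (leaves s ⊆? leaves t) h))
      rel-≅ (marked l) (t ∷ []) = T-ext
        (λ h → let X , nX , has = Equivalence.to (marked⇔ l t) h
                   has′ = subst (HasLabel l) (sym (set-of⇒leaves {t} nX)) has in
          marked⁺ weaklyPartitiveTree l t (inner⁻ (label-inner l has′)) (classify⁺ {l} has′))
        (λ h → let i , eq = marked⁻ weaklyPartitiveTree l t h in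
          Equivalence.from (marked⇔ l t) (_ , leaves-node t , classify⁻ {l} (leaves-strong t) (inner⁺ i) eq))
        where
        label-inner : ∀ l {X} → HasLabel l X → Inner X
        label-inner prime      = proj₁ ∘ proj₂
        label-inner degenerate = proj₁ ∘ proj₂
        label-inner linear     = proj₁ ∘ proj₂
      rel-≅ less (s ∷ t ∷ []) = T-ext
        (λ h → let X , Y , nX , nY , X<Y = Equivalence.to (less⇔ s t) h in
          T-does⁺ (less? (leaves s) (leaves t))
            (subst (λ X → Less X (leaves t)) (sym (set-of⇒leaves {s} nX))
              (subst (Less X) (sym (set-of⇒leaves {t} nY)) X<Y)))
        (λ h → Equivalence.from (less⇔ s t)
          (_ , _ , leaves-node s , leaves-node t , T-does⁻ (less? (leaves s) (leaves t)) h))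

-- The transduction

-- at R is holds of leaves iff R holds of the nodes coded by their copies is.

data FlatName : ℕ → Set where
  present : Fin 4 → FlatName 1
  at      : ∀ {r} → TreeName r → Vec (Fin 4) r → FlatName r

Γ₂ : Vocabulary
Γ₂ = record
  { RelName   = FlatName
  ; SetName   = λ _ → ⊥
  ; relFinite = names , complete
  ; setFinite = [] , λ ()
  }
  where
  copies : List (Fin 4)
  copies = List.allFin 4
  labels : List Label
  labels = prime ∷ degenerate ∷ linear ∷ []
  ∈-labels : ∀ l → l List.∈ labels
  ∈-labels prime      = here refl
  ∈-labels degenerate = there (here refl)
  ∈-labels linear     = there (there (here refl))
  pair-name : TreeName 2 → Fin 4 → Fin 4 → ∃ FlatName
  pair-name R i j = 2 , at R (i ∷ j ∷ [])
  mark-name : Label → Fin 4 → ∃ FlatName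
  mark-name l i = 1 , at (marked l) (i ∷ [])
  present-name : Fin 4 → ∃ FlatName
  present-name i = 1 , present i
  pairs : TreeName 2 → List (∃ FlatName)
  pairs R = List.cartesianProductWith (pair-name R) copies copies
  ∈-pairs : ∀ R i j → (2 , at R (i ∷ j ∷ [])) List.∈ pairs R
  ∈-pairs R i j = ∈-cartesianProductWith⁺ (pair-name R) (∈-allFin i) (∈-allFin j)
  presents marks : List (∃ FlatName)
  presents = List.map present-name copies
  marks    = List.cartesianProductWith mark-name labels copies
  names : List (∃ FlatName)
  names = presents List.++ marks List.++ pairs desc List.++ pairs less
  complete : ∀ {r} (R : FlatName r) → (r , R) List.∈ names
  complete (present i)                = ∈-++⁺ˡ (∈-map⁺ present-name (∈-allFin i))
  complete (at (marked l) (i ∷ []))   = ∈-++⁺ʳ presents (∈-++⁺ˡ (∈-cartesianProductWith⁺ mark-name (∈-labels l) (∈-allFin i)))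
  complete (at desc (i ∷ j ∷ []))     = ∈-++⁺ʳ presents (∈-++⁺ʳ marks (∈-++⁺ˡ (∈-pairs desc i j)))
  complete (at less (i ∷ j ∷ []))     = ∈-++⁺ʳ presents (∈-++⁺ʳ marks (∈-++⁺ʳ (pairs desc) (∈-pairs less i j)))

leafᶠ : Formula Γ₁ 1 0
leafᶠ = zero ≈̇ zero

twoNodesᶠ : Fin 4 → Fin 4 → Formula Γ₁ 2 2 → Formula Γ₁ 2 0
twoNodesᶠ i j φ = ∃ˢ (∃ˢ (nodeᶠ i zero (suc zero) ∧̇ nodeᶠ j (suc zero) zero ∧̇ φ))

flatᶠ : ∀ {r} → FlatName r → Formula Γ₁ r 0
flatᶠ (present i)              = ∃ˢ (nodeᶠ i zero zero)
flatᶠ (at (marked l) (i ∷ [])) = ∃ˢ (nodeᶠ i zero zero ∧̇ labelᶠ l zero)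
flatᶠ (at desc (i ∷ j ∷ []))   = twoNodesᶠ i j (⊆ᶠ (suc zero) zero)
flatᶠ (at less (i ∷ j ∷ []))   = twoNodesᶠ i j (lessᶠ (suc zero) zero)

Γ₃ : Vocabulary
Γ₃ = withCopies 3 Γ₂

unaryᶠ : (Fin 4 → FlatName 1) → Formula Γ₃ 1 0
unaryᶠ R = ⋁̇ λ i → ∃ᵉ (relation (copy i) (suc zero ∷ zero ∷ []) ∧̇ relation (old (R i)) (zero ∷ []))

binaryᶠ : TreeName 2 → Formula Γ₃ 2 0
binaryᶠ R = ⋁̇ λ i → ⋁̇ λ j → ∃ᵉ (∃ᵉ (
  relation (copy i) (suc (suc zero) ∷ suc zero ∷ []) ∧̇
  relation (copy j) (suc (suc (suc zero)) ∷ zero ∷ []) ∧̇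
  relation (old (at R (i ∷ j ∷ []))) (suc zero ∷ zero ∷ [])))

treeᶠ : ∀ {r} → TreeName r → Formula Γ₃ r 0
treeᶠ desc       = binaryᶠ desc
treeᶠ (marked l) = unaryᶠ (λ i → at (marked l) (i ∷ []))
treeᶠ less       = binaryᶠ less

-- All set quantifiers are used before the copying, where sets are sets of leaves; afterwards
-- relations are only looked up at the originals. The original of a point stays its leaf, and the
-- three copies serve one colour each.
transduction : MSOTransduction setVocabulary treeVocabulary
transduction =
  colouring 6 ◅ filtering acceptedᶠ ◅ interpretation leafᶠ flatᶠ (λ ()) ◅
  copying 3 ◅ interpretation (unaryᶠ present) treeᶠ (λ ()) ◅ ε

-- Correctness of the transduction

module Copies {𝔽 : Structure Γ₂} {𝔾 : Structure Γ₃} (isCopying : IsCopying 3 𝔽 𝔾) where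

  open IsCopying isCopying
  open Satisfaction 𝔾

  tag : Fin (size 𝔾) → Fin 4
  tag x = proj₁ (Inverse.from elements x)

  point : Fin (size 𝔾) → Fin (size 𝔽)
  point x = proj₂ (Inverse.from elements x)

  copyOf-code : ∀ x → copyOf (tag x) (point x) ≡ x
  copyOf-code = Inverse.strictlyInverseˡ elements

  code-copyOf : ∀ i z → Inverse.from elements (copyOf i z) ≡ (i , z)
  code-copyOf i z = Inverse.strictlyInverseʳ elements (i , z)

  original-injective : ∀ {y z} → original y ≡ original z → y ≡ z
  original-injective {y} {z} eq =
    cong proj₂ (trans (sym (code-copyOf zero y)) (trans (cong (Inverse.from elements) eq) (code-copyOf zero z)))

  copy⁺ : ∀ x → T (rel 𝔾 (copy (tag x)) (x ∷ original (point x) ∷ []))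
  copy⁺ x = Equivalence.from (copy-rel (tag x) x _) (point x , sym (copyOf-code x) , refl)

  copy⁻ : ∀ i x y → T (rel 𝔾 (copy i) (x ∷ y ∷ [])) → tag x ≡ i × y ≡ original (point x)
  copy⁻ i x y h with Equivalence.to (copy-rel i x y) h
  ... | z , refl , refl = cong proj₁ (code-copyOf i z) , cong original (sym (cong proj₂ (code-copyOf i z)))

  map-original-injective : ∀ {r} (xs ys : Vec (Fin (size 𝔽)) r) →
    Vec.map original xs ≡ Vec.map original ys → xs ≡ ys
  map-original-injective []       []       _  = refl
  map-original-injective (x ∷ xs) (y ∷ ys) eq = cong₂ _∷_
    (original-injective (cong Vec.head eq)) (map-original-injective xs ys (cong Vec.tail eq))

  old⁺ : ∀ {r} (R : FlatName r) xs → T (rel 𝔽 R xs) → T (rel 𝔾 (old R) (Vec.map original xs))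
  old⁺ R xs h = Equivalence.from (old-rel R _) (xs , refl , h)

  old⁻ : ∀ {r} (R : FlatName r) xs → T (rel 𝔾 (old R) (Vec.map original xs)) → T (rel 𝔽 R xs)
  old⁻ R xs h with Equivalence.to (old-rel R _) h
  ... | ys , eq , h′ = subst (λ xs → T (rel 𝔽 R xs)) (sym (map-original-injective xs ys eq)) h′

  unary-means : ∀ R x → Means (unaryᶠ R) (x ∷ []) [] (T (rel 𝔽 (R (tag x)) (point x ∷ [])))
  unary-means R x = rephrase
    (⋁-means (λ i → ∃ᵉ (relation (copy i) (suc zero ∷ zero ∷ []) ∧̇ relation (old (R i)) (zero ∷ []))) (λ i → literal))
    (λ { (i , y , c , h) → from i y (copy⁻ i x y c) h })
    (λ h → tag x , original (point x) , copy⁺ x , old⁺ (R (tag x)) (point x ∷ []) h)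
    where
    from : ∀ i y → tag x ≡ i × y ≡ original (point x) → T (rel 𝔾 (old (R i)) (y ∷ [])) →
      T (rel 𝔽 (R (tag x)) (point x ∷ []))
    from i y (refl , refl) h = old⁻ (R i) (point x ∷ []) h

  binary-means : ∀ R x y → Means (binaryᶠ R) (x ∷ y ∷ []) []
    (T (rel 𝔽 (at R (tag x ∷ tag y ∷ [])) (point x ∷ point y ∷ [])))
  binary-means R x y = rephrase
    (⋁-means _ λ i → ⋁-means (λ j → ∃ᵉ (∃ᵉ (
        relation (copy i) (suc (suc zero) ∷ suc zero ∷ []) ∧̇
        relation (copy j) (suc (suc (suc zero)) ∷ zero ∷ []) ∧̇
        relation (old (at R (i ∷ j ∷ []))) (suc zero ∷ zero ∷ [])))) λ j → literal)
    (λ { (i , j , x′ , y′ , c , d , h) → from i j x′ y′ (copy⁻ i x x′ c) (copy⁻ j y y′ d) h })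
    (λ h → tag x , tag y , original (point x) , original (point y) , copy⁺ x , copy⁺ y ,
      old⁺ (at R (tag x ∷ tag y ∷ [])) (point x ∷ point y ∷ []) h)
    where
    from : ∀ i j x′ y′ → tag x ≡ i × x′ ≡ original (point x) → tag y ≡ j × y′ ≡ original (point y) →
      T (rel 𝔾 (old (at R (i ∷ j ∷ []))) (x′ ∷ y′ ∷ [])) →
      T (rel 𝔽 (at R (tag x ∷ tag y ∷ [])) (point x ∷ point y ∷ []))
    from i j x′ y′ (refl , refl) (refl , refl) h = old⁻ (at R (i ∷ j ∷ [])) (point x ∷ point y ∷ []) h

module Correct (𝔸 : Structure Γ₁) (isSystem : IsSetSystem (forgetColours 𝔸)) where

  open Meaning 𝔸 isSystem
  open SetSystem 𝒮
  open Colours 𝒮 G C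
  open Tree 𝔸 isSystem
  open Satisfaction 𝔸

  TwoNodes : (Subset card → Subset card → Set) → Fin 4 → Fin 4 → Fin card → Fin card → Set
  TwoNodes R i j u v = ∃ λ X → ∃ λ Y → Node i u X × Node j v Y × R X Y

  two-nodes-means : ∀ {R : Subset card → Subset card → Set} {φ} i j u v →
    (∀ X Y → Means φ (u ∷ v ∷ []) (Y ∷ X ∷ []) (R X Y)) → Means (twoNodesᶠ i j φ) (u ∷ v ∷ []) [] (TwoNodes R i j u v)
  two-nodes-means i j u v m = ∃ˢ-means λ X → ∃ˢ-means λ Y →
    ∧-means (node-means i zero (suc zero)) (∧-means (node-means j (suc zero) zero) (m X Y))

  means⇔ : ∀ {e s} {φ : Formula Γ₁ e s} {ρ σ P} {A : Set} → A ⇔ (𝔸 ⊨ φ [ ρ , σ ]) → Means φ ρ σ P → A ⇔ P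
  means⇔ A⇔φ m = mk⇔ (sound m ∘ Equivalence.to A⇔φ) (Equivalence.from A⇔φ ∘ complete m)

  module _ {𝔽 : Structure Γ₂} {𝔾 : Structure Γ₃} {𝔹 : Structure treeVocabulary}
    (flat : IsInterpretation {Γ₁} {Γ₂} leafᶠ flatᶠ (λ ()) 𝔸 𝔽)
    (isCopying : IsCopying 3 𝔽 𝔾)
    (final : IsInterpretation {Γ₃} {treeVocabulary} (unaryᶠ present) treeᶠ (λ ()) 𝔾 𝔹)
    where

    private
      module F = IsInterpretation flat
      module B = IsInterpretation final
      module S = Satisfaction 𝔾

    open IsCopying isCopying using (copyOf)
    open Copies isCopying

    present⇔ : ∀ i z → T (rel 𝔽 (present i) (z ∷ [])) ⇔ ∃ (Node i (F.embed z))
    present⇔ i z = means⇔ (F.rel-⇔ (present i) (z ∷ [])) (∃ˢ-means λ X → node-means i zero zero)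

    leaf-preimage : ∀ u → ∃ λ z → F.embed z ≡ u
    leaf-preimage u = Equivalence.from (F.universe u) refl

    node-tag : Fin (size 𝔹) → Fin 4
    node-tag t = tag (B.embed t)

    node-point : Fin (size 𝔹) → Fin (size 𝔽)
    node-point t = point (B.embed t)

    binary⇔ : ∀ R s t → T (rel 𝔹 R (s ∷ t ∷ [])) ⇔ (𝔾 ⊨ binaryᶠ R [ B.embed s ∷ B.embed t ∷ [] , [] ]) →
      T (rel 𝔹 R (s ∷ t ∷ [])) ⇔
      T (rel 𝔽 (at R (node-tag s ∷ node-tag t ∷ [])) (node-point s ∷ node-point t ∷ []))
    binary⇔ R s t h = mk⇔ (S.sound m ∘ Equivalence.to h) (Equivalence.from h ∘ S.complete m)
      where m = binary-means R (B.embed s) (B.embed t)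

    abstract

      code : Code 𝔹
      code = record
        { tag            = node-tag
        ; leaf           = F.embed ∘ node-point
        ; code-injective = λ {s} {t} i≡j u≡v → B.injective (trans (sym (copyOf-code (B.embed s)))
            (trans (cong₂ copyOf i≡j (F.injective u≡v)) (copyOf-code (B.embed t))))
        ; code-complete  = code-complete
        ; node-set       = λ t → Equivalence.to (present⇔ (node-tag t) (node-point t))
            (S.sound (unary-means present (B.embed t)) (Equivalence.to (B.universe (B.embed t)) (t , refl)))
        ; desc⇔          = λ s t → trans⇔ (binary⇔ desc s t (B.rel-⇔ desc (s ∷ t ∷ [])))
            (means⇔ (F.rel-⇔ (at desc (node-tag s ∷ node-tag t ∷ [])) (node-point s ∷ node-point t ∷ []))
              (two-nodes-means (node-tag s) (node-tag t) _ _ λ X Y → ⊆-means (suc zero) zero))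
        ; marked⇔        = λ l t → trans⇔
            (let m = unary-means (λ i → at (marked l) (i ∷ [])) (B.embed t) in
             mk⇔ (S.sound m ∘ Equivalence.to (B.rel-⇔ (marked l) (t ∷ [])))
                 (Equivalence.from (B.rel-⇔ (marked l) (t ∷ [])) ∘ S.complete m))
            (means⇔ (F.rel-⇔ (at (marked l) (node-tag t ∷ [])) (node-point t ∷ []))
              (∃ˢ-means λ X → ∧-means (node-means (node-tag t) zero zero) (label-means l zero)))
        ; less⇔          = λ s t → trans⇔ (binary⇔ less s t (B.rel-⇔ less (s ∷ t ∷ [])))
            (means⇔ (F.rel-⇔ (at less (node-tag s ∷ node-tag t ∷ [])) (node-point s ∷ node-point t ∷ []))
              (two-nodes-means (node-tag s) (node-tag t) _ _ λ X Y → less-means (suc zero) zero))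
        }
        where
        trans⇔ : ∀ {A B C : Set} → A ⇔ B → B ⇔ C → A ⇔ C
        trans⇔ f g = mk⇔ (Equivalence.to g ∘ Equivalence.to f) (Equivalence.from f ∘ Equivalence.from g)
        code-complete : ∀ i u X → Node i u X → ∃ λ t → node-tag t ≡ i × F.embed (node-point t) ≡ u
        code-complete i u X node with leaf-preimage u
        ... | z , refl with Equivalence.from (B.universe (copyOf i z)) (S.complete (unary-means present (copyOf i z))
                (subst (λ (i , z) → T (rel 𝔽 (present i) (z ∷ []))) (sym (code-copyOf i z))
                  (Equivalence.from (present⇔ i z) (X , node))))
        ...   | t , eq = t , cong proj₁ code-eq , cong (F.embed ∘ proj₂) code-eq
          where
          code-eq : (node-tag t , node-point t) ≡ (i , z)
          code-eq = trans (cong (λ x → tag x , point x) eq) (code-copyOf i z)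

sound-output : ∀ 𝔸 (isSystem : IsSetSystem 𝔸) → WeaklyPartitive (systemOf 𝔸 isSystem) → ∀ 𝔹 → ⟦ transduction ⟧ 𝔸 𝔹 →
  ∃ λ (W : WeaklyPartitiveTree (systemOf 𝔸 isSystem)) → 𝔹 ≅ treeStructure W
sound-output _ isSystem wp _ (𝔸 , refl , _ , (χ , refl) , 𝔽 , flat , 𝔾 , isCopying , 𝔹 , final , refl) =
  weaklyPartitiveTree , isomorphic
  where
  open Tree.Decode 𝔸 isSystem wp (Satisfaction.sound (Meaning.accepted-means 𝔸 isSystem) χ)
    (Correct.code 𝔸 isSystem flat isCopying final)

-- Existence of an output

interpretation-output : ∀ {Γ Δ} (φ : Formula Γ 1 0)
  (ψʳ : ∀ {r} → RelName Δ r → Formula Γ r 0) (ψˢ : ∀ {r} → SetName Δ r → Formula Γ 0 r) 𝔸 →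
  ∃ λ 𝔹 → IsInterpretation {Γ} {Δ} φ ψʳ ψˢ 𝔸 𝔹
interpretation-output φ ψʳ ψˢ 𝔸 = record
  { size = total
  ; rel  = λ R ys → does (sat? 𝔸 (ψʳ R) (Vec.map element ys) [])
  ; pred = λ R Ys → does (sat? 𝔸 (ψˢ R) [] (Vec.map (image element) Ys))
  } , record
  { embed     = element
  ; injective = injective
  ; universe  = λ x → mk⇔ (λ { (y , refl) → sound y }) (complete x)
  ; rel-⇔     = λ R ys → mk⇔ (T-does⁻ (sat? 𝔸 (ψʳ R) _ _)) (T-does⁺ (sat? 𝔸 (ψʳ R) _ _))
  ; pred-⇔    = λ R Ys → mk⇔ (T-does⁻ (sat? 𝔸 (ψˢ R) _ _)) (T-does⁺ (sat? 𝔸 (ψˢ R) _ _))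
  }
  where open Enumeration (enumerateFin (λ x → sat? 𝔸 φ (x ∷ []) []))

-- Set predicates would have to be carried along images of sets; the flat vocabulary copied here has
-- none.
copying-output : ∀ {Γ} k → (∀ {r} → ¬ SetName Γ r) → (𝔸 : Structure Γ) → ∃ (IsCopying k 𝔸)
copying-output {Γ} k no-sets 𝔸 = record
  { size = suc k ℕ.* size 𝔸
  ; rel  = λ { (old R) ys → does (old? R ys) ; (copy i) (x ∷ y ∷ []) → does (copy? i x y) }
  ; pred = λ R → contradiction R no-sets
  } , record
  { elements = elements
  ; old-rel  = λ R ys → mk⇔ (T-does⁻ (old? R ys)) (T-does⁺ (old? R ys))
  ; old-pred = λ R → contradiction R no-sets
  ; copy-rel = λ i x y → mk⇔ (T-does⁻ (copy? i x y)) (T-does⁺ (copy? i x y))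
  }
  where
  elements : (Fin (suc k) × Fin (size 𝔸)) ↔ Fin (suc k ℕ.* size 𝔸)
  elements = ↔-sym *↔×
  original : Fin (size 𝔸) → Fin (suc k ℕ.* size 𝔸)
  original x = Inverse.to elements (zero , x)
  point : Fin (suc k ℕ.* size 𝔸) → Fin (size 𝔸)
  point y = proj₂ (Inverse.from elements y)
  points-originals : ∀ {r} (xs : Vec (Fin (size 𝔸)) r) → Vec.map point (Vec.map original xs) ≡ xs
  points-originals []       = refl
  points-originals (x ∷ xs) = cong₂ _∷_ (cong proj₂ (Inverse.strictlyInverseʳ elements (zero , x))) (points-originals xs)
  old? : ∀ {r} (R : RelName Γ r) ys → Dec (∃ λ xs → ys ≡ Vec.map original xs × T (rel 𝔸 R xs))
  -- The tuple of points under `ys` is the only possible preimage, so there is nothing to search.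
  old? R ys = map′ (λ h → Vec.map point ys , h)
    (λ { (xs , refl , h) → subst (λ xs′ → Vec.map original xs ≡ Vec.map original xs′ × T (rel 𝔸 R xs′))
                             (sym (points-originals xs)) (refl , h) })
    (≡-dec Fin._≟_ ys (Vec.map original (Vec.map point ys)) ×-dec T? (rel 𝔸 R (Vec.map point ys)))
  copy? : ∀ i x y → Dec (∃ λ z → x ≡ Inverse.to elements (i , z) × y ≡ original z)
  copy? i x y = any? λ z → (x Fin.≟ _) ×-dec (y Fin.≟ _)

colourBy : ∀ {Γ} k (𝔸 : Structure Γ) → (Fin k → Fin (size 𝔸) → Bool) → Structure (withColours k Γ)
colourBy k 𝔸 mark = record
  { size = size 𝔸
  ; rel  = λ { (old R) xs → rel 𝔸 R xs ; (colour i) (x ∷ []) → mark i x }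
  ; pred = pred 𝔸
  }

module Output (𝔸 : Structure setVocabulary) (isSystem : IsSetSystem 𝔸) (wp : WeaklyPartitive (systemOf 𝔸 isSystem)) where

  open Colouring (systemOf 𝔸 isSystem) wp

  ChosenFor : Fin 3 → Fin (size 𝔸) → Set
  ChosenFor i u = ∃ λ P → κ P ≡ i × Chosen P u

  chosenFor? : ∀ i u → Dec (ChosenFor i u)
  chosenFor? i u = someSubset? λ P → (κ P Fin.≟ i) ×-dec chosen? P u

  mark : Fin 6 → Fin (size 𝔸) → Bool
  mark k u = [ (λ i → does (κ ⁅ u ⁆ Fin.≟ i)) , (λ i → does (chosenFor? i u)) ]′ (Fin.splitAt 3 k)

  markG≡ : ∀ i u → mark (markG i) u ≡ does (κ ⁅ u ⁆ Fin.≟ i)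
  markG≡ i u = cong [ (λ i → does (κ ⁅ u ⁆ Fin.≟ i)) , (λ i → does (chosenFor? i u)) ]′ (splitAt-↑ˡ 3 i 3)

  markC≡ : ∀ i u → mark (markC i) u ≡ does (chosenFor? i u)
  markC≡ i u = cong [ (λ i → does (κ ⁅ u ⁆ Fin.≟ i)) , (λ i → does (chosenFor? i u)) ]′ (splitAt-↑ʳ 3 3 i)

  coloured : Structure Γ₁
  coloured = colourBy 6 𝔸 mark

  accepts : coloured ⊨ acceptedᶠ [ [] , [] ]
  accepts = Satisfaction.complete (Meaning.accepted-means coloured isSystem) (Accepting.accepted G C
    (λ {i} {u} eq → subst T (sym (markG≡ i u)) (T-does⁺ (κ ⁅ u ⁆ Fin.≟ i) eq))
    (λ {i} {u} h → T-does⁻ (κ ⁅ u ⁆ Fin.≟ i) (subst T (markG≡ i u) h))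
    (λ {i} {u} P κP≡i c → subst T (sym (markC≡ i u)) (T-does⁺ (chosenFor? i u) (P , κP≡i , c)))
    (λ {i} {u} h → T-does⁻ (chosenFor? i u) (subst T (markC≡ i u) h)))
    where open Meaning coloured isSystem using (G; C)

  output : ∃ λ 𝔹 → ⟦ transduction ⟧ 𝔸 𝔹
  output =
    let 𝔽 , flat      = interpretation-output leafᶠ flatᶠ (λ ()) coloured
        𝔾 , isCopying = copying-output 3 id 𝔽
        𝔹 , final     = interpretation-output (unaryᶠ present) treeᶠ (λ ()) 𝔾 in
    𝔹 , coloured , refl , coloured , (accepts , refl) , 𝔽 , flat , 𝔾 , isCopying , 𝔹 , final , refl

-- The set system rebuilt from `setStructure 𝒮` is definitionally `𝒮`, so what is proved about
-- `systemOf` speaks of `𝒮` directly.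
isSetSystem : ∀ 𝒮 → IsSetSystem (setStructure 𝒮)
isSetSystem 𝒮 = record
  { size≢0 = card≢0 ; members-nonempty = members-nonempty ; whole∈𝒮 = whole∈𝒮 ; singleton∈𝒮 = singleton∈𝒮 }
  where open SetSystem 𝒮

corollary5 : ∃ λ (τ : MSOTransduction setVocabulary treeVocabulary) →
    ∀ (𝒮 : SetSystem) → WeaklyPartitive 𝒮 →
    (∃ λ 𝔹 → ⟦ τ ⟧ (setStructure 𝒮) 𝔹) ×
    (∀ 𝔹 → ⟦ τ ⟧ (setStructure 𝒮) 𝔹 →
    ∃ λ (W : WeaklyPartitiveTree 𝒮) → 𝔹 ≅ treeStructure W)
corollary5 = transduction , λ 𝒮 wp →
  Output.output (setStructure 𝒮) (isSetSystem 𝒮) wp ,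
  sound-output (setStructure 𝒮) (isSetSystem 𝒮) wp
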